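{- Let $G$ be a finite abelian group and let $A$, $B$ and $S$ be non-empty subsets of $G$. Suppose that $$\min\{|A|,|B|\}\geq 9|S|^2-5|S|-3.$$ Then $$|A\dotplus_S B|\geq\min\{|A|+|B|-|S|-2,\ p(G)\}.$$
   Context: For subsets $A,B,S$ of an abelian group $G$ (written additively), the generalized restricted sumset is $A\dotplus_S B:=\{a+b:\ a\in A,\ b\in B,\ a-b\notin S\}$. For a finite group $G$, $p(G)$ denotes the least prime factor of $|G|$. -}

module Defs where

open import Data.Nat using (ℕ)
open import Data.Fin using (Fin)
open import Data.Fin.Properties using (any?; _≟_)
open import Data.Fin.Subset using (Subset; _∈_; _∉_)
open import Data.Fin.Subset.Properties using (_∈?_)
open import Data.Vec using (tabulate)
open import Data.Product using (∃; _×_; _,_)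
open import Relation.Nullary using (does; ¬?)
open import Relation.Nullary.Decidable using (_×-dec_)
open import Relation.Binary.PropositionalEquality using (_≡_)
open import Algebra.Structures using (IsAbelianGroup)

-- A finite abelian group of order n, presented on the carrier Fin n
-- (every finite group is isomorphic to one on Fin |G|), with
-- propositional equality as the group's equality.
record FinAbGroup (n : ℕ) : Set where
  field
    _+_ : Fin n → Fin n → Fin n
    0#  : Fin n
    -_  : Fin n → Fin n
    isAbelianGroup : IsAbelianGroup _≡_ _+_ 0# -_

  infixl 6 _+_ _-_
  _-_ : Fin n → Fin n → Fin n
  x - y = x + (- y)

restrictedSumset : ∀ {n} → FinAbGroup n → Subset n → Subset n → Subset n → Subset n
restrictedSumset G A B S = tabulate λ x →
  does (any? λ a → any? λ b →
    (a ∈? A) ×-dec ((b ∈? B) ×-dec (¬? ((a - b) ∈? S) ×-dec (a + b ≟ x))))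
  where open FinAbGroup G

open import Data.Nat using (_≤_)
open import Data.Nat.Divisibility using (_∣_)
open import Data.Nat.Primality using (Prime)

IsLeastPrimeFactor : ℕ → ℕ → Set
IsLeastPrimeFactor n p = Prime p × p ∣ n × (∀ q → Prime q → q ∣ n → p ≤ q)

{-# OPTIONS --safe #-}
-- Only a set C that covers the restricted sumset of A and B and has fewer than p elements needs to be considered. The
-- case p = 2 is trivial. Otherwise adjoin elements to the trivial subgroup so that every index q is a prime factor of
-- |G|, hence odd and ≥ p, and prove the bounds for A and B inside cosets of the subgroup reached.
--
-- In ℤ/q the polynomial ∏ (x - y - d) ∏ (x + y - z), over d ∈ D and z ∈ Z, vanishes on X × Y. Weights on X and on Y
-- with vanishing lower moments extract its top coefficients, which are coefficients of (t - 1)^|D| (t + 1)^|Z|. Two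
-- adjacent ones are not both zero modulo q, so |X| + |Y| ≤ |Z| + |D| + 2.
--
-- For K of index q in K′, let a, b, c, σ be the sizes of the fibres of A, B, C, S over K′/K ≅ ℤ/q. The weak bound
-- |A| + |B| ≤ |C| + 5 |S| - 2 holds for the fibres. Summing it over the row of the largest fibre of B leaves a gap that
-- is closed by the part of C outside the row; the inequality in ℤ/q, applied to the supports or to the level sets of
-- a and b, makes that part large. This gives the weak bound for K′. If |A| and |B| are large and A or B meets two cosets
-- of K, it also gives |A| + |B| ≤ |C| + |S| + 2, without using that bound for the fibres.
module Submission where

-- The sharp bound cannot be carried up the chain of subgroups by itself: fibres of A and B may be
-- tiny while one fibre contains all of S, so the size hypothesis is lost on passing to cosets. The
-- weak bound has no size hypothesis and therefore descends to fibres. Its excess over the sharp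
-- bound is 4 |S| - 4, which vanishes for |S| = 1; otherwise it has to be repaid at the step where A
-- or B meets two cosets. When B meets few cosets, |A| and |B| being quadratic in |S| makes the
-- largest fibres tall enough for that; when it meets many, the level sets do it. C is an arbitrary
-- covering set because a coset of the restricted sumset collects sums from several pairs of fibres:
-- it need not be the restricted sumset of any one pair, but it covers each of them. The condition
-- |C| < p acts through p ≤ q: supports and level sets of c have fewer than q elements, as the
-- inequalities in ℤ/q require. That q is odd allows a factor 2 to be cancelled in the coefficients
-- of (t - 1)^r (t + 1)^(q-1).

module Counting where

  open import Data.Bool using (Bool; true; false; T; not; if_then_else_; _∧_)
  open import Data.Bool.Properties using (T-∧)
  open import Data.Nat using (ℕ; zero; suc; _+_; _*_; _≤_; z≤n; s≤s; _<ᵇ_)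
  open import Data.Nat.Properties
  open import Data.Fin using (Fin; zero; suc; toℕ)
  import Data.Fin.Properties as Finₚ
  open import Data.Product using (∃; _×_; _,_)
  open import Data.Sum using (inj₁; inj₂)
  open import Data.Empty using (⊥-elim)
  open import Data.Unit using (tt)
  open import Function using (_∘_; Equivalence)
  open import Relation.Nullary using (Dec; yes; no; does)
  open import Relation.Binary.PropositionalEquality
  open import Algebra.Properties.CommutativeMonoid.Sum +-0-commutativeMonoid
    using (sum; sum-cong-≗; ∑-distrib-+; ∑-comm; sum-replicate-zero)
  open import Data.Nat.Tactic.RingSolver using (solve-∀)

  witness : ∀ {P : Set} (d : Dec P) → T (does d) → P
  witness (yes p) _ = p

  holds : ∀ {P : Set} (d : Dec P) → P → T (does d)
  holds (yes _) _ = tt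
  holds (no ¬p) p = ⊥-elim (¬p p)

  ∧-intro : ∀ {x y} → T x → T y → T (x ∧ y)
  ∧-intro p q = Equivalence.from T-∧ (p , q)

  ∧-elim : ∀ {x y} → T (x ∧ y) → T x × T y
  ∧-elim = Equivalence.to T-∧

  -- A certificate for linear arithmetic: `L ≤ R` is a sum of hypotheses formed with `_⊞_`, `e` is
  -- the slack, and the ring solver checks the identity. No subtraction of natural numbers occurs.
  ≤-from : ∀ {x y L R} → L ≤ R → ∀ e → x + R + e ≡ y + L → x ≤ y
  ≤-from {x} {y} {L} {R} L≤R e eq = +-cancelʳ-≤ R x y (begin
    x + R      ≤⟨ m≤m+n (x + R) e ⟩
    x + R + e  ≡⟨ eq ⟩
    y + L      ≤⟨ +-monoʳ-≤ y L≤R ⟩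
    y + R      ∎)
    where open ≤-Reasoning

  infixr 6 _⊞_
  _⊞_ : ∀ {a b c d} → a ≤ b → c ≤ d → a + c ≤ b + d
  _⊞_ = +-mono-≤

  -- Sums and counts over finite sets

  sum-mono : ∀ {n} {f g : Fin n → ℕ} → (∀ i → f i ≤ g i) → sum f ≤ sum g
  sum-mono {zero}  _ = z≤n
  sum-mono {suc n} h = h zero ⊞ sum-mono (h ∘ suc)

  term≤sum : ∀ {n} (f : Fin n → ℕ) i → f i ≤ sum f
  term≤sum f zero    = m≤m+n _ _
  term≤sum f (suc i) = ≤-trans (term≤sum (f ∘ suc) i) (m≤n+m _ _)

  sum-*ʳ : ∀ {n} (f : Fin n → ℕ) c → sum (λ i → f i * c) ≡ sum f * c
  sum-*ʳ {zero}  f c = refl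
  sum-*ʳ {suc n} f c rewrite sum-*ʳ (f ∘ suc) c = sym (*-distribʳ-+ c (f zero) _)

  sum-const : ∀ n c → sum {n} (λ _ → c) ≡ n * c
  sum-const zero    c = refl
  sum-const (suc n) c = cong (c +_) (sum-const n c)

  sum-split : ∀ (f : ℕ → ℕ) m n → sum {m + n} (f ∘ toℕ) ≡ sum {m} (f ∘ toℕ) + sum {n} (λ i → f (m + toℕ i))
  sum-split f zero    n = refl
  sum-split f (suc m) n = trans (cong (f 0 +_) (sum-split (f ∘ suc) m n)) (sym (+-assoc (f 0) _ _))

  omit : ∀ {n} → Fin n → (Fin n → ℕ) → Fin n → ℕ
  omit k f i = if does (i Finₚ.≟ k) then 0 else f i

  omit-≢ : ∀ {n} {k i : Fin n} (f : Fin n → ℕ) → i ≢ k → omit k f i ≡ f i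
  omit-≢ {k = k} {i} f i≢k with i Finₚ.≟ k
  ... | yes i≡k = ⊥-elim (i≢k i≡k)
  ... | no  _   = refl

  sum-omit : ∀ {n} (f : Fin n → ℕ) k → sum f ≡ f k + sum (omit k f)
  sum-omit f zero    = refl
  sum-omit f (suc k) rewrite sum-omit (f ∘ suc) k = +-swap (f zero) (f (suc k)) _
    where
    +-swap : ∀ a b c → a + (b + c) ≡ b + (a + c)
    +-swap = solve-∀

  -- Injectivity is demanded only where `f` is positive, so default values of `φ` may collide. The
  -- induction removes the value at `φ zero` from `g`.
  sum-inj : ∀ {m n} (f : Fin m → ℕ) (g : Fin n → ℕ) (φ : Fin m → Fin n) →
            (∀ i → f i ≤ g (φ i)) →
            (∀ i i′ → 1 ≤ f i → 1 ≤ f i′ → φ i ≡ φ i′ → i ≡ i′) →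
            sum f ≤ sum g
  sum-inj {zero}  f g φ f≤g inj = z≤n
  sum-inj {suc m} f g φ f≤g inj with f zero in f0
  ... | zero = sum-inj (f ∘ suc) g (φ ∘ suc) (f≤g ∘ suc)
                 (λ i i′ p p′ e → Finₚ.suc-injective (inj (suc i) (suc i′) p p′ e))
  ... | suc x = begin
    suc x + sum (f ∘ suc)                     ≤⟨ subst (_≤ g (φ zero)) f0 (f≤g zero) ⊞ rest ⟩
    g (φ zero) + sum (omit (φ zero) g)        ≡⟨ sum-omit g (φ zero) ⟨
    sum g                                     ∎
    where
    open ≤-Reasoning
    below : ∀ i → f (suc i) ≤ omit (φ zero) g (φ (suc i))
    below i with f (suc i) in fi
    ... | zero  = z≤n
    ... | suc y = subst (suc y ≤_) (sym (omit-≢ g ne)) (subst (_≤ g (φ (suc i))) fi (f≤g (suc i)))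
      where
      ne : φ (suc i) ≢ φ zero
      ne e with inj (suc i) zero (subst (1 ≤_) (sym fi) (s≤s z≤n)) (subst (1 ≤_) (sym f0) (s≤s z≤n)) e
      ... | ()
    rest : sum (f ∘ suc) ≤ sum (omit (φ zero) g)
    rest = sum-inj (f ∘ suc) (omit (φ zero) g) (φ ∘ suc) below
             (λ i i′ p p′ e → Finₚ.suc-injective (inj (suc i) (suc i′) p p′ e))

  𝟙 : Bool → ℕ
  𝟙 true  = 1
  𝟙 false = 0

  𝟙≤1 : ∀ b → 𝟙 b ≤ 1
  𝟙≤1 true  = ≤-refl
  𝟙≤1 false = z≤n

  𝟙-T : ∀ {b} → T b → 𝟙 b ≡ 1
  𝟙-T {true} _ = refl

  𝟙⇒T : ∀ {b} → 1 ≤ 𝟙 b → T b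
  𝟙⇒T {true} _ = tt

  𝟙-mono : ∀ {b c} → (T b → T c) → 𝟙 b ≤ 𝟙 c
  𝟙-mono {true}  h = ≤-reflexive (sym (𝟙-T (h tt)))
  𝟙-mono {false} h = z≤n

  𝟙-≤ : ∀ {b n} → (T b → 1 ≤ n) → 𝟙 b ≤ n
  𝟙-≤ {true}  h = h tt
  𝟙-≤ {false} h = z≤n

  # : ∀ {n} → (Fin n → Bool) → ℕ
  # P = sum (𝟙 ∘ P)

  #-mono : ∀ {n} {P Q : Fin n → Bool} → (∀ i → T (P i) → T (Q i)) → # P ≤ # Q
  #-mono h = sum-mono λ i → 𝟙-mono (h i)

  #-inj : ∀ {m n} {P : Fin m → Bool} {Q : Fin n → Bool} (φ : Fin m → Fin n) →
          (∀ i → T (P i) → T (Q (φ i))) →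
          (∀ i i′ → T (P i) → T (P i′) → φ i ≡ φ i′ → i ≡ i′) → # P ≤ # Q
  #-inj {P = P} {Q} φ h inj = sum-inj (𝟙 ∘ P) (𝟙 ∘ Q) φ (λ i → 𝟙-mono (h i))
    λ i i′ p p′ → inj i i′ (𝟙⇒T p) (𝟙⇒T p′)

  #-⊎ : ∀ {n} (P Q : Fin n → Bool) → # P ≡ # (λ i → P i ∧ Q i) + # (λ i → P i ∧ not (Q i))
  #-⊎ P Q = trans (sum-cong-≗ λ i → split (P i) (Q i))
                  (∑-distrib-+ (λ i → 𝟙 (P i ∧ Q i)) (λ i → 𝟙 (P i ∧ not (Q i))))
    where
    split : ∀ p q → 𝟙 p ≡ 𝟙 (p ∧ q) + 𝟙 (p ∧ not q)
    split true  true  = refl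
    split true  false = refl
    split false q     = refl

  #-pos : ∀ {n} {P : Fin n → Bool} i → T (P i) → 1 ≤ # P
  #-pos {P = P} i p = ≤-trans (≤-reflexive (sym (𝟙-T p))) (term≤sum (𝟙 ∘ P) i)

  sum-pos : ∀ {n} (f : Fin n → ℕ) → 1 ≤ sum f → ∃ λ i → 1 ≤ f i
  sum-pos {suc n} f h with f zero in eq
  ... | suc x = zero , subst (1 ≤_) (sym eq) (s≤s z≤n)
  ... | zero  with sum-pos (f ∘ suc) h
  ...   | i , p = suc i , p

  #-witness : ∀ {n} (P : Fin n → Bool) → 1 ≤ # P → ∃ λ i → T (P i)
  #-witness P h with sum-pos (𝟙 ∘ P) h
  ... | i , p = i , 𝟙⇒T p

  #≤n : ∀ {n} (P : Fin n → Bool) → # P ≤ n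
  #≤n {n} P = ≤-trans (sum-mono (𝟙≤1 ∘ P)) (≤-reflexive (trans (sum-const n 1) (*-identityʳ n)))

  sum-indicator : ∀ {n} (k : Fin n) (x : ℕ) → sum (λ i → if does (k Finₚ.≟ i) then x else 0) ≡ x
  sum-indicator {suc n} zero    x = trans (cong (x +_) (sum-replicate-zero n)) (+-identityʳ x)
  sum-indicator {suc n} (suc k) x = sum-indicator k x

  #-fibres : ∀ {n q} (P : Fin n → Bool) (χ : Fin n → Fin q) →
             sum (λ k → # (λ x → P x ∧ does (χ x Finₚ.≟ k))) ≡ # P
  #-fibres {n} {q} P χ = trans (∑-comm (λ k x → 𝟙 (P x ∧ does (χ x Finₚ.≟ k)))) (sum-cong-≗ pointwise)
    where
    pointwise : ∀ x → sum (λ k → 𝟙 (P x ∧ does (χ x Finₚ.≟ k))) ≡ 𝟙 (P x)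
    pointwise x with P x
    ... | false = sum-replicate-zero q
    ... | true  = trans (sum-cong-≗ λ k → 𝟙-if (does (χ x Finₚ.≟ k))) (sum-indicator (χ x) 1)
      where
      𝟙-if : ∀ b → 𝟙 b ≡ (if b then 1 else 0)
      𝟙-if true  = refl
      𝟙-if false = refl

  supp : ∀ {n} → (Fin n → ℕ) → Fin n → Bool
  supp f i = 0 <ᵇ f i

  #supp≤sum : ∀ {n} (f : Fin n → ℕ) → # (supp f) ≤ sum f
  #supp≤sum f = sum-mono λ i → 𝟙-≤ (<ᵇ⇒< 0 (f i))

  upper : ∀ {n} → (Fin n → ℕ) → ℕ → Fin n → Bool
  upper f t i = t <ᵇ f i

  sum-below : ∀ N x → sum {N} (λ w → 𝟙 (toℕ w <ᵇ x)) ≤ x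
  sum-below zero    x       = z≤n
  sum-below (suc N) zero    = ≤-reflexive (sum-replicate-zero N)
  sum-below (suc N) (suc x) = s≤s (sum-below N x)

  sum-below-≡ : ∀ N x → x ≤ N → sum {N} (λ w → 𝟙 (toℕ w <ᵇ x)) ≡ x
  sum-below-≡ N       zero    _         = sum-replicate-zero N
  sum-below-≡ (suc N) (suc x) (s≤s x≤N) = cong suc (sum-below-≡ N x x≤N)

  -- Layer-cake summation: the level sets below height `N` count each `i` exactly min (f i) N times.
  levels≤sum : ∀ {n} (f : Fin n → ℕ) N → sum {N} (λ w → # (upper f (toℕ w))) ≤ sum f
  levels≤sum f N = ≤-trans (≤-reflexive (∑-comm {N} (λ w i → 𝟙 (toℕ w <ᵇ f i))))
                           (sum-mono λ i → sum-below N (f i))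

  sum≡levels : ∀ {n} (f : Fin n → ℕ) N → (∀ i → f i ≤ N) → sum {N} (λ w → # (upper f (toℕ w))) ≡ sum f
  sum≡levels f N f≤N = trans (∑-comm {N} (λ w i → 𝟙 (toℕ w <ᵇ f i)))
                             (sum-cong-≗ λ i → sum-below-≡ N (f i) (f≤N i))

  argmax : ∀ {n} (f : Fin n → ℕ) → Fin n → ∃ λ i → ∀ j → f j ≤ f i
  argmax {suc zero} f _ = zero , λ { zero → ≤-refl }
  argmax {suc (suc n)} f _ with argmax (f ∘ suc) zero
  ... | i , max with ≤-total (f zero) (f (suc i))
  ...   | inj₁ le = suc i , λ { zero → le ; (suc j) → max j }
  ...   | inj₂ ge = zero , λ { zero → ≤-refl ; (suc j) → ≤-trans (max j) ge }

-- Integer coefficients of (t - 1)^r (t + 1)^M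

module Coefficients where

  open import Data.Nat as ℕ using (ℕ; zero; suc; s≤s)
  import Data.Nat.Properties as ℕₚ
  open import Data.Integer using (ℤ; +_; 0ℤ; 1ℤ; -1ℤ; _+_; _-_; _*_; -_)
  open import Data.Integer.Properties
  open import Data.Integer.Divisibility.Signed
  open import Data.Integer.Tactic.RingSolver using (solve-∀)
  open import Relation.Binary.PropositionalEquality

  shift : (ℕ → ℤ) → ℕ → ℤ
  shift f zero    = 0ℤ
  shift f (suc k) = f k

  -- coeff r M k is the coefficient of t^k in (t - 1)^r (t + 1)^M.
  coeff : ℕ → ℕ → ℕ → ℤ
  coeff zero    zero    zero    = 1ℤ
  coeff zero    zero    (suc k) = 0ℤ
  coeff zero    (suc M) k       = shift (coeff zero M) k + 1ℤ * coeff zero M k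
  coeff (suc r) M       k       = shift (coeff r M) k + -1ℤ * coeff r M k

  -- The recursion multiplies by the factors t + 1 first. Commuting one of them past all factors t -
  -- 1 makes it the outermost one.
  coeff-sucʳ : ∀ r M k → coeff r (suc M) k ≡ shift (coeff r M) k + 1ℤ * coeff r M k
  coeff-sucʳ zero    M k       = refl
  coeff-sucʳ (suc r) M zero    = trans (cong (λ z → 0ℤ + -1ℤ * z) (coeff-sucʳ r M zero)) (lem (coeff r M 0))
    where
    lem : ∀ a → 0ℤ + -1ℤ * (0ℤ + 1ℤ * a) ≡ 0ℤ + 1ℤ * (0ℤ + -1ℤ * a)
    lem = solve-∀
  coeff-sucʳ (suc r) M (suc k) =
    trans (cong₂ (λ z w → z + -1ℤ * w) (coeff-sucʳ r M k) (coeff-sucʳ r M (suc k)))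
          (lem (shift (coeff r M) k) (coeff r M k) (coeff r M (suc k)))
    where
    lem : ∀ a b c → (a + 1ℤ * b) + -1ℤ * (b + 1ℤ * c) ≡ (a + -1ℤ * b) + 1ℤ * (b + -1ℤ * c)
    lem = solve-∀

  coeff-degree : ∀ r M k → r ℕ.+ M ℕ.< k → coeff r M k ≡ 0ℤ
  coeff-degree zero    zero    (suc k) _        = refl
  coeff-degree zero    (suc M) (suc k) (s≤s lt)
    rewrite coeff-degree zero M k lt | coeff-degree zero M (suc k) (ℕₚ.m≤n⇒m≤1+n lt) = refl
  coeff-degree (suc r) M       (suc k) (s≤s lt)
    rewrite coeff-degree r M k lt | coeff-degree r M (suc k) (ℕₚ.m≤n⇒m≤1+n lt) = refl

  -- The constant term is ±1; squaring it avoids tracking the sign.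
  coeff-0² : ∀ r M → coeff r M 0 * coeff r M 0 ≡ 1ℤ
  coeff-0² zero    zero    = refl
  coeff-0² zero    (suc M) = trans (lem (coeff 0 M 0)) (coeff-0² zero M)
    where
    lem : ∀ a → (0ℤ + 1ℤ * a) * (0ℤ + 1ℤ * a) ≡ a * a
    lem = solve-∀
  coeff-0² (suc r) M       = trans (lem (coeff r M 0)) (coeff-0² r M)
    where
    lem : ∀ a → (0ℤ + -1ℤ * a) * (0ℤ + -1ℤ * a) ≡ a * a
    lem = solve-∀

  -- The differential equation (t² - 1) f′ = (r (t + 1) + M (t - 1)) f of f = (t - 1)^r (t + 1)^M.
  coeff-recurrence : ∀ r M k →
    (1ℤ + + k) * coeff r M (suc k) + (+ r + + M - + k + 1ℤ) * shift (coeff r M) k ≡ (+ M - + r) * coeff r M k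
  coeff-recurrence zero zero zero    = refl
  coeff-recurrence zero zero (suc zero)    = refl
  coeff-recurrence zero zero (suc (suc k)) = lem (1ℤ + (1ℤ + (1ℤ + + k))) (+ 0 + + 0 - + (suc (suc k)) + 1ℤ) (+ 0 - + 0)
    where
    lem : ∀ a b c → a * 0ℤ + b * 0ℤ ≡ c * 0ℤ
    lem = solve-∀
  coeff-recurrence zero (suc M) zero = begin
    (1ℤ + 0ℤ) * (a + 1ℤ * b) + (0ℤ + (1ℤ + m) - 0ℤ + 1ℤ) * 0ℤ
      ≡⟨ lem₁ a b m ⟩
    ((1ℤ + 0ℤ) * b + (0ℤ + m - 0ℤ + 1ℤ) * 0ℤ) + a
      ≡⟨ cong (_+ a) (coeff-recurrence zero M zero) ⟩
    (m - 0ℤ) * a + a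
      ≡⟨ lem₂ a m ⟩
    ((1ℤ + m) - 0ℤ) * (0ℤ + 1ℤ * a) ∎
    where
    open ≡-Reasoning
    m = + M
    a = coeff 0 M 0
    b = coeff 0 M 1
    lem₁ : ∀ a b m → (1ℤ + 0ℤ) * (a + 1ℤ * b) + (0ℤ + (1ℤ + m) - 0ℤ + 1ℤ) * 0ℤ
                   ≡ ((1ℤ + 0ℤ) * b + (0ℤ + m - 0ℤ + 1ℤ) * 0ℤ) + a
    lem₁ = solve-∀
    lem₂ : ∀ a m → (m - 0ℤ) * a + a ≡ ((1ℤ + m) - 0ℤ) * (0ℤ + 1ℤ * a)
    lem₂ = solve-∀
  coeff-recurrence zero (suc M) (suc k) = begin
    (1ℤ + (1ℤ + κ)) * (b + 1ℤ * a) + (0ℤ + (1ℤ + m) - (1ℤ + κ) + 1ℤ) * (d + 1ℤ * c)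
      ≡⟨ lem₁ a b c d κ m ⟩
    ((1ℤ + (1ℤ + κ)) * a + (0ℤ + m - (1ℤ + κ) + 1ℤ) * c) + ((1ℤ + κ) * b + (0ℤ + m - κ + 1ℤ) * d) + (b + c)
      ≡⟨ cong₂ (λ x y → x + y + (b + c)) (coeff-recurrence zero M (suc k)) (coeff-recurrence zero M k) ⟩
    (m - 0ℤ) * b + (m - 0ℤ) * c + (b + c)
      ≡⟨ lem₂ b c m ⟩
    ((1ℤ + m) - 0ℤ) * (c + 1ℤ * b) ∎
    where
    open ≡-Reasoning
    m = + M
    κ = + k
    a = coeff 0 M (suc (suc k))
    b = coeff 0 M (suc k)
    c = coeff 0 M k
    d = shift (coeff 0 M) k
    lem₁ : ∀ a b c d κ m →
      (1ℤ + (1ℤ + κ)) * (b + 1ℤ * a) + (0ℤ + (1ℤ + m) - (1ℤ + κ) + 1ℤ) * (d + 1ℤ * c)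
      ≡ ((1ℤ + (1ℤ + κ)) * a + (0ℤ + m - (1ℤ + κ) + 1ℤ) * c) + ((1ℤ + κ) * b + (0ℤ + m - κ + 1ℤ) * d) + (b + c)
    lem₁ = solve-∀
    lem₂ : ∀ b c m → (m - 0ℤ) * b + (m - 0ℤ) * c + (b + c) ≡ ((1ℤ + m) - 0ℤ) * (c + 1ℤ * b)
    lem₂ = solve-∀
  coeff-recurrence (suc r) M zero = begin
    (1ℤ + 0ℤ) * (a + -1ℤ * b) + ((1ℤ + ρ) + m - 0ℤ + 1ℤ) * 0ℤ
      ≡⟨ lem₁ a b m ρ ⟩
    a - ((1ℤ + 0ℤ) * b + (ρ + m - 0ℤ + 1ℤ) * 0ℤ)
      ≡⟨ cong (_-_ a) (coeff-recurrence r M zero) ⟩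
    a - (m - ρ) * a
      ≡⟨ lem₂ a m ρ ⟩
    (m - (1ℤ + ρ)) * (0ℤ + -1ℤ * a) ∎
    where
    open ≡-Reasoning
    m = + M
    ρ = + r
    a = coeff r M 0
    b = coeff r M 1
    lem₁ : ∀ a b m ρ → (1ℤ + 0ℤ) * (a + -1ℤ * b) + ((1ℤ + ρ) + m - 0ℤ + 1ℤ) * 0ℤ
                     ≡ a - ((1ℤ + 0ℤ) * b + (ρ + m - 0ℤ + 1ℤ) * 0ℤ)
    lem₁ = solve-∀
    lem₂ : ∀ a m ρ → a - (m - ρ) * a ≡ (m - (1ℤ + ρ)) * (0ℤ + -1ℤ * a)
    lem₂ = solve-∀
  coeff-recurrence (suc r) M (suc k) = begin
    (1ℤ + (1ℤ + κ)) * (b + -1ℤ * a) + ((1ℤ + ρ) + m - (1ℤ + κ) + 1ℤ) * (d + -1ℤ * c)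
      ≡⟨ lem₁ a b c d κ m ρ ⟩
    ((1ℤ + κ) * b + (ρ + m - κ + 1ℤ) * d) - ((1ℤ + (1ℤ + κ)) * a + (ρ + m - (1ℤ + κ) + 1ℤ) * c) + (b - c)
      ≡⟨ cong₂ (λ x y → x - y + (b - c)) (coeff-recurrence r M k) (coeff-recurrence r M (suc k)) ⟩
    (m - ρ) * c - (m - ρ) * b + (b - c)
      ≡⟨ lem₂ b c m ρ ⟩
    (m - (1ℤ + ρ)) * (c + -1ℤ * b) ∎
    where
    open ≡-Reasoning
    m = + M
    ρ = + r
    κ = + k
    a = coeff r M (suc (suc k))
    b = coeff r M (suc k)
    c = coeff r M k
    d = shift (coeff r M) k
    lem₁ : ∀ a b c d κ m ρ →
      (1ℤ + (1ℤ + κ)) * (b + -1ℤ * a) + ((1ℤ + ρ) + m - (1ℤ + κ) + 1ℤ) * (d + -1ℤ * c)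
      ≡ ((1ℤ + κ) * b + (ρ + m - κ + 1ℤ) * d) - ((1ℤ + (1ℤ + κ)) * a + (ρ + m - (1ℤ + κ) + 1ℤ) * c) + (b - c)
    lem₁ = solve-∀
    lem₂ : ∀ b c m ρ → (m - ρ) * c - (m - ρ) * b + (b - c) ≡ (m - (1ℤ + ρ)) * (c + -1ℤ * b)
    lem₂ = solve-∀

  -- These are binomial coefficients: for r = 0 the equation (t + 1) f′ = M f gives two terms
  -- instead of three.
  coeff₀-recurrence : ∀ M k → (1ℤ + + k) * coeff 0 M (suc k) ≡ (+ M - + k) * coeff 0 M k
  coeff₀-recurrence zero    zero    = refl
  coeff₀-recurrence zero    (suc k) = lem (1ℤ + (1ℤ + + k)) (+ 0 - + suc k)
    where
    lem : ∀ a b → a * 0ℤ ≡ b * 0ℤ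
    lem = solve-∀
  coeff₀-recurrence (suc M) zero = begin
    (1ℤ + 0ℤ) * (a + 1ℤ * b)          ≡⟨ lem₁ a b ⟩
    (1ℤ + 0ℤ) * b + a                 ≡⟨ cong (_+ a) (coeff₀-recurrence M zero) ⟩
    (m - 0ℤ) * a + a                  ≡⟨ lem₂ a m ⟩
    ((1ℤ + m) - 0ℤ) * (0ℤ + 1ℤ * a)   ∎
    where
    open ≡-Reasoning
    m = + M
    a = coeff 0 M 0
    b = coeff 0 M 1
    lem₁ : ∀ a b → (1ℤ + 0ℤ) * (a + 1ℤ * b) ≡ (1ℤ + 0ℤ) * b + a
    lem₁ = solve-∀
    lem₂ : ∀ a m → (m - 0ℤ) * a + a ≡ ((1ℤ + m) - 0ℤ) * (0ℤ + 1ℤ * a)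
    lem₂ = solve-∀
  coeff₀-recurrence (suc M) (suc k) = begin
    (1ℤ + (1ℤ + κ)) * (b + 1ℤ * a)
      ≡⟨ lem₁ a b κ ⟩
    (1ℤ + (1ℤ + κ)) * a + (1ℤ + κ) * b + b
      ≡⟨ cong₂ (λ x y → x + y + b) (coeff₀-recurrence M (suc k)) (coeff₀-recurrence M k) ⟩
    (m - (1ℤ + κ)) * b + (m - κ) * c + b
      ≡⟨ lem₂ b c κ m ⟩
    ((1ℤ + m) - (1ℤ + κ)) * (c + 1ℤ * b) ∎
    where
    open ≡-Reasoning
    m = + M
    κ = + k
    a = coeff 0 M (suc (suc k))
    b = coeff 0 M (suc k)
    c = coeff 0 M k
    lem₁ : ∀ a b κ → (1ℤ + (1ℤ + κ)) * (b + 1ℤ * a) ≡ (1ℤ + (1ℤ + κ)) * a + (1ℤ + κ) * b + b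
    lem₁ = solve-∀
    lem₂ : ∀ b c κ m → (m - (1ℤ + κ)) * b + (m - κ) * c + b ≡ ((1ℤ + m) - (1ℤ + κ)) * (c + 1ℤ * b)
    lem₂ = solve-∀

-- Arithmetic modulo a prime and the coefficient form of the combinatorial Nullstellensatz

module Modular where

  open Coefficients
  open import Data.Nat as ℕ using (ℕ; zero; suc; s≤s)
  import Data.Nat.Properties as ℕₚ
  import Data.Nat.Divisibility as ℕ∣
  open import Data.Nat.Primality using (Prime; euclidsLemma; prime⇒nonZero)
  open import Data.Nat.Coprimality using (Coprime; coprime-Bézout)
  open import Data.Nat.GCD using (module Bézout)
  open import Data.Integer using (ℤ; +_; -[1+_]; 0ℤ; 1ℤ; -1ℤ; _+_; _-_; _*_; -_; _^_; ∣_∣)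
  open import Data.Integer.Properties
  open import Data.Integer.Divisibility.Signed
  open import Data.Integer.Tactic.RingSolver using (solve-∀)
  open import Data.List using (List; []; _∷_; _++_; map; length)
  open import Data.List.Relation.Unary.All using (All; []; _∷_)
  import Data.List.Relation.Unary.All as All
  import Data.List.Relation.Unary.All.Properties as Allₚ
  open import Data.List.Relation.Unary.Any using (Any; here; there)
  open import Data.List.Relation.Unary.AllPairs using (AllPairs; []; _∷_)
  open import Data.Product using (∃; _×_; _,_; proj₁; proj₂)
  open import Data.Sum using (_⊎_; inj₁; inj₂)
  import Data.Sum as Sum
  open import Data.Empty using (⊥-elim)
  open import Relation.Nullary using (¬_; yes; no; Dec)
  open import Relation.Binary.PropositionalEquality

  module Modulo (q : ℕ) (pq : Prime q) where

    -- Residues are kept as integers and compared by divisibility, so that the integer ring solver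
    -- remains available.
    Zero : ℤ → Set
    Zero z = + q ∣ z

    zero? : ∀ z → Dec (Zero z)
    zero? z = + q ∣? z

    zero-* : ∀ x y → Zero (x * y) → Zero x ⊎ Zero y
    zero-* x y h = Sum.map ∣ᵤ⇒∣ ∣ᵤ⇒∣
      (euclidsLemma ∣ x ∣ ∣ y ∣ pq (subst (q ℕ∣.∣_) (abs-* x y) (∣⇒∣ᵤ h)))

    Zero-0 : Zero 0ℤ
    Zero-0 = divides 0ℤ refl

    small-nonzero : ∀ n → 1 ℕ.≤ n → n ℕ.< q → ¬ Zero (+ n)
    small-nonzero (suc n) _ n<q h = ℕₚ.<⇒≱ n<q (ℕ∣.∣⇒≤ (∣⇒∣ᵤ h))

    1<q : 1 ℕ.< q
    1<q = ℕ.nonTrivial⇒n>1 q {{Data.Nat.Primality.prime⇒nonTrivial pq}}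

    ¬Zero-1 : ¬ Zero 1ℤ
    ¬Zero-1 = small-nonzero 1 ℕₚ.≤-refl 1<q

    cancel : ∀ {x} y → ¬ Zero x → Zero (x * y) → Zero y
    cancel {x} y ¬x h with zero-* x y h
    ... | inj₁ zx = ⊥-elim (¬x zx)
    ... | inj₂ zy = zy

    inverse-+ : ∀ n → ¬ Zero (+ n) → ∃ λ u → Zero (u * + n - 1ℤ)
    inverse-+ n ¬n with coprime-Bézout coprime
      where
      instance _ = prime⇒nonZero pq
      coprime : Coprime q n
      coprime {d} (d∣q , d∣n) with Data.Nat.Primality.prime⇒irreducible pq d∣q
      ... | inj₁ d≡1 = d≡1
      ... | inj₂ refl = ⊥-elim (¬n (∣ᵤ⇒∣ d∣n))
    ... | Bézout.+- x y eq = - (+ y) , divides (- (+ x)) (begin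
            - (+ y) * + n - 1ℤ       ≡⟨ lem (+ y) (+ n) ⟩
            - (1ℤ + + y * + n)       ≡⟨ cong (λ z → - (1ℤ + z)) (sym (pos-* y n)) ⟩
            - (+ (1 ℕ.+ y ℕ.* n))    ≡⟨ cong (λ z → - (+ z)) eq ⟩
            - (+ (x ℕ.* q))          ≡⟨ cong -_ (pos-* x q) ⟩
            - (+ x * + q)            ≡⟨ neg-distribˡ-* (+ x) (+ q) ⟩
            - (+ x) * + q            ∎)
      where
      open ≡-Reasoning
      lem : ∀ a b → - a * b - 1ℤ ≡ - (1ℤ + a * b)
      lem = solve-∀
    ... | Bézout.-+ x y eq = + y , divides (+ x) (begin
            + y * + n - 1ℤ           ≡⟨ cong (_- 1ℤ) (sym (pos-* y n)) ⟩
            + (y ℕ.* n) - 1ℤ         ≡⟨ cong (λ z → + z - 1ℤ) (sym eq) ⟩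
            + (1 ℕ.+ x ℕ.* q) - 1ℤ   ≡⟨ cong (λ z → (1ℤ + z) - 1ℤ) (pos-* x q) ⟩
            (1ℤ + + x * + q) - 1ℤ    ≡⟨ lem (+ x * + q) ⟩
            + x * + q                ∎)
      where
      open ≡-Reasoning
      lem : ∀ a → (1ℤ + a) - 1ℤ ≡ a
      lem = solve-∀

    inverse : ∀ z → ¬ Zero z → ∃ λ u → Zero (u * z - 1ℤ)
    inverse (+ n)      ¬z = inverse-+ n ¬z
    inverse (-[1+ n ]) ¬z with inverse-+ (suc n) (λ h → ¬z (∣m⇒∣-m h))
    ... | u , h = - u , subst Zero (lem u (+ suc n)) h
      where
      lem : ∀ a b → a * b - 1ℤ ≡ - a * (- b) - 1ℤ
      lem = solve-∀

    -- Totalised with value 0 at multiples of q, so that it can be applied to every point of a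
    -- weighted list.
    inv : ℤ → ℤ
    inv z with zero? z
    ... | yes _  = 0ℤ
    ... | no  ¬z = proj₁ (inverse z ¬z)

    inv-spec : ∀ z → ¬ Zero z → Zero (inv z * z - 1ℤ)
    inv-spec z ¬z with zero? z
    ... | yes h  = ⊥-elim (¬z h)
    ... | no  ¬z = proj₂ (inverse z ¬z)

    wsum : List (ℤ × ℤ) → (ℤ → ℤ) → ℤ
    wsum []            f = 0ℤ
    wsum ((w , x) ∷ L) f = w * f x + wsum L f

    wsum-linear : ∀ L {F f g h : ℤ → ℤ} e c → (∀ x → F x ≡ f x + e * g x + c * h x) →
                  wsum L F ≡ wsum L f + e * wsum L g + c * wsum L h
    wsum-linear []            e c eq = lem e c
      where
      lem : ∀ e c → 0ℤ ≡ 0ℤ + e * 0ℤ + c * 0ℤ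
      lem = solve-∀
    wsum-linear ((w , x) ∷ L) {F} {f} {g} {h} e c eq =
      trans (cong₂ (λ y z → w * y + z) (eq x) (wsum-linear L e c eq))
            (lem w e c (f x) (g x) (h x) (wsum L f) (wsum L g) (wsum L h))
      where
      lem : ∀ w e c f g h F G H → w * (f + e * g + c * h) + (F + e * G + c * H)
                                ≡ (w * f + F) + e * (w * g + G) + c * (w * h + H)
      lem = solve-∀

    wsum-scale : ∀ L (f : ℤ → ℤ) c → wsum L (λ x → f x * c) ≡ wsum L f * c
    wsum-scale []            f c = refl
    wsum-scale ((w , x) ∷ L) f c = trans (cong (λ z → w * (f x * c) + z) (wsum-scale L f c)) (lem w (f x) c (wsum L f))
      where
      lem : ∀ w y c z → w * (y * c) + z * c ≡ (w * y + z) * c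
      lem = solve-∀

    wsum-cong : ∀ L {f g : ℤ → ℤ} → (∀ x → f x ≡ g x) → wsum L f ≡ wsum L g
    wsum-cong []            eq = refl
    wsum-cong ((w , x) ∷ L) eq = cong₂ (λ y z → w * y + z) (eq x) (wsum-cong L eq)

    wsum-zero : ∀ L {f : ℤ → ℤ} → All (λ p → Zero (f (proj₂ p))) L → Zero (wsum L f)
    wsum-zero []            []       = Zero-0
    wsum-zero ((w , x) ∷ L) (z ∷ zs) = ∣m∣n⇒∣m+n (∣n⇒∣m*n w z) (wsum-zero L zs)

    moment : List (ℤ × ℤ) → ℕ → ℤ
    moment L k = wsum L (λ x → x ^ k)

    -- For A + 1 points distinct modulo q these are the weights of the divided difference of order
    -- `A`: on polynomials of degree at most `A` it reads off the coefficient of x^A.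
    record Weights (xs : List ℤ) (A : ℕ) : Set where
      field
        points  : List (ℤ × ℤ)
        support : map proj₂ points ≡ xs
        vanish  : ∀ j → j ℕ.< A → Zero (moment points j)
        leading : Zero (moment points A - 1ℤ)

    reweight : ℤ → List (ℤ × ℤ) → List (ℤ × ℤ)
    reweight α = map (λ (w , x) → w * inv (x - α) , x)

    wsum-reweight : ∀ α L (f : ℤ → ℤ) → wsum (reweight α L) f ≡ wsum L (λ x → inv (x - α) * f x)
    wsum-reweight α []            f = refl
    wsum-reweight α ((w , x) ∷ L) f = cong₂ _+_ (*-assoc w (inv (x - α)) (f x)) (wsum-reweight α L f)

    reweight-support : ∀ α L → map proj₂ (reweight α L) ≡ map proj₂ L
    reweight-support α []      = refl
    reweight-support α (_ ∷ L) = cong (_ ∷_) (reweight-support α L)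

    -- The usual recursion for divided differences: the old weights are divided by x - α, and the
    -- weight of α is chosen to make the moment of order 0 vanish.
    weights : ∀ x xs → AllPairs (λ a b → ¬ Zero (b - a)) (x ∷ xs) → Weights (x ∷ xs) (length xs)
    weights x []       _ = record
      { points  = (1ℤ , x) ∷ []
      ; support = refl
      ; vanish  = λ _ ()
      ; leading = Zero-0 }
    weights α (x ∷ xs) (α∉ ∷ distinct) = record
      { points  = L′
      ; support = cong (α ∷_) (trans (reweight-support α L) support)
      ; vanish  = vanish′
      ; leading = leading′ }
      where
      open Weights (weights x xs distinct) renaming (points to L)
      w₀ = - wsum (reweight α L) (λ x → x ^ 0)
      L′ = (w₀ , α) ∷ reweight α L

      moment-0 : Zero (moment L′ 0)
      moment-0 = subst Zero (sym (lem (wsum (reweight α L) (λ x → x ^ 0)))) Zero-0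
        where
        lem : ∀ a → - a * 1ℤ + a ≡ 0ℤ
        lem = solve-∀

      -- Multiplication by x - α undoes the reweighting and kills the point α. Hence μ′(j + 1) - α
      -- μ′(j) = μ(j), and both the vanishing moments and the leading 1 are inherited from `L` one
      -- order higher.
      telescope : ∀ j → Zero (moment L′ (suc j) - α * moment L′ j - moment L j)
      telescope j = subst Zero (sym eq) (wsum-zero L (Allₚ.map⁻ (subst (All _) (sym support) good)))
        where

        g : ℤ → ℤ
        g x = (inv (x - α) * (x - α) - 1ℤ) * x ^ j
        good : All (λ x → Zero (g x)) (x ∷ xs)
        good = All.map (λ {x} ¬z → ∣m⇒∣m*n (x ^ j) (inv-spec (x - α) ¬z)) α∉
        lem₁ : ∀ i x α p → i * (x * p) ≡ p + α * (i * p) + 1ℤ * ((i * (x - α) - 1ℤ) * p)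
        lem₁ = solve-∀
        lem₂ : ∀ w α p M H G → (w * (α * p) + (M + α * H + 1ℤ * G)) - α * (w * p + H) - M ≡ G
        lem₂ = solve-∀
        eq : moment L′ (suc j) - α * moment L′ j - moment L j ≡ wsum L g
        eq = trans
          (cong₂ (λ S H → (w₀ * (α * α ^ j) + S) - α * (w₀ * α ^ j + H) - moment L j)
            (trans (wsum-reweight α L (λ x → x ^ suc j))
                   (wsum-linear L α 1ℤ (λ x → lem₁ (inv (x - α)) x α (x ^ j))))
            (wsum-reweight α L (λ x → x ^ j)))
          (lem₂ w₀ α (α ^ j) (moment L j) (wsum L (λ x → inv (x - α) * x ^ j)) (wsum L g))

      vanish′ : ∀ j → j ℕ.< suc (length xs) → Zero (moment L′ j)
      vanish′ zero    _        = moment-0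
      vanish′ (suc j) (s≤s lt) =
        subst Zero (lem (moment L′ (suc j)) (α * moment L′ j) (moment L j))
          (∣m∣n⇒∣m+n (∣m∣n⇒∣m+n (telescope j) (∣n⇒∣m*n α (vanish′ j (ℕₚ.m≤n⇒m≤1+n lt)))) (vanish j lt))
        where
        lem : ∀ a b c → a - b - c + b + c ≡ a
        lem = solve-∀

      leading′ : Zero (moment L′ (suc (length xs)) - 1ℤ)
      leading′ =
        subst Zero (lem (moment L′ (suc (length xs))) (α * moment L′ (length xs)) (moment L (length xs)))
          (∣m∣n⇒∣m+n (∣m∣n⇒∣m+n (telescope (length xs)) (∣n⇒∣m*n α (vanish′ (length xs) ℕₚ.≤-refl))) leading)
        where
        lem : ∀ a b c → a - b - c + b + (c - 1ℤ) ≡ a - 1ℤ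
        lem = solve-∀

    linearProduct : List (ℤ × ℤ) → ℤ → ℤ → ℤ
    linearProduct []             x y = 1ℤ
    linearProduct ((e , c) ∷ Fs) x y = (x + e * y + c) * linearProduct Fs x y

    -- The coefficient of x^k in the product of the homogeneous parts x + e y, at y = 1.
    leadingCoeff : List (ℤ × ℤ) → ℕ → ℤ
    leadingCoeff []             zero    = 1ℤ
    leadingCoeff []             (suc k) = 0ℤ
    leadingCoeff ((e , c) ∷ Fs) k       = shift (leadingCoeff Fs) k + e * leadingCoeff Fs k

    module Nullstellensatz {xs ys A B} (X : Weights xs A) (Y : Weights ys B) where
      open Weights X renaming (points to LX; support to supportX; vanish to vanishX; leading to leadingX)
      open Weights Y renaming (points to LY; support to supportY; vanish to vanishY; leading to leadingY)

      Φ : (ℤ → ℤ → ℤ) → ℤ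
      Φ F = wsum LX (λ x → wsum LY (F x))

      -- The exponents `i` and `j` carry the monomial accumulated while the linear factors are
      -- expanded one by one.
      ψ : List (ℤ × ℤ) → ℕ → ℕ → ℤ
      ψ Fs i j = Φ (λ x y → linearProduct Fs x y * (x ^ i * y ^ j))

      ψ-[] : ∀ i j → ψ [] i j ≡ moment LX i * moment LY j
      ψ-[] i j = trans (wsum-cong LX inner) (wsum-scale LX (λ x → x ^ i) (moment LY j))
        where
        lem : ∀ a b → 1ℤ * (a * b) ≡ b * a
        lem = solve-∀
        inner : ∀ x → wsum LY (λ y → 1ℤ * (x ^ i * y ^ j)) ≡ x ^ i * moment LY j
        inner x = trans (wsum-cong LY (λ y → lem (x ^ i) (y ^ j)))
                        (trans (wsum-scale LY (λ y → y ^ j) (x ^ i)) (*-comm (moment LY j) (x ^ i)))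

      ψ-∷ : ∀ e c Fs i j → ψ ((e , c) ∷ Fs) i j ≡ ψ Fs (suc i) j + e * ψ Fs i (suc j) + c * ψ Fs i j
      ψ-∷ e c Fs i j = wsum-linear LX e c λ x → wsum-linear LY e c λ y →
        lem x y e c (linearProduct Fs x y) (x ^ i) (y ^ j)
        where
        lem : ∀ x y e c G p r → (x + e * y + c) * G * (p * r) ≡ G * ((x * p) * r) + e * (G * (p * (y * r))) + c * (G * (p * r))
        lem = solve-∀

      zero-combination : ∀ {u v w} e c → Zero u → Zero v → Zero w → Zero (u + e * v + c * w)
      zero-combination e c zu zv zw = ∣m∣n⇒∣m+n (∣m∣n⇒∣m+n zu (∣n⇒∣m*n e zv)) (∣n⇒∣m*n c zw)

      -- Every monomial of the expansion has y-degree below `B`, where the weights on Y have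
      -- vanishing moments.
      low-y : ∀ Fs i j → j ℕ.+ length Fs ℕ.< B → Zero (ψ Fs i j)
      low-y []             i j lt = subst Zero (sym (ψ-[] i j))
        (∣n⇒∣m*n (moment LX i) (vanishY j (subst (ℕ._< B) (ℕₚ.+-identityʳ j) lt)))
      low-y ((e , c) ∷ Fs) i j lt = subst Zero (sym (ψ-∷ e c Fs i j))
        (zero-combination e c (low-y Fs (suc i) j lt′) (low-y Fs i (suc j) (subst (ℕ._< B) (ℕₚ.+-suc j (length Fs)) lt)) (low-y Fs i j lt′))
        where
        lt′ = ℕₚ.<-trans (ℕₚ.+-monoʳ-< j (ℕₚ.n<1+n (length Fs))) lt

      -- Total degree below A + B forces x-degree below `A` or y-degree below `B` in each monomial.
      low : ∀ Fs i j → i ℕ.+ (j ℕ.+ length Fs) ℕ.< A ℕ.+ B → Zero (ψ Fs i j)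
      low []             i j lt with i ℕ.<? A
      ... | yes i<A = subst Zero (sym (ψ-[] i j)) (∣m⇒∣m*n (moment LY j) (vanishX i i<A))
      ... | no  i≮A = low-y [] i j (ℕₚ.+-cancelˡ-< A _ _ (ℕₚ.≤-<-trans (ℕₚ.+-monoˡ-≤ _ (ℕₚ.≮⇒≥ i≮A)) lt))
      low ((e , c) ∷ Fs) i j lt = subst Zero (sym (ψ-∷ e c Fs i j))
        (zero-combination e c
          (low Fs (suc i) j (subst (ℕ._< A ℕ.+ B) (trans (cong (i ℕ.+_) (ℕₚ.+-suc j _)) (ℕₚ.+-suc i _)) lt))
          (low Fs i (suc j) (subst (ℕ._< A ℕ.+ B) (cong (i ℕ.+_) (ℕₚ.+-suc j _)) lt))
          (low Fs i j (ℕₚ.<-trans (ℕₚ.+-monoʳ-< i (ℕₚ.+-monoʳ-< j (ℕₚ.n<1+n (length Fs)))) lt)))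

      -- In total degree A + B only x^A y^B survives, with value 1. The number `u` is the x-degree
      -- that the remaining factors still have to supply.
      top : ∀ Fs u i j → i ℕ.+ u ≡ A → i ℕ.+ (j ℕ.+ length Fs) ≡ A ℕ.+ B → Zero (ψ Fs i j - leadingCoeff Fs u)
      top [] zero i j iu eq rewrite ℕₚ.+-identityʳ i | ℕₚ.+-identityʳ j | iu | ℕₚ.+-cancelˡ-≡ A j B eq =
        subst Zero (sym (trans (cong (_- 1ℤ) (ψ-[] A B)) (lem (moment LX A) (moment LY B))))
          (∣m∣n⇒∣m+n (∣m⇒∣m*n (moment LY B) leadingX) leadingY)
        where
        lem : ∀ a b → a * b - 1ℤ ≡ (a - 1ℤ) * b + (b - 1ℤ)
        lem = solve-∀
      top [] (suc u) i j iu eq = subst Zero (sym (trans (+-identityʳ _) (ψ-[] i j)))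
        (∣m⇒∣m*n (moment LY j) (vanishX i (ℕₚ.m+n≤o⇒m≤o (suc i) (ℕₚ.≤-reflexive (trans (sym (ℕₚ.+-suc i u)) iu)))))
      top ((e , c) ∷ Fs) u i j iu eq =
        subst Zero (sym (trans (cong (_- (shift (leadingCoeff Fs) u + e * leadingCoeff Fs u)) (ψ-∷ e c Fs i j))
            (lem (ψ Fs (suc i) j) (ψ Fs i (suc j)) (ψ Fs i j) e c (shift (leadingCoeff Fs) u) (leadingCoeff Fs u))))
          (zero-combination e c (first u iu) (top Fs u i (suc j) iu eq′) lower)
        where
        lem : ∀ p q r e c s t → p + e * q + c * r - (s + e * t) ≡ (p - s) + e * (q - t) + c * r
        lem = solve-∀
        eq′ : i ℕ.+ (suc j ℕ.+ length Fs) ≡ A ℕ.+ B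
        eq′ = trans (cong (i ℕ.+_) (sym (ℕₚ.+-suc j _))) eq
        eq″ : suc (i ℕ.+ (j ℕ.+ length Fs)) ≡ A ℕ.+ B
        eq″ = trans (sym (ℕₚ.+-suc i _)) eq′
        lower : Zero (ψ Fs i j)
        lower = low Fs i j (ℕₚ.≤-reflexive eq″)
        -- At u = 0 another factor x pushes the x-degree beyond `A`, which leaves y-degree below
        -- `B`.
        first : ∀ u → i ℕ.+ u ≡ A → Zero (ψ Fs (suc i) j - shift (leadingCoeff Fs) u)
        first zero    iu = subst Zero (sym (+-identityʳ _))
          (low-y Fs (suc i) j (ℕₚ.≤-reflexive (ℕₚ.+-cancelˡ-≡ A _ _
            (trans (cong (ℕ._+ suc (j ℕ.+ length Fs)) (trans (sym iu) (ℕₚ.+-identityʳ i))) eq′))))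
        first (suc u) iu = top Fs u (suc i) j (trans (sym (ℕₚ.+-suc i u)) iu) eq″

      -- The weighted sum of the product is evaluated twice: value by value it is zero, and by `top`
      -- it is the coefficient of x^A y^B.
      leadingCoeff-zero : ∀ Fs → length Fs ≡ A ℕ.+ B →
                          All (λ x → All (λ y → Zero (linearProduct Fs x y)) ys) xs → Zero (leadingCoeff Fs A)
      leadingCoeff-zero Fs len van = subst Zero (lem (ψ Fs 0 0) (leadingCoeff Fs A))
        (∣m∣n⇒∣m-n ψ-zero (top Fs A 0 0 refl len))
        where
        lem : ∀ a b → a - (a - b) ≡ b
        lem = solve-∀
        ψ-zero : Zero (ψ Fs 0 0)
        ψ-zero = wsum-zero LX (Allₚ.map⁻ (subst (All _) (sym supportX) (All.map
          (λ {x} h → wsum-zero LY (Allₚ.map⁻ (subst (All _) (sym supportY)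
            (All.map (λ {y} z → ∣m⇒∣m*n (x ^ 0 * y ^ 0) z) h)))) van)))

    linearProduct-zero : ∀ {Fs x y} → Any (λ p → Zero (x + proj₁ p * y + proj₂ p)) Fs → Zero (linearProduct Fs x y)
    linearProduct-zero {_ ∷ Fs} {x} {y} (here z)  = ∣m⇒∣m*n (linearProduct Fs x y) z
    linearProduct-zero {(e , c) ∷ _} {x} {y} (there h) = ∣n⇒∣m*n (x + e * y + c) (linearProduct-zero h)

    factors : List ℤ → List ℤ → List (ℤ × ℤ)
    factors D Z = map (λ d → -1ℤ , - d) D ++ map (λ z → 1ℤ , - z) Z

    -- The constants `d` and `z` do not reach the top degree. The explicit factors 1ℤ and -1ℤ in
    -- `coeff` make both recursions agree term by term.
    leadingCoeff-factors : ∀ D Z k → leadingCoeff (factors D Z) k ≡ coeff (length D) (length Z) k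
    leadingCoeff-factors []      []      zero    = refl
    leadingCoeff-factors []      []      (suc k) = refl
    leadingCoeff-factors []      (z ∷ Z) zero    = cong (λ a → 0ℤ + 1ℤ * a) (leadingCoeff-factors [] Z 0)
    leadingCoeff-factors []      (z ∷ Z) (suc k) =
      cong₂ (λ a b → a + 1ℤ * b) (leadingCoeff-factors [] Z k) (leadingCoeff-factors [] Z (suc k))
    leadingCoeff-factors (d ∷ D) Z       zero    = cong (λ a → 0ℤ + -1ℤ * a) (leadingCoeff-factors D Z 0)
    leadingCoeff-factors (d ∷ D) Z       (suc k) =
      cong₂ (λ a b → a + -1ℤ * b) (leadingCoeff-factors D Z k) (leadingCoeff-factors D Z (suc k))

-- The polynomial method in ℤ/q

module PrimeField where

  open Counting
  open Coefficients
  open Modular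
  open import Data.Bool using (Bool; true; false; T)
  open import Data.Unit using (tt)
  open import Data.Nat as ℕ using (ℕ; zero; suc; z≤n; s≤s)
  import Data.Nat.Properties as ℕₚ
  open import Data.Nat.Primality using (Prime)
  open import Data.Fin using (Fin; zero; suc; toℕ)
  import Data.Fin.Properties as Finₚ
  open import Data.Integer using (ℤ; +_; 1ℤ; -1ℤ; _+_; _-_; _*_; -_)
  open import Data.Integer.Properties
  open import Data.Integer.Divisibility.Signed
  open import Data.Integer.Tactic.RingSolver using (solve-∀)
  import Data.Nat.Tactic.RingSolver as ℕSolver
  open import Data.List using (List; []; _∷_; map; length; take)
  import Data.List.Properties as Listₚ
  open import Data.List.Relation.Unary.All using (All; []; _∷_)
  import Data.List.Relation.Unary.All as All
  import Data.List.Relation.Unary.All.Properties as Allₚ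
  open import Data.List.Relation.Unary.Any using (Any; here; there)
  import Data.List.Relation.Unary.Any as Any
  import Data.List.Relation.Unary.Any.Properties as Anyₚ
  open import Data.List.Relation.Unary.AllPairs using (AllPairs; []; _∷_)
  import Data.List.Relation.Unary.AllPairs as AllPairs
  import Data.List.Relation.Unary.AllPairs.Properties as AllPairsₚ
  open import Data.List.Membership.Propositional using (_∈_)
  import Data.List.Membership.Propositional.Properties as ∈ₚ
  open import Data.Product using (∃; _×_; _,_; proj₁; proj₂)
  open import Data.Sum using (_⊎_; inj₁; inj₂)
  open import Data.Empty using (⊥-elim)
  open import Function using (_∘_)
  open import Relation.Nullary using (¬_; yes; no)
  open import Relation.Binary.PropositionalEquality
  open import Relation.Binary using (tri<; tri≈; tri>)

  elements : ∀ {n} → (Fin n → Bool) → List (Fin n)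
  elements {zero}  P = []
  elements {suc n} P with P zero
  ... | true  = zero ∷ map suc (elements (P ∘ suc))
  ... | false = map suc (elements (P ∘ suc))

  length-elements : ∀ {n} (P : Fin n → Bool) → length (elements P) ≡ # P
  length-elements {zero}  P = refl
  length-elements {suc n} P with P zero
  ... | true  = cong suc (trans (Listₚ.length-map Fin.suc (elements (P ∘ suc))) (length-elements (P ∘ suc)))
  ... | false = trans (Listₚ.length-map Fin.suc (elements (P ∘ suc))) (length-elements (P ∘ suc))

  elements-T : ∀ {n} (P : Fin n → Bool) → All (T ∘ P) (elements P)
  elements-T {zero}  P = []
  elements-T {suc n} P with P zero in eq
  ... | true  = subst T (sym eq) tt ∷ Allₚ.map⁺ (elements-T (P ∘ suc))
  ... | false = Allₚ.map⁺ (elements-T (P ∘ suc))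

  ∈-elements : ∀ {n} (P : Fin n → Bool) i → T (P i) → i ∈ elements P
  ∈-elements {suc n} P zero    p with P zero
  ... | true = here refl
  ∈-elements {suc n} P (suc i) p with P zero
  ... | true  = there (∈ₚ.∈-map⁺ suc (∈-elements (P ∘ suc) i p))
  ... | false = ∈ₚ.∈-map⁺ suc (∈-elements (P ∘ suc) i p)

  elements-distinct : ∀ {n} (P : Fin n → Bool) → AllPairs _≢_ (elements P)
  elements-distinct {zero}  P = []
  elements-distinct {suc n} P with P zero
  ... | true  = Allₚ.map⁺ (All.universal (λ _ ()) _) ∷ rest
    where rest = AllPairsₚ.map⁺ (AllPairs.map (λ ne e → ne (Finₚ.suc-injective e)) (elements-distinct (P ∘ suc)))
  ... | false = AllPairsₚ.map⁺ (AllPairs.map (λ ne e → ne (Finₚ.suc-injective e)) (elements-distinct (P ∘ suc)))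

  module OddPrime (q : ℕ) (pq : Prime q) (2<q : 2 ℕ.< q) where
    open Modulo q pq

    coeff-0-nonzero : ∀ r M → ¬ Zero (coeff r M 0)
    coeff-0-nonzero r M h = ¬Zero-1 (subst Zero (coeff-0² r M) (∣m⇒∣m*n (coeff r M 0) h))

    -- The recurrence solved for its lowest term, whose factor r + M - k = n is invertible;
    -- `coeff-up` solves it for the highest term, with factor k + 2.
    coeff-down : ∀ r M k n → r ℕ.+ M ≡ k ℕ.+ n → 1 ℕ.≤ n → n ℕ.< q →
                 Zero (coeff r M (suc k)) → Zero (coeff r M (suc (suc k))) → Zero (coeff r M k)
    coeff-down r M k n N≡ 1≤n n<q z₁ z₂ = cancel (coeff r M k) (small-nonzero n 1≤n n<q) (subst Zero eq
      (∣m∣n⇒∣m-n (∣n⇒∣m*n (+ M - + r) z₁) (∣n⇒∣m*n (1ℤ + + suc k) z₂)))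
      where
      c₀ = coeff r M k
      c₁ = coeff r M (suc k)
      c₂ = coeff r M (suc (suc k))
      lem₁ : ∀ a b → a + b - a ≡ b
      lem₁ = solve-∀
      lem₂ : ∀ κ ν c → (κ + ν - (1ℤ + κ) + 1ℤ) * c ≡ ν * c
      lem₂ = solve-∀
      eq : (+ M - + r) * c₁ - (1ℤ + + suc k) * c₂ ≡ + n * c₀
      eq = trans (cong (_- (1ℤ + + suc k) * c₂) (sym (coeff-recurrence r M (suc k))))
          (trans (lem₁ ((1ℤ + + suc k) * c₂) ((+ r + + M - + suc k + 1ℤ) * c₀))
          (trans (cong (λ z → (z - + suc k + 1ℤ) * c₀) (cong +_ N≡)) (lem₂ (+ k) (+ n) c₀)))

    coeff-up : ∀ r M k → suc (suc k) ℕ.< q →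
               Zero (coeff r M k) → Zero (coeff r M (suc k)) → Zero (coeff r M (suc (suc k)))
    coeff-up r M k k<q z₀ z₁ = cancel (coeff r M (suc (suc k))) (small-nonzero (suc (suc k)) (s≤s z≤n) k<q)
      (∣m+n∣n⇒∣m (subst Zero (sym (coeff-recurrence r M (suc k))) (∣n⇒∣m*n (+ M - + r) z₁))
                 (∣n⇒∣m*n (+ r + + M - + suc k + 1ℤ) z₀))

    -- The condition r + M < j + q keeps every factor met on the way down to `j` below q.
    coeff-zeros-below : ∀ r M k → k ℕ.≤ r ℕ.+ M → Zero (coeff r M k) → Zero (coeff r M (suc k)) →
                        ∀ j → j ℕ.≤ k → r ℕ.+ M ℕ.< j ℕ.+ q → Zero (coeff r M j)
    coeff-zeros-below r M k k≤N z₀ z₁ j j≤k lt with ℕₚ.m≤n⇒m<n∨m≡n j≤k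
    ... | inj₂ refl = z₀
    coeff-zeros-below r M (suc k) k<N z₀ z₁ j _ lt | inj₁ (s≤s j≤k) =
      coeff-zeros-below r M k (ℕₚ.<⇒≤ k<N) next z₀ j j≤k lt
      where
      n = r ℕ.+ M ℕ.∸ k
      N≡ : k ℕ.+ n ≡ r ℕ.+ M
      N≡ = ℕₚ.m+[n∸m]≡n (ℕₚ.<⇒≤ k<N)
      next : Zero (coeff r M k)
      next = coeff-down r M k n (sym N≡) (ℕₚ.m<n⇒0<n∸m k<N)
        (ℕₚ.+-cancelˡ-< k n q (ℕₚ.<-≤-trans (subst (ℕ._< j ℕ.+ q) (sym N≡) lt) (ℕₚ.+-monoˡ-≤ q j≤k))) z₀ z₁

    coeff-zeros-above : ∀ r M k → Zero (coeff r M k) → Zero (coeff r M (suc k)) →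
                        ∀ t → suc (t ℕ.+ k) ℕ.< q → Zero (coeff r M (t ℕ.+ k)) × Zero (coeff r M (suc (t ℕ.+ k)))
    coeff-zeros-above r M k z₀ z₁ zero    lt = z₀ , z₁
    coeff-zeros-above r M k z₀ z₁ (suc t) lt with coeff-zeros-above r M k z₀ z₁ t (ℕₚ.<-trans (ℕₚ.n<1+n _) lt)
    ... | y₀ , y₁ = y₁ , coeff-up r M (t ℕ.+ k) lt y₀ y₁

    -- Multiplication by t + 1 mixes only neighbouring coefficients, so each such factor costs the
    -- window of zeros one place at its lower end and none at its upper end q - 1.
    coeff-raise : ∀ r M → (∀ j → r ℕ.+ M ℕ.< j ℕ.+ q → j ℕ.< q → Zero (coeff r M j)) →
                  ∀ t j → t ℕ.+ (r ℕ.+ M) ℕ.< j ℕ.+ q → j ℕ.< q → Zero (coeff r (t ℕ.+ M) j)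
    coeff-raise r M h zero    j       lt j<q = h j lt j<q
    coeff-raise r M h (suc t) zero    lt j<q = subst Zero (sym (coeff-sucʳ r (t ℕ.+ M) 0))
      (∣m∣n⇒∣m+n Zero-0 (∣n⇒∣m*n 1ℤ (coeff-raise r M h t 0 (ℕₚ.<-trans (ℕₚ.n<1+n _) lt) j<q)))
    coeff-raise r M h (suc t) (suc j) lt j<q = subst Zero (sym (coeff-sucʳ r (t ℕ.+ M) (suc j)))
      (∣m∣n⇒∣m+n (coeff-raise r M h t j (ℕ.s≤s⁻¹ lt) (ℕₚ.<-trans (ℕₚ.n<1+n j) j<q))
                 (∣n⇒∣m*n 1ℤ (coeff-raise r M h t (suc j) (ℕₚ.<-trans (ℕₚ.n<1+n _) lt) j<q)))

    coeff₀-nonzero : ∀ M k → k ℕ.≤ M → M ℕ.< q → ¬ Zero (coeff 0 M k)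
    coeff₀-nonzero M zero    _   _   = coeff-0-nonzero 0 M
    coeff₀-nonzero M (suc k) k<M M<q h = coeff₀-nonzero M k (ℕₚ.<⇒≤ k<M) M<q
      (cancel (coeff 0 M k) (small-nonzero (M ℕ.∸ k) (ℕₚ.m<n⇒0<n∸m k<M) (ℕₚ.≤-<-trans (ℕₚ.m∸n≤m M k) M<q))
        (subst Zero (trans (coeff₀-recurrence M k) (cong (_* coeff 0 M k) M-k)) (∣n⇒∣m*n (1ℤ + + k) h)))
      where
      M-k : + M - + k ≡ + (M ℕ.∸ k)
      M-k = trans ([+m]-[+n]≡m⊖n M k) (⊖-≥ (ℕₚ.<⇒≤ k<M))

    -- Modulo q the coefficients of (t - 1)^r (t + 1)^(q-1) are, from t^r to t^(q-1), ± 2^r with alternating signs.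
    coeff-alternate : ∀ r Q k → suc Q ≡ q → r ℕ.≤ k → suc k ℕ.< q → Zero (coeff r Q k + coeff r Q (suc k))
    coeff-alternate zero Q k refl _ k<q = cancel _ (small-nonzero (suc k) (s≤s z≤n) k<q)
      (divides (coeff 0 Q k) (trans (*-distribˡ-+ (1ℤ + + k) (coeff 0 Q k) (coeff 0 Q (suc k)))
        (trans (cong (λ z → (1ℤ + + k) * coeff 0 Q k + z) (coeff₀-recurrence Q k)) (lem (+ k) (+ Q) (coeff 0 Q k)))))
      where
      lem : ∀ κ Q c → (1ℤ + κ) * c + (Q - κ) * c ≡ c * (1ℤ + Q)
      lem = solve-∀
    coeff-alternate (suc r) Q (suc k) Q≡ (s≤s r≤k) k<q =
      subst Zero (lem (coeff r Q k) (coeff r Q (suc k)) (coeff r Q (suc (suc k))))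
        (∣m∣n⇒∣m-n (coeff-alternate r Q k Q≡ r≤k (ℕₚ.<-trans (ℕₚ.n<1+n _) k<q))
                   (coeff-alternate r Q (suc k) Q≡ (ℕₚ.m≤n⇒m≤1+n r≤k) k<q))
      where
      lem : ∀ a b c → (a + b) - (b + c) ≡ (a + -1ℤ * b) + (b + -1ℤ * c)
      lem = solve-∀

    -- By `coeff-alternate`, passing from r to r + 1 multiplies the coefficient by -2 modulo q. The
    -- start, r = 0, is a binomial coefficient.
    coeff-top-nonzero : ∀ r Q k → suc Q ≡ q → r ℕ.≤ k → k ℕ.< q → ¬ Zero (coeff r Q k)
    coeff-top-nonzero zero    Q k refl _ k<q h = coeff₀-nonzero Q k (ℕ.s≤s⁻¹ k<q) (ℕₚ.n<1+n Q) h
    coeff-top-nonzero (suc r) Q (suc k) Q≡ (s≤s r≤k) k<q h =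
      coeff-top-nonzero r Q (suc k) Q≡ (ℕₚ.m≤n⇒m≤1+n r≤k) k<q
        (cancel _ (small-nonzero 2 (s≤s z≤n) 2<q)
          (subst Zero (lem (coeff r Q k) (coeff r Q (suc k)))
            (∣m∣n⇒∣m-n (coeff-alternate r Q k Q≡ r≤k k<q) h)))
      where
      lem : ∀ a b → (a + b) - (a + -1ℤ * b) ≡ + 2 * b
      lem = solve-∀

    -- Two adjacent zeros spread to the whole window r + M - q < j < q. Raising M to q - 1 keeps j =
    -- q - 1 inside the window, although that coefficient is nonzero.
    coeff-adjacent : ∀ r M k → r ℕ.< q → M ℕ.< q → k ℕ.≤ r ℕ.+ M → suc k ℕ.< q → r ℕ.+ M ℕ.< k ℕ.+ q →
                     Zero (coeff r M k) → ¬ Zero (coeff r M (suc k))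
    coeff-adjacent r M k r<q M<q k≤N k<q N<k+q z₀ z₁ = coeff-top-nonzero r Q Q Q≡ (ℕ.s≤s⁻¹ (subst (suc r ℕ.≤_) (sym Q≡) r<q)) Q<q
      (subst (λ R → Zero (coeff r R Q)) (ℕₚ.m∸n+n≡m M≤Q) (coeff-raise r M zeros (Q ℕ.∸ M) Q bound Q<q))
      where
      Q = ℕ.pred q
      Q≡ : suc Q ≡ q
      Q≡ = ℕₚ.suc-pred q {{ℕ.>-nonZero (ℕₚ.<-trans (s≤s z≤n) 2<q)}}
      Q<q : Q ℕ.< q
      Q<q = ℕₚ.≤-reflexive Q≡
      M≤Q : M ℕ.≤ Q
      M≤Q = ℕ.s≤s⁻¹ (subst (suc M ℕ.≤_) (sym Q≡) M<q)
      bound : Q ℕ.∸ M ℕ.+ (r ℕ.+ M) ℕ.< Q ℕ.+ q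
      bound = subst (ℕ._< Q ℕ.+ q) (sym (trans (lem (Q ℕ.∸ M) r M) (cong (ℕ._+ r) (ℕₚ.m∸n+n≡m M≤Q)))) (ℕₚ.+-monoʳ-< Q r<q)
        where
        lem : ∀ a b c → a ℕ.+ (b ℕ.+ c) ≡ a ℕ.+ c ℕ.+ b
        lem = ℕSolver.solve-∀
      zeros : ∀ j → r ℕ.+ M ℕ.< j ℕ.+ q → j ℕ.< q → Zero (coeff r M j)
      zeros j lt j<q with j ℕ.≤? k
      ... | yes j≤k = coeff-zeros-below r M k k≤N z₀ z₁ j j≤k lt
      ... | no  j≰k = subst (λ i → Zero (coeff r M i)) suc-t
        (proj₂ (coeff-zeros-above r M k z₀ z₁ (j ℕ.∸ suc k) (subst (ℕ._< q) (sym suc-t) j<q)))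
        where
        suc-t : suc (j ℕ.∸ suc k ℕ.+ k) ≡ j
        suc-t = trans (sym (ℕₚ.+-suc _ k)) (ℕₚ.m∸n+n≡m (ℕₚ.≰⇒> j≰k))

    Cover : (X Y D Z : Fin q → Bool) → Set
    Cover X Y D Z = ∀ x y → T (X x) → T (Y y) →
      (∃ λ d → T (D d) × Zero (+ toℕ x - + toℕ y - + toℕ d)) ⊎ (∃ λ z → T (Z z) × Zero (+ toℕ x + + toℕ y - + toℕ z))

    toℤ : Fin q → ℤ
    toℤ i = + toℕ i

    toℤ-distinct : ∀ {a b : Fin q} → a ≢ b → ¬ Zero (toℤ b - toℤ a)
    toℤ-distinct {a} {b} a≢b h with ℕₚ.<-cmp (toℕ a) (toℕ b)
    ... | tri≈ _ e _ = a≢b (Finₚ.toℕ-injective e)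
    ... | tri< lt _ _ = small-nonzero (toℕ b ℕ.∸ toℕ a) (ℕₚ.m<n⇒0<n∸m lt)
      (ℕₚ.≤-<-trans (ℕₚ.m∸n≤m (toℕ b) (toℕ a)) (Finₚ.toℕ<n b))
      (subst Zero (trans ([+m]-[+n]≡m⊖n (toℕ b) (toℕ a)) (⊖-≥ (ℕₚ.<⇒≤ lt))) h)
    ... | tri> _ _ gt = small-nonzero (toℕ a ℕ.∸ toℕ b) (ℕₚ.m<n⇒0<n∸m gt)
      (ℕₚ.≤-<-trans (ℕₚ.m∸n≤m (toℕ a) (toℕ b)) (Finₚ.toℕ<n a))
      (subst Zero (trans (lem (toℤ b) (toℤ a)) (trans ([+m]-[+n]≡m⊖n (toℕ a) (toℕ b)) (⊖-≥ (ℕₚ.<⇒≤ gt)))) (∣m⇒∣-m h))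
      where
      lem : ∀ a b → - (a - b) ≡ b - a
      lem = solve-∀

    -- X and Y are cut down to k + 1 and j + 1 points, so that the orders k and j add up to the
    -- exact number of linear factors.
    prefix : (Fin q → Bool) → ℕ → List ℤ
    prefix P k = map toℤ (take k (elements P))

    prefix-weights : ∀ P k → suc k ℕ.≤ # P → Weights (prefix P (suc k)) k
    prefix-weights P k k<#P with take (suc k) (elements P) | distinct | len
      where
      distinct : AllPairs _≢_ (take (suc k) (elements P))
      distinct = AllPairsₚ.take⁺ (suc k) (elements-distinct P)
      len : length (take (suc k) (elements P)) ≡ suc k
      len = trans (Listₚ.length-take (suc k) (elements P))
                  (ℕₚ.m≤n⇒m⊓n≡m (subst (suc k ℕ.≤_) (sym (length-elements P)) k<#P))
    ... | x ∷ xs | distinct | len = subst (Weights (map toℤ (x ∷ xs))) (trans (Listₚ.length-map toℤ xs) (ℕₚ.suc-injective len))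
      (weights (toℤ x) (map toℤ xs) (AllPairsₚ.map⁺ (AllPairs.map toℤ-distinct distinct)))

    prefix-T : ∀ P k (Q : ℤ → Set) → (∀ x → T (P x) → Q (toℤ x)) → All Q (prefix P k)
    prefix-T P k Q h = Allₚ.map⁺ (All.map (λ {x} → h x) (Allₚ.take⁺ k (elements-T P)))

    module _ (X Y D Z : Fin q → Bool) (cover : Cover X Y D Z) where

      vanishing : ∀ k j → k ℕ.+ j ≡ # D ℕ.+ # Z → suc k ℕ.≤ # X → suc j ℕ.≤ # Y → Zero (coeff (# D) (# Z) k)
      vanishing k j N≡ k<X j<Y = subst Zero coeff≡
        (Nullstellensatz.leadingCoeff-zero (prefix-weights X k k<X) (prefix-weights Y j j<Y) Fs len
          (prefix-T X (suc k) _ λ x Xx → prefix-T Y (suc j) _ λ y Yy → linearProduct-zero {Fs} (factor x y (cover x y Xx Yy))))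
        where
        Ds = map toℤ (elements D)
        Zs = map toℤ (elements Z)
        Fs = factors Ds Zs
        #D≡ : length Ds ≡ # D
        #D≡ = trans (Listₚ.length-map toℤ (elements D)) (length-elements D)
        #Z≡ : length Zs ≡ # Z
        #Z≡ = trans (Listₚ.length-map toℤ (elements Z)) (length-elements Z)
        coeff≡ : leadingCoeff Fs k ≡ coeff (# D) (# Z) k
        coeff≡ = trans (leadingCoeff-factors Ds Zs k) (cong₂ (λ r M → coeff r M k) #D≡ #Z≡)
        len : length Fs ≡ k ℕ.+ j
        len = trans (Listₚ.length-++ (map (λ d → -1ℤ , - d) Ds))
          (trans (cong₂ ℕ._+_ (trans (Listₚ.length-map _ Ds) #D≡) (trans (Listₚ.length-map _ Zs) #Z≡)) (sym N≡))
        factor : ∀ x y → (∃ λ d → T (D d) × Zero (toℤ x - toℤ y - toℤ d)) ⊎ (∃ λ z → T (Z z) × Zero (toℤ x + toℤ y - toℤ z)) →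
                 Any (λ p → Zero (toℤ x + proj₁ p * toℤ y + proj₂ p)) Fs
        factor x y (inj₁ (d , Dd , z)) = Anyₚ.++⁺ˡ (Anyₚ.map⁺ (Anyₚ.map⁺ (Any.map hit (∈-elements D d Dd))))
          where
          lem : ∀ x y d → x - y - d ≡ x + -1ℤ * y + - d
          lem = solve-∀
          hit : ∀ {d′} → d ≡ d′ → Zero (toℤ x + -1ℤ * toℤ y + - toℤ d′)
          hit refl = subst Zero (lem (toℤ x) (toℤ y) (toℤ d)) z
        factor x y (inj₂ (z , Zz , h)) = Anyₚ.++⁺ʳ (map (λ d → -1ℤ , - d) Ds) (Anyₚ.map⁺ (Anyₚ.map⁺ (Any.map hit (∈-elements Z z Zz))))
          where
          lem : ∀ x y d → x + y - d ≡ x + 1ℤ * y + - d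
          lem = solve-∀
          hit : ∀ {z′} → z ≡ z′ → Zero (toℤ x + 1ℤ * toℤ y + - toℤ z′)
          hit refl = subst Zero (lem (toℤ x) (toℤ y) (toℤ z)) h

      -- If the bound failed, X and Y would be large enough to split the degree N both as k + (N -
      -- k) and as (k + 1) + (N - k - 1), which makes two adjacent coefficients vanish.
      restricted-bound : 1 ℕ.≤ # X → 1 ℕ.≤ # Y → # D ℕ.< q → # Z ℕ.< q → # X ℕ.+ # Y ℕ.≤ # Z ℕ.+ # D ℕ.+ 2
      restricted-bound 1≤X 1≤Y D<q Z<q with # X ℕ.+ # Y ℕ.≤? # Z ℕ.+ # D ℕ.+ 2
      ... | yes p = p
      ... | no ¬p with # Y ℕ.≤? # D ℕ.+ # Z
      -- One point of X suffices here: order 0 in x extracts the constant term, which is ±1.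
      ...   | no Y≰N = ⊥-elim (coeff-0-nonzero (# D) (# Z) (vanishing 0 (# D ℕ.+ # Z) refl 1≤X (ℕₚ.≰⇒> Y≰N)))
      ...   | yes Y≤N with # Y in #Y | 1≤Y
      ...     | suc l | _ = ⊥-elim (coeff-adjacent (# D) (# Z) k D<q Z<q k≤N k+1<q N<k+q
                  (vanishing k l k+l≡N (ℕₚ.≤-trans (ℕₚ.n≤1+n _) k+2≤X) (ℕₚ.≤-reflexive (sym #Y))) (second l refl))
        where
        N = # D ℕ.+ # Z
        k = N ℕ.∸ l
        l≤N : l ℕ.≤ N
        l≤N = ℕₚ.≤-trans (ℕₚ.n≤1+n l) Y≤N
        k+l≡N : k ℕ.+ l ≡ N
        k+l≡N = ℕₚ.m∸n+n≡m l≤N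
        k≤N : k ℕ.≤ N
        k≤N = ℕₚ.m∸n≤m N l
        k+2≤X : suc (suc k) ℕ.≤ # X
        k+2≤X = ≤-from (ℕₚ.≰⇒> ¬p) 0 (trans (lem₁ k l (# X)) (trans (cong (λ n → # X ℕ.+ (3 ℕ.+ n)) k+l≡N) (lem₂ (# X) (# D) (# Z))))
          where
          lem₁ : ∀ k l x → 2 ℕ.+ k ℕ.+ (x ℕ.+ (1 ℕ.+ l)) ℕ.+ 0 ≡ x ℕ.+ (3 ℕ.+ (k ℕ.+ l))
          lem₁ = ℕSolver.solve-∀
          lem₂ : ∀ x d z → x ℕ.+ (3 ℕ.+ (d ℕ.+ z)) ≡ x ℕ.+ (1 ℕ.+ (z ℕ.+ d ℕ.+ 2))
          lem₂ = ℕSolver.solve-∀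
        k+1<q : suc k ℕ.< q
        k+1<q = ℕₚ.≤-trans k+2≤X (#≤n X)
        N<k+q : N ℕ.< k ℕ.+ q
        N<k+q = subst (ℕ._< k ℕ.+ q) k+l≡N (ℕₚ.+-monoʳ-< k (ℕₚ.≤-trans (ℕₚ.≤-reflexive (sym #Y)) (#≤n Y)))
        -- For l = 0 the index k + 1 exceeds the degree, and the coefficient is zero for that
        -- reason.
        second : ∀ l′ → l′ ≡ l → Zero (coeff (# D) (# Z) (suc k))
        second zero     refl = subst Zero (sym (coeff-degree (# D) (# Z) (suc k)
          (ℕₚ.≤-reflexive (cong suc (trans (sym k+l≡N) (ℕₚ.+-identityʳ k)))))) Zero-0
        second (suc l′) refl = vanishing (suc k) l′ (trans (sym (ℕₚ.+-suc k l′)) k+l≡N) k+2≤X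
          (ℕₚ.≤-trans (ℕₚ.n≤1+n _) (ℕₚ.≤-reflexive (sym #Y)))

      -- With D empty the coefficients are binomial with upper index below q, hence nonzero. A
      -- single vanishing coefficient is then a contradiction, which saves one unit.
      unrestricted-bound : 1 ℕ.≤ # X → 1 ℕ.≤ # Y → # D ≡ 0 → # Z ℕ.< q → # X ℕ.+ # Y ℕ.≤ # Z ℕ.+ 1
      unrestricted-bound 1≤X 1≤Y D≡0 Z<q with # X ℕ.+ # Y ℕ.≤? # Z ℕ.+ 1
      ... | yes p = p
      ... | no ¬p with # Y ℕ.≤? # Z
      ...   | no Y≰N = ⊥-elim (coeff-0-nonzero (# D) (# Z) (vanishing 0 (# Z) (cong (ℕ._+ # Z) (sym D≡0)) 1≤X (ℕₚ.≰⇒> Y≰N)))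
      ...   | yes Y≤N with # Y in #Y | 1≤Y
      ...     | suc l | _ = ⊥-elim (coeff₀-nonzero (# Z) k (ℕₚ.m∸n≤m (# Z) l) Z<q
                  (subst (λ r → Zero (coeff r (# Z) k)) D≡0
                    (vanishing k l (trans k+l≡N (cong (ℕ._+ # Z) (sym D≡0))) k<X (ℕₚ.≤-reflexive (sym #Y)))))
        where
        k = # Z ℕ.∸ l
        k+l≡N : k ℕ.+ l ≡ # Z
        k+l≡N = ℕₚ.m∸n+n≡m (ℕₚ.≤-trans (ℕₚ.n≤1+n l) Y≤N)
        k<X : suc k ℕ.≤ # X
        k<X = ≤-from (ℕₚ.≰⇒> ¬p) 0 (trans (lem₁ k l (# X)) (trans (cong (λ n → # X ℕ.+ (2 ℕ.+ n)) k+l≡N) (lem₂ (# X) (# Z))))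
          where
          lem₁ : ∀ k l x → 1 ℕ.+ k ℕ.+ (x ℕ.+ (1 ℕ.+ l)) ℕ.+ 0 ≡ x ℕ.+ (2 ℕ.+ (k ℕ.+ l))
          lem₁ = ℕSolver.solve-∀
          lem₂ : ∀ x z → x ℕ.+ (2 ℕ.+ z) ≡ x ℕ.+ (1 ℕ.+ (z ℕ.+ 1))
          lem₂ = ℕSolver.solve-∀

-- Fibre sizes over ℤ/q and sums along a row

module Fibres where

  open Counting
  open import Data.Bool using (Bool; true; false; T; not; _∧_)
  open import Data.Bool.Properties using (T?)
  open import Data.Nat using (ℕ; zero; suc; _+_; _*_; _∸_; _≤_; _<_; z≤n; s≤s; _<ᵇ_; _≤?_)
  open import Data.Nat.Properties
  open import Data.Nat.Tactic.RingSolver using (solve-∀)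
  open import Data.Fin using (Fin; zero; suc)
  import Data.Fin.Properties as Finₚ
  open import Data.Product using (_×_; _,_; proj₁; proj₂)
  open import Data.Sum using (_⊎_; inj₁; inj₂)
  import Data.Sum as Sum
  open import Data.Empty using (⊥-elim)
  open import Data.Unit using (tt)
  open import Function using (_∘_)
  open import Relation.Nullary using (yes; no; does)
  open import Relation.Binary.PropositionalEquality
  open import Algebra.Properties.CommutativeMonoid.Sum +-0-commutativeMonoid
    using (sum; sum-cong-≗; ∑-distrib-+)

  -- The operations `_⊕_` and `_⊖_` are not tied to each other, and commutativity is not among the
  -- fields. Exchanging A and B, which turns i ⊖ j into j ⊖ i, thus gives another instance with the
  -- same S.
  record Addition (q : ℕ) : Set where
    infixl 6 _⊕_ _⊖_ _⊘ʳ_ _⊘ˡ_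
    field
      _⊕_ _⊖_ _⊘ʳ_ _⊘ˡ_ : Fin q → Fin q → Fin q
      ⊘ʳ-⊕ : ∀ k j → (k ⊘ʳ j) ⊕ j ≡ k
      ⊕-⊘ʳ : ∀ i j → (i ⊕ j) ⊘ʳ j ≡ i
      ⊘ˡ-⊕ : ∀ k i → i ⊕ (k ⊘ˡ i) ≡ k
      ⊕-⊘ˡ : ∀ i j → (i ⊕ j) ⊘ˡ i ≡ j
      ⊖-injˡ : ∀ i i′ j → i ⊖ j ≡ i′ ⊖ j → i ≡ i′
      ⊖-injʳ : ∀ i j j′ → i ⊖ j ≡ i ⊖ j′ → j ≡ j′
      restricted : ∀ X Y D Z → (∀ i j → T (X i) → T (Y j) → T (D (i ⊖ j)) ⊎ T (Z (i ⊕ j))) →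
                   1 ≤ # X → 1 ≤ # Y → # D < q → # Z < q → # X + # Y ≤ # Z + # D + 2
      cauchy-davenport : ∀ X Y Z → (∀ i j → T (X i) → T (Y j) → T (Z (i ⊕ j))) →
                         1 ≤ # X → 1 ≤ # Y → # Z < q → # X + # Y ≤ # Z + 1

  swapAddition : ∀ {q} → Addition q → Addition q
  swapAddition A = record
    { _⊕_ = λ i j → j ⊕ i ; _⊖_ = λ i j → j ⊖ i ; _⊘ʳ_ = _⊘ˡ_ ; _⊘ˡ_ = _⊘ʳ_
    ; ⊘ʳ-⊕ = ⊘ˡ-⊕ ; ⊕-⊘ʳ = λ i j → ⊕-⊘ˡ j i ; ⊘ˡ-⊕ = ⊘ʳ-⊕ ; ⊕-⊘ˡ = λ i j → ⊕-⊘ʳ j i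
    ; ⊖-injˡ = λ i i′ j → ⊖-injʳ j i i′ ; ⊖-injʳ = λ i j j′ → ⊖-injˡ j j′ i
    ; restricted = λ X Y D Z h 1≤X 1≤Y D<q Z<q → subst (_≤ # Z + # D + 2) (+-comm (# Y) (# X))
        (restricted Y X D Z (λ i j p r → h j i r p) 1≤Y 1≤X D<q Z<q)
    ; cauchy-davenport = λ X Y Z h 1≤X 1≤Y Z<q → subst (_≤ # Z + 1) (+-comm (# Y) (# X))
        (cauchy-davenport Y X Z (λ i j p r → h j i r p) 1≤Y 1≤X Z<q) }
    where open Addition A

  -- The weak bound |A| + |B| ≤ |C| + 1 + ψ |S| has ψ s = 5 s - 3 for s > 0, which gains 3 for every further
  -- coset that meets S, and ψ 0 = 0, which is the bound of Cauchy and Davenport.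
  ψ : ℕ → ℕ
  ψ zero    = 0
  ψ (suc s) = 5 * s + 2

  ψ-pos : ∀ {s} → 1 ≤ s → ψ s + 3 ≡ 5 * s
  ψ-pos {suc s} _ = lem s
    where
    lem : ∀ s → 5 * s + 2 + 3 ≡ 5 * (1 + s)
    lem = solve-∀

  -- Fibre sizes of A, B, of a set C covering the restricted sumset, and of S.
  record Fibred {q : ℕ} (Add : Addition q) (a b c σ : Fin q → ℕ) : Set where
    open Addition Add
    field
      fibre-bound : ∀ i j → 1 ≤ a i → 1 ≤ b j → a i + b j ≤ c (i ⊕ j) + (1 + ψ (σ (i ⊖ j)))
      trivial-b   : ∀ i j → 1 ≤ a i → b j ≤ c (i ⊕ j) + σ (i ⊖ j)
      trivial-a   : ∀ i j → 1 ≤ b j → a i ≤ c (i ⊕ j) + σ (i ⊖ j)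
      c<q         : sum c < q
      1≤a         : 1 ≤ sum a
      1≤b         : 1 ≤ sum b

  swapFibred : ∀ {q Add a b c σ} → Fibred {q} Add a b c σ → Fibred (swapAddition Add) b a c σ
  swapFibred {a = a} {b} {c} D = record
    { fibre-bound = λ i j p r → ≤-trans (≤-reflexive (+-comm (b i) (a j))) (fibre-bound j i r p)
    ; trivial-b = λ i j → trivial-a j i ; trivial-a = λ i j → trivial-b j i
    ; c<q = c<q ; 1≤a = 1≤b ; 1≤b = 1≤a }
    where open Fibred D

  supp-pos : ∀ {n} (f : Fin n → ℕ) {i} → T (supp f i) → 1 ≤ f i
  supp-pos f {i} = <ᵇ⇒< 0 (f i)

  pos-supp : ∀ {n} (f : Fin n → ℕ) {i} → 1 ≤ f i → T (supp f i)
  pos-supp f = <⇒<ᵇ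

  #supp-pos : ∀ {n} (f : Fin n → ℕ) → 1 ≤ sum f → 1 ≤ # (supp f)
  #supp-pos f h with sum-pos f h
  ... | i , p = #-pos {P = supp f} i (pos-supp f p)

  #-unique : ∀ {n} (P : Fin n → Bool) i j → # P ≤ 1 → T (P i) → T (P j) → i ≡ j
  #-unique P i j #P≤1 Pi Pj with i Finₚ.≟ j
  ... | yes i≡j = i≡j
  ... | no  i≢j = ⊥-elim (<⇒≱ (s≤s (s≤s z≤n)) (≤-trans two #P≤1))
    where
    open ≤-Reasoning
    two : 2 ≤ # P
    two = begin
      2                                  ≡⟨ cong₂ _+_ (𝟙-T Pi) (trans (omit-≢ (𝟙 ∘ P) (i≢j ∘ sym)) (𝟙-T Pj)) ⟨
      𝟙 (P i) + omit i (𝟙 ∘ P) j         ≤⟨ +-monoʳ-≤ (𝟙 (P i)) (term≤sum (omit i (𝟙 ∘ P)) j) ⟩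
      𝟙 (P i) + sum (omit i (𝟙 ∘ P))     ≡⟨ sum-omit (𝟙 ∘ P) i ⟨
      # P                                ∎

  omit-mono : ∀ {n} {f g : Fin n → ℕ} k → (∀ i → f i ≤ g i) → ∀ i → omit k f i ≤ omit k g i
  omit-mono k h i with does (i Finₚ.≟ k)
  ... | true  = z≤n
  ... | false = h i

  -- The term at `k` is kept in full and every other element of `E` contributes at least 1.
  sum-supp-term : ∀ {n} (E : Fin n → Bool) (f : Fin n → ℕ) → (∀ k → T (E k) → 1 ≤ f k) → ∀ k → f k + # E ≤ sum f + 1
  sum-supp-term E f h k = begin
    f k + # E                                      ≡⟨ cong (f k +_) (sum-omit (𝟙 ∘ E) k) ⟩
    f k + (𝟙 (E k) + sum (omit k (𝟙 ∘ E)))          ≤⟨ +-monoʳ-≤ (f k) (𝟙≤1 (E k) ⊞ sum-mono (omit-mono k λ i → 𝟙-≤ (h i))) ⟩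
    f k + (1 + sum (omit k f))                     ≡⟨ lem (f k) (sum (omit k f)) ⟩
    (f k + sum (omit k f)) + 1                     ≡⟨ cong (_+ 1) (sum-omit f k) ⟨
    sum f + 1                                      ∎
    where
    open ≤-Reasoning
    lem : ∀ x y → x + (1 + y) ≡ (x + y) + 1
    lem = solve-∀

  module Rows {q : ℕ} {Add : Addition q} {a b c σ : Fin q → ℕ} (D : Fibred Add a b c σ) where
    open Addition Add
    open Fibred D

    m l r s : ℕ
    m = # (supp a)
    l = # (supp b)
    r = # (supp σ)
    s = sum σ

    i₁ j₁ : Fin q
    i₁ = proj₁ (argmax a (proj₁ (sum-pos a 1≤a)))
    j₁ = proj₁ (argmax b (proj₁ (sum-pos b 1≤b)))

    α β : ℕ
    α = a i₁
    β = b j₁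

    a≤α : ∀ i → a i ≤ α
    a≤α = proj₂ (argmax a (proj₁ (sum-pos a 1≤a)))

    b≤β : ∀ j → b j ≤ β
    b≤β = proj₂ (argmax b (proj₁ (sum-pos b 1≤b)))

    1≤α : 1 ≤ α
    1≤α = ≤-trans (proj₂ (sum-pos a 1≤a)) (a≤α _)

    1≤β : 1 ≤ β
    1≤β = ≤-trans (proj₂ (sum-pos b 1≤b)) (b≤β _)

    1≤m : 1 ≤ m
    1≤m = #supp-pos a 1≤a

    1≤l : 1 ≤ l
    1≤l = #supp-pos b 1≤b

    σ≤s : ∀ d → σ d ≤ s
    σ≤s = term≤sum σ

    r≤s : r ≤ s
    r≤s = #supp≤sum σ

    -- What B lacks compared with having all its nonempty fibres of the maximal size `β`.
    deficit : ℕ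
    deficit = sum (λ j → 𝟙 (supp b j) * (β ∸ b j))

    b+deficit : sum b + deficit ≡ l * β
    b+deficit = trans (sym (∑-distrib-+ b (λ j → 𝟙 (supp b j) * (β ∸ b j))))
      (trans (sum-cong-≗ λ j → lem (b j) (b≤β j)) (sum-*ʳ (𝟙 ∘ supp b) β))
      where
      lem : ∀ x → x ≤ β → x + 𝟙 (0 <ᵇ x) * (β ∸ x) ≡ 𝟙 (0 <ᵇ x) * β
      lem zero    _ = refl
      lem (suc x) h = trans (cong (suc x +_) (+-identityʳ _)) (trans (m+[n∸m]≡n h) (sym (*-identityˡ β)))

    b≤lβ : sum b ≤ l * β
    b≤lβ = ≤-trans (m≤m+n _ _) (≤-reflexive b+deficit)

    deficit-term : ∀ j → 1 ≤ b j → β ≤ deficit + b j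
    deficit-term j 1≤bj = begin
      β                                     ≡⟨ m∸n+n≡m (b≤β j) ⟨
      β ∸ b j + b j                         ≡⟨ cong (_+ b j) (trans (sym (*-identityˡ _)) (cong (_* (β ∸ b j)) (sym (𝟙-T (pos-supp b 1≤bj))))) ⟩
      𝟙 (supp b j) * (β ∸ b j) + b j        ≤⟨ +-monoˡ-≤ (b j) (term≤sum (λ j → 𝟙 (supp b j) * (β ∸ b j)) j) ⟩
      deficit + b j                         ∎
      where open ≤-Reasoning

    b+β : ∀ j → 1 ≤ b j → sum b + β ≤ l * β + b j
    b+β j 1≤bj = ≤-from (deficit-term j 1≤bj ⊞ ≤-reflexive b+deficit) 0 (lem (sum b) β deficit (b j) (l * β))
      where
      lem : ∀ B β d y L → (B + β) + ((d + y) + L) + 0 ≡ (L + y) + (β + (B + d))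
      lem = solve-∀

    -- The translate of the support of `a` by `j₁`: the cosets that A reaches with the largest fibre
    -- of B.
    row : Fin q → Bool
    row k = supp a (k ⊘ʳ j₁)

    rowSum offRow : ℕ
    rowSum = sum (λ k → 𝟙 (row k) * c k)
    offRow = sum (λ k → 𝟙 (not (row k)) * c k)

    row+off : sum c ≡ rowSum + offRow
    row+off = trans (sum-cong-≗ λ k → lem (row k) (c k)) (∑-distrib-+ (λ k → 𝟙 (row k) * c k) _)
      where
      lem : ∀ p x → x ≡ 𝟙 p * x + 𝟙 (not p) * x
      lem true  x = sym (trans (+-identityʳ _) (*-identityˡ x))
      lem false x = sym (*-identityˡ x)

    ⊕-injˡ : ∀ i i′ j → i ⊕ j ≡ i′ ⊕ j → i ≡ i′
    ⊕-injˡ i i′ j e = trans (sym (⊕-⊘ʳ i j)) (trans (cong (_⊘ʳ j) e) (⊕-⊘ʳ i′ j))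

    ⊘ʳ-inj : ∀ k k′ j → k ⊘ʳ j ≡ k′ ⊘ʳ j → k ≡ k′
    ⊘ʳ-inj k k′ j e = trans (sym (⊘ʳ-⊕ k j)) (trans (cong (_⊕ j) e) (⊘ʳ-⊕ k′ j))

    #row≤m : # row ≤ m
    #row≤m = #-inj {P = row} {Q = supp a} (_⊘ʳ j₁) (λ _ p → p) (λ k k′ _ _ → ⊘ʳ-inj k k′ j₁)

    row-reindex : sum (λ i → 𝟙 (supp a i) * c (i ⊕ j₁)) ≤ rowSum
    row-reindex = sum-inj _ (λ k → 𝟙 (row k) * c k) (_⊕ j₁)
      (λ i → ≤-reflexive (cong (λ i′ → 𝟙 (supp a i′) * c (i ⊕ j₁)) (sym (⊕-⊘ʳ i j₁))))
      (λ i i′ _ _ → ⊕-injˡ i i′ j₁)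

    diagonal-reindex : ∀ (f : Fin q → ℕ) → sum (λ i → f (i ⊖ j₁)) ≤ sum f
    diagonal-reindex f = sum-inj _ f (_⊖ j₁) (λ _ → ≤-refl) (λ i i′ _ _ → ⊖-injˡ i i′ j₁)

    sum-ψ : sum (ψ ∘ σ) + 3 * r ≡ 5 * s
    sum-ψ = begin
      sum (ψ ∘ σ) + 3 * r                                ≡⟨ cong (sum (ψ ∘ σ) +_) (trans (*-comm 3 r) (sym (sum-*ʳ (𝟙 ∘ supp σ) 3))) ⟩
      sum (ψ ∘ σ) + sum (λ d → 𝟙 (supp σ d) * 3)         ≡⟨ ∑-distrib-+ (ψ ∘ σ) (λ d → 𝟙 (supp σ d) * 3) ⟨
      sum (λ d → ψ (σ d) + 𝟙 (supp σ d) * 3)             ≡⟨ sum-cong-≗ (λ d → lem (σ d)) ⟩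
      sum (λ d → σ d * 5)                                ≡⟨ sum-*ʳ σ 5 ⟩
      s * 5                                              ≡⟨ *-comm s 5 ⟩
      5 * s                                              ∎
      where
      open ≡-Reasoning
      lem : ∀ x → ψ x + 𝟙 (0 <ᵇ x) * 3 ≡ x * 5
      lem zero    = refl
      lem (suc x) = trans (ψ-pos {suc x} (s≤s z≤n)) (*-comm 5 (suc x))

    -- The fibre bounds for the pairs (i, j₁) are added. The differences i ⊖ j₁ are distinct, so the
    -- terms in ψ add up to at most 5 s - 3 r.
    row-bound : sum a + m * β + 3 * r ≤ rowSum + m + 5 * s
    row-bound = ≤-from (sums ⊞ row-reindex ⊞ diagonal-reindex (ψ ∘ σ) ⊞ ≤-reflexive sum-ψ) 0
        (lem (sum a) (m * β) (3 * r) rowSum m (5 * s) (sum f) (sum g) (sum (ψ ∘ σ)))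
      where
      f = λ i → 𝟙 (supp a i) * c (i ⊕ j₁)
      g = λ i → ψ (σ (i ⊖ j₁))
      lem : ∀ A M r′ R m s′ F G P → (A + M + r′) + ((F + m + G) + (R + (P + s′))) + 0 ≡ (R + m + s′) + ((A + M) + (F + (G + (P + r′))))
      lem = solve-∀
      pointwise : ∀ i → a i + 𝟙 (supp a i) * β ≤ f i + 𝟙 (supp a i) + g i
      pointwise i with a i in ai | fibre-bound i j₁
      ... | zero  | _ = z≤n
      ... | suc x | h rewrite *-identityˡ β | *-identityˡ (c (i ⊕ j₁)) =
        ≤-trans (h (s≤s z≤n) 1≤β) (≤-reflexive (sym (+-assoc (c (i ⊕ j₁)) 1 _)))
      sums : sum a + m * β ≤ sum f + m + sum g
      sums = subst₂ _≤_
        (trans (∑-distrib-+ a (λ i → 𝟙 (supp a i) * β)) (cong (sum a +_) (sum-*ʳ (𝟙 ∘ supp a) β)))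
        (trans (∑-distrib-+ (λ i → f i + 𝟙 (supp a i)) g) (cong (_+ sum g) (∑-distrib-+ f (𝟙 ∘ supp a))))
        (sum-mono pointwise)

    row-trivial : m * β ≤ rowSum + s
    row-trivial = begin
      m * β                                                  ≡⟨ sum-*ʳ (𝟙 ∘ supp a) β ⟨
      sum (λ i → 𝟙 (supp a i) * β)                           ≤⟨ sum-mono pointwise ⟩
      sum (λ i → 𝟙 (supp a i) * c (i ⊕ j₁) + σ (i ⊖ j₁))     ≡⟨ ∑-distrib-+ (λ i → 𝟙 (supp a i) * c (i ⊕ j₁)) _ ⟩
      _                                                      ≤⟨ row-reindex ⊞ diagonal-reindex σ ⟩
      rowSum + s                                             ∎
      where
      open ≤-Reasoning
      pointwise : ∀ i → 𝟙 (supp a i) * β ≤ 𝟙 (supp a i) * c (i ⊕ j₁) + σ (i ⊖ j₁)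
      pointwise i with a i in ai | trivial-b i j₁
      ... | zero  | _ = z≤n
      ... | suc x | h rewrite *-identityˡ β | *-identityˡ (c (i ⊕ j₁)) = h (s≤s z≤n)

    rowSum<q : rowSum < q
    rowSum<q = ≤-<-trans (subst (rowSum ≤_) (sym row+off) (m≤m+n rowSum offRow)) c<q

    column-trivial : ∀ j → 1 ≤ b j → sum a ≤ sum c + s
    column-trivial j 1≤bj = ≤-trans (sum-mono λ i → trivial-a i j 1≤bj)
      (≤-trans (≤-reflexive (∑-distrib-+ (λ i → c (i ⊕ j)) _))
        (sum-inj _ c (_⊕ j) (λ _ → ≤-refl) (λ i i′ _ _ → ⊕-injˡ i i′ j)
         ⊞ sum-inj _ σ (_⊖ j) (λ _ → ≤-refl) (λ i i′ _ _ → ⊖-injˡ i i′ j)))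

    outside : (Fin q → Bool) → Fin q → Bool
    outside Z k = Z k ∧ not (row k)

    #≤m+outside : ∀ Z → # Z ≤ m + # (outside Z)
    #≤m+outside Z = ≤-trans (≤-reflexive (#-⊎ Z row))
      (+-monoˡ-≤ (# (outside Z)) (≤-trans (#-mono {P = λ k → Z k ∧ row k} {row} λ k p → proj₂ (∧-elim {Z k} p)) #row≤m))

    #c<q : ∀ t → # (upper c t) < q
    #c<q t = ≤-<-trans (≤-trans (#-mono {P = upper c t} {supp c} λ k p → pos-supp c (≤-trans (s≤s z≤n) (<ᵇ⇒< t (c k) p)))
                                (#supp≤sum c)) c<q

    -- Where S has no elements the fibre bound has ψ 0 = 0 and is that of Cauchy and Davenport.
    supp-c : ∀ i j → 1 ≤ a i → 1 ≤ b j → T (supp σ (i ⊖ j)) ⊎ a i + b j ≤ c (i ⊕ j) + 1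
    supp-c i j 1≤ai 1≤bj with σ (i ⊖ j) in eq | fibre-bound i j 1≤ai 1≤bj
    ... | zero  | h = inj₂ h
    ... | suc x | _ = inj₁ tt

    -- Off the support of `σ`, a i ≥ t + 1 and b j ≥ u + 1 force c (i ⊕ j) ≥ t + u + 1, so the three
    -- level sets meet the hypothesis of the restricted inequality.
    level-bound : ∀ t u → t < α → u < β → r < q → # (upper a t) + # (upper b u) ≤ # (upper c (t + u)) + r + 2
    level-bound t u t<α u<β r<q = restricted (upper a t) (upper b u) (supp σ) (upper c (t + u)) cover
      (#-pos {P = upper a t} i₁ (<⇒<ᵇ t<α)) (#-pos {P = upper b u} j₁ (<⇒<ᵇ u<β)) r<q (#c<q (t + u))
      where
      cover : ∀ i j → T (upper a t i) → T (upper b u j) → T (supp σ (i ⊖ j)) ⊎ T (upper c (t + u) (i ⊕ j))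
      cover i j p p′ = Sum.map₂ (λ h → <⇒<ᵇ (≤-from (<ᵇ⇒< t (a i) p ⊞ <ᵇ⇒< u (b j) p′ ⊞ h) 0
                                    (lem t u (a i) (b j) (c (i ⊕ j)))))
        (supp-c i j (≤-trans (s≤s z≤n) (<ᵇ⇒< t (a i) p)) (≤-trans (s≤s z≤n) (<ᵇ⇒< u (b j) p′)))
        where
        lem : ∀ t u x y z → 1 + (t + u) + (x + (y + (z + 1))) + 0 ≡ z + (1 + t + (1 + u + (x + y)))
        lem = solve-∀

    outside≤offRow : ∀ Z → (∀ k → T (Z k) → 1 ≤ c k) → # (outside Z) ≤ offRow
    outside≤offRow Z h = sum-mono λ k → pointwise (Z k) (c k) (row k) (h k)
      where
      pointwise : ∀ z x p → (T z → 1 ≤ x) → 𝟙 (z ∧ not p) ≤ 𝟙 (not p) * x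
      pointwise false x p     _ = z≤n
      pointwise true  x true  _ = z≤n
      pointwise true  x false h = ≤-trans (h tt) (≤-reflexive (sym (*-identityˡ x)))

    -- The row has at most `m` cosets. The rest of the support of `c` lies outside it and
    -- contributes at least 1 per coset.
    extras : ∀ e → m + l ≤ # (supp c) + e → l ≤ offRow + e
    extras e h = ≤-from (h ⊞ #≤m+outside (supp c) ⊞ outside≤offRow (supp c) (λ k → supp-pos c {k})) 0 (lem m l e (# (supp c)) (# (outside (supp c))) offRow)
      where
      lem : ∀ m l r z e o → l + ((z + r) + ((m + e) + o)) + 0 ≡ o + r + ((m + l) + (z + e))
      lem = solve-∀

    Sums : Fin q → Bool
    Sums k = does (Finₚ.any? λ j → T? (supp b j ∧ supp a (k ⊘ʳ j)))

    -- A chosen class of B through which `k` is a sum; `j₁` is a default for other `k`.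
    sumOf : Fin q → Fin q
    sumOf k with Finₚ.any? (λ j → T? (supp b j ∧ supp a (k ⊘ʳ j)))
    ... | yes (j , _) = j
    ... | no  _       = j₁

    sumOf-spec : ∀ k → T (Sums k) → 1 ≤ b (sumOf k) × 1 ≤ a (k ⊘ʳ sumOf k)
    sumOf-spec k p with Finₚ.any? (λ j → T? (supp b j ∧ supp a (k ⊘ʳ j)))
    ... | yes (j , h) = supp-pos b (proj₁ (∧-elim {supp b j} h)) , supp-pos a (proj₂ (∧-elim {supp b j} h))

    ∈-Sums : ∀ i j → T (supp a i) → T (supp b j) → T (Sums (i ⊕ j))
    ∈-Sums i j p p′ = holds (Finₚ.any? _) (j , ∧-intro p′ (subst (λ x → T (supp a x)) (sym (⊕-⊘ʳ i j)) p))

    -- Cauchy and Davenport, unless the sumset is all of ℤ/q. In that case `row-trivial` with β ≥ s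
    -- + 1 ≥ 2 gives 2 m - 1 ≤ rowSum < q, hence m + l ≤ 2 m ≤ q.
    #Sums-bound : l ≤ m → 1 ≤ s → s < β → m + l ≤ # Sums + 1
    #Sums-bound l≤m 1≤s s<β with q ≤? # Sums
    ... | no  h = cauchy-davenport (supp a) (supp b) Sums ∈-Sums 1≤m 1≤l (≰⇒> h)
    ... | yes h = arith m l s β q rowSum (# Sums) l≤m 1≤m 1≤s s<β row-trivial rowSum<q h
      where
      arith : ∀ m l s β q R Z → l ≤ m → 1 ≤ m → 1 ≤ s → s < β → m * β ≤ R + s → R < q → q ≤ Z → m + l ≤ Z + 1
      arith (suc m) l s β q R Z l≤m _ (s≤s {n = s′} _) s<β mβ R<q q≤Z =
        ≤-from (l≤m ⊞ *-monoʳ-≤ (suc m) s<β ⊞ mβ ⊞ R<q ⊞ q≤Z) (1 + m * s′) (lem m l s′ β q R Z)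
        where
        lem : ∀ m l s β q R Z →
          (1 + m) + l + ((1 + m) + ((1 + m) * β + (R + (1 + s) + (q + Z)))) + (1 + m * s)
          ≡ Z + 1 + (l + ((1 + m) * (1 + (1 + s)) + ((1 + m) * β + (1 + R + q))))
        lem = solve-∀

-- The weak bound

module Weak where

  open Counting
  open Fibres
  open import Data.Bool using (Bool; T; not; _∧_)
  open import Data.Nat using (ℕ; zero; suc; _+_; _*_; _∸_; _≤_; _<_; z≤n; s≤s; _<ᵇ_; _≤?_)
  open import Data.Nat.Properties
  open import Data.Nat.Tactic.RingSolver using (solve-∀)
  open import Data.Fin using (Fin; zero; suc; toℕ)
  import Data.Fin.Properties as Finₚ
  open import Data.Product using (_×_; _,_; proj₁; proj₂)
  open import Data.Sum using (_⊎_; inj₁; inj₂; [_,_]′)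
  open import Data.Empty using (⊥-elim)
  open import Relation.Nullary using (Dec; yes; no; ¬_)
  open import Relation.Binary.PropositionalEquality
  open import Algebra.Properties.CommutativeMonoid.Sum +-0-commutativeMonoid
    using (sum; ∑-distrib-+)

  -- This is (m - l) (β - 1) ≥ 0 written without subtraction.
  rearrange : ∀ {m l β} → l ≤ m → 1 ≤ β → l * β + m ≤ m * β + l
  rearrange {l = l} l≤m (s≤s {n = β} _) with m≤n⇒∃[o]m+o≡n l≤m
  ... | d , refl = subst₂ _≤_ (lem₁ l d β) (lem₂ l d β) (m≤m+n (l * β + l + l + d) (d * β))
    where
    lem₁ : ∀ l d β → l * β + l + l + d ≡ l * (1 + β) + (l + d)
    lem₁ = solve-∀
    lem₂ : ∀ l d β → l * β + l + l + d + d * β ≡ (l + d) * (1 + β) + l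
    lem₂ = solve-∀

  module WeakBound {q : ℕ} {Add : Addition q} {a b c σ : Fin q → ℕ} (D : Fibred Add a b c σ) where
    open Addition Add
    open Fibred D
    open Rows D public

    Weak : Set
    Weak = sum a + sum b ≤ sum c + (1 + ψ s)

    weak-pos : 1 ≤ s → sum a + sum b + 2 ≤ sum c + 5 * s → Weak
    weak-pos 1≤s h = +-cancelʳ-≤ 2 _ _ (≤-trans h (≤-reflexive
      (trans (cong (sum c +_) (sym (ψ-pos 1≤s))) (lem (sum c) (ψ s)))))
      where
      lem : ∀ c p → c + (p + 3) ≡ c + (1 + p) + 2
      lem = solve-∀

    extras-restricted : l ≤ offRow + (r + 2)
    extras-restricted with l ≤? r + 2
    ... | yes h = ≤-trans h (m≤n+m (r + 2) offRow)
    ... | no  h = extras (r + 2) (≤-trans (level-bound 0 0 1≤α 1≤β r<q) (≤-reflexive (+-assoc (# (supp c)) r 2)))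
      where
      r<q : r < q
      r<q = ≤-trans (s≤s (m≤m+n r 2)) (≤-trans (≰⇒> h) (#≤n (supp b)))

    -- The row gains 3 r, the restricted inequality outside it loses r + 2, and the weak bound asks
    -- for 2 more: the balance is 2 r ≥ 4.
    weak-r≥2 : l ≤ m → 2 ≤ r → Weak
    weak-r≥2 l≤m 2≤r = weak-pos (≤-trans (s≤s z≤n) (≤-trans 2≤r r≤s))
      (subst (λ C → sum a + sum b + 2 ≤ C + 5 * s) (sym row+off)
        (≤-from (row-bound ⊞ b≤lβ ⊞ extras-restricted ⊞ rearrange l≤m 1≤β ⊞ 2≤r ⊞ 2≤r) 0
          (lem (sum a) (sum b) (m * β) (l * β) m l r s rowSum offRow)))
      where
      lem : ∀ A B M L m l r s R X →
        A + B + 2 + ((R + m + 5 * s) + (L + (X + (r + 2) + (M + l + (r + r))))) + 0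
        ≡ R + X + 5 * s + ((A + M + 3 * r) + (B + (l + ((L + m) + (2 + 2)))))
      lem = solve-∀

    -- The inequality of Cauchy and Davenport loses only 1 outside the row, which is exactly what
    -- the bound allows.
    weak-r≡0 : l ≤ m → r ≡ 0 → Weak
    weak-r≡0 l≤m r≡0 = subst (λ x → sum a + sum b ≤ sum c + (1 + ψ x)) (sym s≡0)
      (subst (λ C → sum a + sum b ≤ C + 1) (sym row+off)
        (≤-from (row-bound′ ⊞ b≤lβ ⊞ extras 1 cd ⊞ rearrange l≤m 1≤β) 0
          (lem (sum a) (sum b) (m * β) (l * β) m l rowSum offRow)))
      where
      r≮1 : ¬ 1 ≤ r
      r≮1 h = <⇒≢ h (sym r≡0)
      s≡0 : s ≡ 0
      s≡0 with s in eq
      ... | zero  = refl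
      ... | suc _ = ⊥-elim (r≮1 (#supp-pos σ (subst (1 ≤_) (sym eq) (s≤s z≤n))))
      cd : m + l ≤ # (supp c) + 1
      cd = cauchy-davenport (supp a) (supp b) (supp c) cover 1≤m 1≤l (#c<q 0)
        where
        cover : ∀ i j → T (supp a i) → T (supp b j) → T (supp c (i ⊕ j))
        cover i j p p′ with supp-c i j (supp-pos a p) (supp-pos b p′)
        ... | inj₁ z = ⊥-elim (r≮1 (#-pos {P = supp σ} (i ⊖ j) z))
        ... | inj₂ h = pos-supp c (+-cancelʳ-≤ 1 _ _ (≤-trans (supp-pos a p ⊞ supp-pos b p′) h))
      row-bound′ : sum a + m * β ≤ rowSum + m
      row-bound′ = subst₂ _≤_ (trans (cong (λ x → sum a + m * β + 3 * x) r≡0) (+-identityʳ _))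
                              (trans (cong (λ x → rowSum + m + 5 * x) s≡0) (+-identityʳ _)) row-bound
      lem : ∀ A B M L m l R X → A + B + ((R + m) + (L + (X + 1 + (M + l)))) + 0 ≡ R + X + 1 + ((A + M) + (B + (l + (L + m))))
      lem = solve-∀

    -- For r = 1 the balance of `weak-r≥2` falls short by 2. If β ≤ s, level sets or the trivial
    -- bound take over; if β > s, the restricted inequality is replaced by that of Cauchy and
    -- Davenport.
    module Single (r≡1 : r ≡ 1) where

      1≤s : 1 ≤ s
      1≤s = subst (_≤ s) r≡1 r≤s

      weak-trivial : sum b + 2 ≤ 4 * s → Weak
      weak-trivial h = weak-pos 1≤s (≤-from (column-trivial j₁ 1≤β ⊞ h) 0 (lem (sum a) (sum b) (sum c) s))
        where
        lem : ∀ A B C s → A + B + 2 + ((C + s) + 4 * s) + 0 ≡ C + 5 * s + (A + (B + 2))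
        lem = solve-∀

      -- Level `t` of `a` is paired with the support of `b`, and every level costs r + 2 = 3.
      levels-bound : 1 < q → sum a + α * l ≤ sum c + α * 3
      levels-bound 1<q = begin
        sum a + α * l                                                   ≡⟨ cong₂ _+_ (sum≡levels a α a≤α) (sum-const α l) ⟨
        sum {α} (λ t → # (upper a (toℕ t))) + sum {α} (λ _ → l)         ≡⟨ ∑-distrib-+ {α} (λ t → # (upper a (toℕ t))) (λ _ → l) ⟨
        sum {α} (λ t → # (upper a (toℕ t)) + l)                         ≤⟨ sum-mono {α} level ⟩
        sum {α} (λ t → # (upper c (toℕ t)) + 3)                         ≡⟨ ∑-distrib-+ {α} (λ t → # (upper c (toℕ t))) (λ _ → 3) ⟩
        sum {α} (λ t → # (upper c (toℕ t))) + sum {α} (λ _ → 3)         ≤⟨ levels≤sum c α ⊞ ≤-reflexive (sum-const α 3) ⟩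
        sum c + α * 3                                                   ∎
        where
        open ≤-Reasoning
        level : ∀ (t : Fin α) → # (upper a (toℕ t)) + l ≤ # (upper c (toℕ t)) + 3
        level t = ≤-trans (level-bound (toℕ t) 0 (Finₚ.toℕ<n t) 1≤β (subst (_< q) (sym r≡1) 1<q))
          (≤-reflexive (trans (cong₂ (λ w r → # (upper c w) + r + 2) (+-identityʳ (toℕ t)) r≡1) (+-assoc (# (upper c (toℕ t))) 1 2)))

      weak-levels : 1 < q → β ≤ s → β ≤ α → Weak
      weak-levels 1<q β≤s β≤α with sum b + 2 ≤? 4 * s
      ... | yes h = weak-trivial h
      ... | no  h = weak-pos 1≤s (arith (sum a) (sum b) (sum c) s α β l 1≤s β≤s β≤α b≤lβ (levels-bound 1<q) (≰⇒> h))
        where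
        arith : ∀ A B C s α β l → 1 ≤ s → β ≤ s → β ≤ α → B ≤ l * β → A + α * l ≤ C + α * 3 → 4 * s < B + 2 →
                A + B + 2 ≤ C + 5 * s
        -- Three fibres of B have at most 3 s elements together and are paid by 5 s; each of the
        -- other l - 3 has at most α elements, which the levels provide. For l ≤ 2 the failure of
        -- the trivial bound is contradicted by |B| ≤ 2 s.
        arith A B C s α β (suc (suc (suc l))) 1≤s β≤s β≤α B≤ h _ =
          ≤-from (h ⊞ B≤ ⊞ *-monoʳ-≤ 3 β≤s ⊞ *-monoʳ-≤ l β≤α ⊞ *-monoʳ-≤ 2 1≤s) 0 (lem A B C s α β l)
          where
          lem : ∀ A B C s α β l → A + B + 2 + ((C + α * 3) + ((3 + l) * β + (3 * s + (l * α + 2 * s)))) + 0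
                                ≡ C + 5 * s + ((A + α * (3 + l)) + (B + (3 * β + (l * β + 2 * 1))))
          lem = solve-∀
        arith A B C s α β 2 1≤s β≤s _ B≤ _ h = ⊥-elim (n≮0 {0} (≤-from (h ⊞ B≤ ⊞ *-monoʳ-≤ 2 β≤s ⊞ *-monoʳ-≤ 2 1≤s) 0 (lem B s β)))
          where
          lem : ∀ B s β → 1 + ((B + 2) + (2 * β + (2 * s + 2 * s))) + 0 ≡ 0 + ((1 + 4 * s) + (B + (2 * β + 2 * 1)))
          lem = solve-∀
        arith A B C s α β 1 1≤s β≤s _ B≤ _ h = ⊥-elim (n≮0 {0} (≤-from (h ⊞ B≤ ⊞ β≤s ⊞ *-monoʳ-≤ 3 1≤s) 1 (lem B s β)))
          where
          lem : ∀ B s β → 1 + ((B + 2) + (1 * β + (s + 3 * s))) + 1 ≡ 0 + ((1 + 4 * s) + (B + (β + 3 * 1)))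
          lem = solve-∀
        arith A B C s α β 0 1≤s β≤s _ B≤ _ h = ⊥-elim (n≮0 {0} (≤-from (h ⊞ B≤ ⊞ *-monoʳ-≤ 4 1≤s) 2 (lem B s)))
          where
          lem : ∀ B s → 1 + ((B + 2) + (0 + 4 * s)) + 2 ≡ 0 + ((1 + 4 * s) + (B + 4 * 1))
          lem = solve-∀

      -- A sum outside the row over which C is empty comes from a fibre of B with at most σ d ≤ s < β elements;
      -- as S meets one coset only, different sums use different fibres, and their deficit pays for them.
      short : Fin q → Bool
      short j = supp b j ∧ (b j <ᵇ β)

      #short≤deficit : # short ≤ deficit
      #short≤deficit = sum-mono λ j → pointwise (b j)
        where
        pointwise : ∀ x → 𝟙 ((0 <ᵇ x) ∧ (x <ᵇ β)) ≤ 𝟙 (0 <ᵇ x) * (β ∸ x)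
        pointwise zero    = z≤n
        pointwise (suc x) = 𝟙-≤ λ p → ≤-trans (m<n⇒0<n∸m (<ᵇ⇒< (suc x) β p)) (≤-reflexive (sym (*-identityˡ _)))

      empty : Fin q → Bool
      empty k = outside Sums k ∧ not (supp c k)

      short-sumOf : s < β → ∀ k → T (empty k) → T (short (sumOf k)) × T (supp σ ((k ⊘ʳ sumOf k) ⊖ sumOf k))
      short-sumOf s<β k p = ∧-intro (pos-supp b 1≤bj) (<⇒<ᵇ (≤-<-trans bj≤σ (≤-<-trans (σ≤s _) s<β)))
                          , pos-supp σ (≤-trans 1≤bj bj≤σ)
        where
        j = sumOf k
        spec = sumOf-spec k (proj₁ (∧-elim {Sums k} (proj₁ (∧-elim {outside Sums k} p))))
        1≤bj = proj₁ spec
        ck≡0 : c k ≡ 0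
        ck≡0 with c k | proj₂ (∧-elim {outside Sums k} p)
        ... | zero | _ = refl
        bj≤σ : b j ≤ σ ((k ⊘ʳ j) ⊖ j)
        bj≤σ = subst (λ x → b j ≤ x + σ ((k ⊘ʳ j) ⊖ j)) (trans (cong c (⊘ʳ-⊕ k j)) ck≡0) (trivial-b (k ⊘ʳ j) j (proj₂ spec))

      #empty≤deficit : s < β → # empty ≤ deficit
      #empty≤deficit s<β = ≤-trans (#-inj {P = empty} {Q = short} sumOf (λ k p → proj₁ (short-sumOf s<β k p)) inj) #short≤deficit
        where
        inj : ∀ k k′ → T (empty k) → T (empty k′) → sumOf k ≡ sumOf k′ → k ≡ k′
        inj k k′ p p′ e = ⊘ʳ-inj k k′ (sumOf k) (⊖-injˡ _ _ (sumOf k)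
          (#-unique (supp σ) _ _ (≤-reflexive r≡1) (proj₂ (short-sumOf s<β k p))
            (subst (λ j → T (supp σ ((k′ ⊘ʳ j) ⊖ j))) (sym e) (proj₂ (short-sumOf s<β k′ p′)))))

      -- The unrestricted sumset loses 1 instead of 3. Its classes on which C is empty are charged
      -- to `deficit`, which `b+deficit` subtracts from l β.
      weak-tall : l ≤ m → s < β → Weak
      weak-tall l≤m s<β = weak-pos 1≤s (subst (λ C → sum a + sum b + 2 ≤ C + 5 * s) (sym row+off)
        (≤-from (row-bound′ ⊞ ≤-reflexive b+deficit ⊞ #Sums-bound l≤m 1≤s s<β ⊞ #≤m+outside Sums ⊞ split ⊞ rearrange l≤m 1≤β) 0
          (lem (sum a) (sum b) (m * β) (l * β) m l s deficit rowSum offRow (# Sums) (# (outside Sums)))))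
        where
        row-bound′ : sum a + m * β + 3 ≤ rowSum + m + 5 * s
        row-bound′ = subst (λ x → sum a + m * β + 3 * x ≤ rowSum + m + 5 * s) r≡1 row-bound
        split : # (outside Sums) ≤ offRow + deficit
        split = ≤-trans (≤-reflexive (#-⊎ (outside Sums) (supp c)))
          (≤-trans (#-mono {P = λ k → outside Sums k ∧ supp c k} {λ k → outside (supp c) k}
                     (λ k p → ∧-intro (proj₂ (∧-elim {outside Sums k} p)) (proj₂ (∧-elim {Sums k} (proj₁ (∧-elim {outside Sums k} p))))))
                   (outside≤offRow (supp c) (λ k → supp-pos c {k}))
            ⊞ #empty≤deficit s<β)
        lem : ∀ A B M L m l s d R X Z E →
          A + B + 2 + ((R + m + 5 * s) + (L + (Z + 1 + (m + E + (X + d + (M + l)))))) + 0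
          ≡ R + X + 5 * s + ((A + M + 3) + ((B + d) + ((m + l) + (Z + (E + (L + m))))))
        lem = solve-∀

  weak-half : ∀ {q Add a b c σ} → 1 < q → (D : Fibred {q} Add a b c σ) → Rows.l D ≤ Rows.m D →
              Rows.r D ≢ 1 ⊎ Rows.s D < Rows.β D → sum a + sum b ≤ sum c + (1 + ψ (sum σ))
  weak-half 1<q D l≤m h with Rows.r D in r≡
  ... | zero          = WeakBound.weak-r≡0 D l≤m r≡
  ... | suc (suc r)   = WeakBound.weak-r≥2 D l≤m (subst (2 ≤_) (sym r≡) (s≤s (s≤s z≤n)))
  weak-half 1<q D l≤m (inj₁ r≢1) | 1 = ⊥-elim (r≢1 refl)
  weak-half 1<q D l≤m (inj₂ s<β) | 1 = WeakBound.Single.weak-tall D r≡ l≤m s<β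

  -- Exchanging A and B arranges l ≤ m for the row arguments and β ≤ α for the level argument.
  weak-bound : ∀ {q Add a b c σ} → 1 < q → Fibred {q} Add a b c σ → sum a + sum b ≤ sum c + (1 + ψ (sum σ))
  weak-bound {a = a} {b} {c} {σ} 1<q D with Rows.r D Data.Nat.≟ 1
  ... | no r≢1 = [ (λ m≤l → swapped (weak-half 1<q (swapFibred D) m≤l (inj₁ r≢1))) , (λ l≤m → weak-half 1<q D l≤m (inj₁ r≢1)) ]′
                   (≤-total (Rows.m D) (Rows.l D))
    where
    swapped : sum b + sum a ≤ sum c + (1 + ψ (sum σ)) → sum a + sum b ≤ sum c + (1 + ψ (sum σ))
    swapped = subst (_≤ sum c + (1 + ψ (sum σ))) (+-comm (sum b) (sum a))
  ... | yes r≡1 = cases (Rows.β D ≤? Rows.s D) (Rows.α D ≤? Rows.s D)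
    where
    E = swapFibred D
    swapped : sum b + sum a ≤ sum c + (1 + ψ (sum σ)) → sum a + sum b ≤ sum c + (1 + ψ (sum σ))
    swapped = subst (_≤ sum c + (1 + ψ (sum σ))) (+-comm (sum b) (sum a))
    low-β : Rows.β D ≤ Rows.s D → Rows.β D ≤ Rows.α D → sum a + sum b ≤ sum c + (1 + ψ (sum σ))
    low-β = WeakBound.Single.weak-levels D r≡1 1<q
    low-α : Rows.α D ≤ Rows.s D → Rows.α D ≤ Rows.β D → sum a + sum b ≤ sum c + (1 + ψ (sum σ))
    low-α h h′ = swapped (WeakBound.Single.weak-levels E r≡1 1<q h h′)
    cases : Dec (Rows.β D ≤ Rows.s D) → Dec (Rows.α D ≤ Rows.s D) → sum a + sum b ≤ sum c + (1 + ψ (sum σ))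
    cases (yes p) (yes p′) = [ low-α p′ , low-β p ]′ (≤-total (Rows.α D) (Rows.β D))
    cases (yes p) (no ¬p′) = low-β p (≤-trans p (<⇒≤ (≰⇒> ¬p′)))
    cases (no ¬p) (yes p′) = low-α p′ (≤-trans p′ (<⇒≤ (≰⇒> ¬p)))
    cases (no ¬p) (no ¬p′) = [ (λ m≤l → swapped (weak-half 1<q E m≤l (inj₂ (≰⇒> ¬p′)))) , (λ l≤m → weak-half 1<q D l≤m (inj₂ (≰⇒> ¬p))) ]′
                               (≤-total (Rows.m D) (Rows.l D))

-- The sharp bound when A or B meets two cosets

module Strong where

  open Counting
  open Fibres
  open import Data.Bool using (Bool; true; false; T; not; _∧_)
  open import Data.Bool.Properties using (T?)
  open import Data.Nat using (ℕ; zero; suc; _+_; _*_; _≤_; _<_; pred; z≤n; s≤s; s≤s⁻¹; >-nonZero; _<ᵇ_; _≤?_; _<?_)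
  open import Data.Nat.Properties
  open import Data.Nat.Tactic.RingSolver using (solve-∀)
  open import Data.Fin using (Fin; zero; suc; toℕ)
  import Data.Fin.Properties as Finₚ
  open import Data.Product using (∃; _×_; _,_; proj₁; proj₂)
  open import Data.Sum using (_⊎_; inj₁; inj₂; [_,_]′)
  open import Data.Empty using (⊥; ⊥-elim)
  open import Function using (_∘_)
  open import Relation.Nullary using (Dec; yes; no; does; ¬_)
  open import Relation.Binary.PropositionalEquality
  open import Algebra.Properties.CommutativeMonoid.Sum +-0-commutativeMonoid
    using (sum; ∑-distrib-+)

  module StrongBound {q : ℕ} {Add : Addition q} {a b c σ : Fin q → ℕ} (D : Fibred Add a b c σ) where
    open Addition Add
    open Fibred D
    open Rows D public

    Strong : Set
    Strong = sum a + sum b ≤ sum c + (s + 2)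

    -- The common balance: 4 s is the excess of the row's 5 s over the target s, `d` counts the
    -- surplus cosets of A, and `x`, `y` record a saving on |B| ≤ l β, mostly β against the size of
    -- one chosen fibre.
    strong-from : ∀ d x y → l + d ≡ m → sum b + x ≤ l * β + y →
                  4 * s + l + d + y ≤ offRow + 2 + 3 * r + d * β + x → Strong
    strong-from d x y l+d≡m h h′ = subst (λ C → sum a + sum b ≤ C + (s + 2)) (sym row+off)
      (≤-from (subst (λ m → sum a + m * β + 3 * r ≤ rowSum + m + 5 * s) (sym l+d≡m) row-bound ⊞ h ⊞ h′) 0
        (lem (sum a) (sum b) l d s r β x y rowSum offRow))
      where
      lem : ∀ A B l d s r β x y R X →
        A + B + ((R + (l + d) + 5 * s) + ((l * β + y) + (X + 2 + 3 * r + d * β + x))) + 0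
        ≡ R + X + (s + 2) + ((A + (l + d) * β + 3 * r) + ((B + x) + (4 * s + l + d + y)))
      lem = solve-∀

    ≤offRow : ∀ k → T (not (row k)) → c k ≤ offRow
    ≤offRow k p = ≤-trans (≤-reflexive (sym (trans (cong (_* c k) (𝟙-T p)) (*-identityˡ (c k)))))
                          (term≤sum (λ k → 𝟙 (not (row k)) * c k) k)

    -- With a single fibre, β is at least |B| and so at least 4 s; the second coset of A brings one
    -- more β, which repays 4 s.
    strong-l≡1 : ∀ d → l + suc d ≡ m → l ≡ 1 → 4 * s ≤ sum b → Strong
    strong-l≡1 d l+d≡m l≡1 h = strong-from (suc d) 0 0 l+d≡m
      (≤-trans (≤-reflexive (+-identityʳ (sum b))) (≤-trans b≤lβ (≤-reflexive (sym (+-identityʳ (l * β))))))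
      (subst (λ l → 4 * s + l + suc d + 0 ≤ offRow + 2 + 3 * r + suc d * β + 0) (sym l≡1)
        (≤-from (h ⊞ subst (λ l → sum b ≤ l * β) l≡1 b≤lβ ⊞ *-monoʳ-≤ d 1≤β) (offRow + 3 * r)
          (lem (sum b) s d β offRow r)))
      where
      lem : ∀ B s d β X r → (4 * s + 1 + (1 + d) + 0) + (B + (1 * β + d * β)) + (X + 3 * r)
                          ≡ (X + 2 + 3 * r + (1 + d) * β + 0) + (4 * s + (B + d * 1))
      lem = solve-∀

    -- As l ≥ 2, Cauchy and Davenport provide a sum outside the row. The fibre of B behind it is
    -- small unless C is large there.
    extra-sum : l ≤ m → 1 ≤ s → s < β → 2 ≤ l → ∃ λ j → 1 ≤ b j × b j ≤ offRow + s
    extra-sum l≤m 1≤s s<β 2≤l = bound (#-witness (outside Sums)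
      (≤-from (2≤l ⊞ #Sums-bound l≤m 1≤s s<β ⊞ #≤m+outside Sums) 0 (lem m l (# Sums) (# (outside Sums)))))
      where
      lem : ∀ m l Z E → 1 + (l + (Z + 1 + (m + E))) + 0 ≡ E + (2 + (m + l + Z))
      lem = solve-∀
      bound : (∃ λ k → T (outside Sums k)) → ∃ λ j → 1 ≤ b j × b j ≤ offRow + s
      bound (k , p) = j , proj₁ spec , ≤-trans (trivial-b (k ⊘ʳ j) j (proj₂ spec))
          (≤-trans (≤-reflexive (cong c (⊘ʳ-⊕ k j))) (≤offRow k (proj₂ (∧-elim {Sums k} p))) ⊞ σ≤s _)
        where
        j = sumOf k
        spec = sumOf-spec k (proj₁ (∧-elim {Sums k} p))

    -- The fibre found by `extra-sum` counts offRow + s in place of β. This raises the debt from 4 s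
    -- to 5 s, to be met by β + 2 r.
    strong-small : ∀ d → l + d ≡ m → 1 ≤ s → s < β → 2 ≤ l → l ≤ r + 2 → 5 * s ≤ β + 2 * r → Strong
    strong-small d l+d≡m 1≤s s<β 2≤l l≤r+2 h = use (extra-sum (m+n≤o⇒m≤o l (≤-reflexive l+d≡m)) 1≤s s<β 2≤l)
      where
      lem : ∀ l d s r β y X → (4 * s + l + d + y) + ((X + s) + ((r + 2) + (d * β + (β + 2 * r)))) + 0
                            ≡ (X + 2 + 3 * r + d * β + β) + (y + (l + (d * 1 + 5 * s)))
      lem = solve-∀
      use : (∃ λ j → 1 ≤ b j × b j ≤ offRow + s) → Strong
      use (j , 1≤bj , bj≤) = strong-from d β (b j) l+d≡m (b+β j 1≤bj)
        (≤-from (bj≤ ⊞ l≤r+2 ⊞ *-monoʳ-≤ d 1≤β ⊞ h) 0 (lem l d s r β (b j) offRow))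

    -- Here `k` is a sum of supports through a difference that avoids S; such classes form the
    -- restricted sumset of the supports, where c k ≥ a i + b j - 1.
    GoodAt : Fin q → Fin q → Bool
    GoodAt k j = supp b j ∧ (supp a (k ⊘ʳ j) ∧ not (supp σ ((k ⊘ʳ j) ⊖ j)))

    Good : Fin q → Bool
    Good k = does (Finₚ.any? λ j → T? (GoodAt k j))

    not-both : ∀ {p} → T p → T (not p) → ⊥
    not-both {true} _ ()

    Good-spec : ∀ k → T (Good k) → ∃ λ j → ∃ λ i → 1 ≤ b j × 1 ≤ a i × a i + b j ≤ c k + 1
    Good-spec k p = use (witness (Finₚ.any? λ j → T? (GoodAt k j)) p)
      where
      use : (∃ λ j → T (GoodAt k j)) → ∃ λ j → ∃ λ i → 1 ≤ b j × 1 ≤ a i × a i + b j ≤ c k + 1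
      use (j , h) = j , i , supp-pos b hb , supp-pos a ha ,
                  [ (λ z → ⊥-elim (not-both z hσ)) , subst (λ k → a i + b j ≤ c k + 1) (⊘ʳ-⊕ k j) ]′
                    (supp-c i j (supp-pos a ha) (supp-pos b hb))
        where
        i = k ⊘ʳ j
        hb = proj₁ (∧-elim {supp b j} h)
        ha = proj₁ (∧-elim {supp a i} (proj₂ (∧-elim {supp b j} h)))
        hσ = proj₂ (∧-elim {supp a i} (proj₂ (∧-elim {supp b j} h)))

    Good-pos : ∀ k → T (Good k) → 1 ≤ c k
    Good-pos k p = use (Good-spec k p)
      where
      use : (∃ λ j → ∃ λ i → 1 ≤ b j × 1 ≤ a i × a i + b j ≤ c k + 1) → 1 ≤ c k
      use (j , i , 1≤bj , 1≤ai , h) = +-cancelʳ-≤ 1 _ _ (≤-trans (1≤ai ⊞ 1≤bj) h)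

    #Good-bound : r < q → m + l ≤ # Good + r + 2
    #Good-bound r<q = restricted (supp a) (supp b) (supp σ) Good cover 1≤m 1≤l r<q
      (≤-<-trans (#-mono {P = Good} {supp c} λ k p → pos-supp c (Good-pos k p)) (#c<q 0))
      where
      cover : ∀ i j → T (supp a i) → T (supp b j) → T (supp σ (i ⊖ j)) ⊎ T (Good (i ⊕ j))
      cover i j p p′ with supp σ (i ⊖ j) in eq
      ... | true  = inj₁ _
      ... | false = inj₂ (holds (Finₚ.any? λ j′ → T? (GoodAt (i ⊕ j) j′)) (j , good (sym (⊕-⊘ʳ i j))))
        where
        good : ∀ {i′} → i ≡ i′ → T (supp b j ∧ (supp a i′ ∧ not (supp σ (i′ ⊖ j))))
        good refl = ∧-intro p′ (∧-intro p (subst (T ∘ not) (sym eq) _))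

    -- At least l - r - 2 ≥ 1 good classes lie outside the row. One is counted with its full c k ≥ a
    -- i + b j - 1, the others with 1 each.
    extra-good : r + 3 ≤ l → ∃ λ j → ∃ λ i → 1 ≤ b j × 1 ≤ a i × a i + b j + l ≤ offRow + r + 4
    extra-good r+3≤l = bound (#-witness (outside Good)
      (≤-from (r+3≤l ⊞ good ⊞ #≤m+outside Good) 0 (lem m l r (# Good) (# (outside Good)))))
      where
      good : m + l ≤ # Good + r + 2
      good = #Good-bound (≤-trans (≤-trans (s≤s (m≤m+n r 2)) (≤-reflexive (sym (+-suc r 2)))) (≤-trans r+3≤l (#≤n (supp b))))
      lem : ∀ m l r Z E → 1 + (l + (Z + r + 2 + (m + E))) + 0 ≡ E + (r + 3 + (m + l + Z))
      lem = solve-∀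
      off : Fin q → ℕ
      off k = 𝟙 (not (row k)) * c k
      off≡ : ∀ k → T (not (row k)) → off k ≡ c k
      off≡ k p = trans (cong (_* c k) (𝟙-T p)) (*-identityˡ (c k))
      lem′ : ∀ w m l r Z E X y → w + l + ((y + 1) + ((Z + r + 2) + ((m + E) + (X + 1)))) + 0
                               ≡ X + r + 4 + (w + ((m + l) + (Z + (y + E))))
      lem′ = solve-∀
      bound : (∃ λ k → T (outside Good k)) → ∃ λ j → ∃ λ i → 1 ≤ b j × 1 ≤ a i × a i + b j + l ≤ offRow + r + 4
      bound (k , p) = use (Good-spec k (proj₁ (∧-elim {Good k} p)))
        where
        ck+ : c k + # (outside Good) ≤ offRow + 1
        ck+ = subst (λ x → x + # (outside Good) ≤ offRow + 1) (off≡ k (proj₂ (∧-elim {Good k} p)))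
          (sum-supp-term (outside Good) off
            (λ k p → subst (1 ≤_) (sym (off≡ k (proj₂ (∧-elim {Good k} p)))) (Good-pos k (proj₁ (∧-elim {Good k} p)))) k)
        use : (∃ λ j → ∃ λ i → 1 ≤ b j × 1 ≤ a i × a i + b j ≤ c k + 1) →
              ∃ λ j → ∃ λ i → 1 ≤ b j × 1 ≤ a i × a i + b j + l ≤ offRow + r + 4
        use (j , i , 1≤bj , 1≤ai , h) = j , i , 1≤bj , 1≤ai ,
          ≤-from (h ⊞ good ⊞ #≤m+outside Good ⊞ ck+) 0 (lem′ (a i + b j) m l r (# Good) (# (outside Good)) offRow (c k))

    -- The parameter `x` bounds the nonempty fibres of A from below. The value 1 is free; a tight
    -- case will use 2.
    strong-middle : ∀ d x → l + d ≡ m → r + 3 ≤ l → (∀ i → 1 ≤ a i → x ≤ a i) →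
                    4 * s + 2 + d ≤ x + 2 * r + β + d * β → Strong
    strong-middle d x l+d≡m r+3≤l x≤a h = use (extra-good r+3≤l)
      where
      lem : ∀ l d s r β w y x X → (4 * s + l + d + y) + ((X + r + 4) + ((x + 2 * r + β + d * β) + w)) + 0
                                ≡ (X + 2 + 3 * r + d * β + β) + ((w + y + l) + ((4 * s + 2 + d) + x))
      lem = solve-∀
      use : (∃ λ j → ∃ λ i → 1 ≤ b j × 1 ≤ a i × a i + b j + l ≤ offRow + r + 4) → Strong
      use (j , i , 1≤bj , 1≤ai , h′) = strong-from d β (b j) l+d≡m (b+β j 1≤bj)
        (≤-from (h′ ⊞ h ⊞ x≤a i 1≤ai) 0 (lem l d s r β (a i) (b j) x offRow))

    -- Along a staircase of level pairs the sum of the two heights takes each value once, so the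
    -- level sets of `c` add up to at most |C|. Each pair costs r + 2. The β - 1 steps in `b` have a
    -- surplus of at least r + 1 each since m ≥ 2 r + 3, the α - 1 steps in `a` a net cost of at
    -- most r + 1, and r + 2 ≤ s + 2 is left.
    strong-levels : α ≤ β → 2 * r + 3 ≤ m → Strong
    strong-levels α≤β h = along (pred α) (pred β) (suc-pred α {{>-nonZero 1≤α}}) (suc-pred β {{>-nonZero 1≤β}})
      where
      r<q : r < q
      r<q = ≤-trans (≤-from h (r + 2) (lem r m)) (#≤n (supp a))
        where
        lem : ∀ r m → 1 + r + m + (r + 2) ≡ m + (2 * r + 3)
        lem = solve-∀
      -- The bounds for the level pairs (0,0), (0,1), …, (0,β-1), (1,β-1), …, (α-1,β-1) are added up.
      along : ∀ x y → suc x ≡ α → suc y ≡ β → Strong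
      along x y x≡ y≡ = ≤-from (first ⊞ second ⊞ levels ⊞ ≤-reflexive sum-a ⊞ *-monoʳ-≤ y h ⊞ *-monoʳ-≤ (r + 1) x≤y ⊞ r≤s) 0
          (lem (sum a) (sum b) (sum c) s r m x y Σa (levelSum 0 (suc y)) (levelSum (suc y) x))
        where
        levelSum : ℕ → ℕ → ℕ
        levelSum w N = sum {N} (λ t → # (upper c (w + toℕ t)))
        Σa = sum {x} (λ t → # (upper a (suc (toℕ t))))
        x≤y : x ≤ y
        x≤y = s≤s⁻¹ (subst₂ _≤_ (sym x≡) (sym y≡) α≤β)
        sum-a : sum a ≡ m + Σa
        sum-a = sym (sum≡levels a (suc x) (λ i → subst (a i ≤_) (sym x≡) (a≤α i)))
        levels : levelSum 0 (suc y) + levelSum (suc y) x ≤ sum c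
        levels = ≤-trans (≤-reflexive (sym (sum-split (λ w → # (upper c w)) (suc y) x))) (levels≤sum c (suc y + x))
        first : suc y * m + sum b ≤ levelSum 0 (suc y) + suc y * (r + 2)
        first = subst₂ _≤_
          (trans (∑-distrib-+ {suc y} (λ _ → m) (λ t → # (upper b (toℕ t))))
            (cong₂ _+_ (sum-const (suc y) m) (sum≡levels b (suc y) (λ j → subst (b j ≤_) (sym y≡) (b≤β j)))))
          (trans (∑-distrib-+ {suc y} (λ t → # (upper c (toℕ t))) (λ _ → r + 2)) (cong (levelSum 0 (suc y) +_) (sum-const (suc y) (r + 2))))
          (sum-mono {suc y} λ t → ≤-trans (level-bound 0 (toℕ t) 1≤α (subst (toℕ t <_) y≡ (Finₚ.toℕ<n t)) r<q)
                                          (≤-reflexive (+-assoc (# (upper c (toℕ t))) r 2)))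
        second : Σa + x * 1 ≤ levelSum (suc y) x + x * (r + 2)
        second = subst₂ _≤_
          (trans (∑-distrib-+ {x} (λ t → # (upper a (suc (toℕ t)))) (λ _ → 1)) (cong (Σa +_) (sum-const x 1)))
          (trans (∑-distrib-+ {x} (λ t → # (upper c (suc y + toℕ t))) (λ _ → r + 2)) (cong (levelSum (suc y) x +_) (sum-const x (r + 2))))
          (sum-mono {x} λ t → ≤-trans
            (+-monoʳ-≤ (# (upper a (suc (toℕ t)))) (#-pos {P = upper b y} j₁ (<⇒<ᵇ (≤-reflexive y≡))))
            (≤-trans (level-bound (suc (toℕ t)) y (subst (suc (toℕ t) <_) x≡ (s≤s (Finₚ.toℕ<n t))) (≤-reflexive y≡) r<q)
              (≤-reflexive (trans (cong (λ w → # (upper c w) + r + 2) (cong suc (+-comm (toℕ t) y)))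
                                  (+-assoc (# (upper c (suc y + toℕ t))) r 2)))))
        lem : ∀ A B C s r m x y a₁ c₁ c₂ →
          A + B + ((c₁ + (1 + y) * (r + 2)) + ((c₂ + x * (r + 2)) + (C + ((m + a₁) + (y * m + ((r + 1) * y + s)))))) + 0
          ≡ C + (s + 2) + (((1 + y) * m + B) + ((a₁ + x * 1) + ((c₁ + c₂) + (A + (y * (2 * r + 3) + ((r + 1) * x + r))))))
        lem = solve-∀

  -- The fibre at `k` contributes at most 1 where β was allowed.
  light-fibre : ∀ {n} (f : Fin n → ℕ) β → (∀ i → f i ≤ β) → ∀ k → 1 ≤ f k → f k ≤ 1 → sum f + β ≤ # (supp f) * β + 1
  light-fibre f β f≤β k 1≤fk fk≤1 = begin
    sum f + β                                ≡⟨ cong (_+ β) (sum-omit f k) ⟩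
    f k + sum (omit k f) + β                 ≤⟨ (fk≤1 ⊞ sum-mono rest) ⊞ ≤-refl ⟩
    1 + sum (omit k g) + β                   ≡⟨ lem (sum (omit k g)) β ⟩
    1 * β + sum (omit k g) + 1               ≡⟨ cong (λ x → x * β + sum (omit k g) + 1) (𝟙-T (pos-supp f 1≤fk)) ⟨
    g k + sum (omit k g) + 1                 ≡⟨ cong (_+ 1) (sum-omit g k) ⟨
    sum g + 1                                ≡⟨ cong (_+ 1) (sum-*ʳ (𝟙 ∘ supp f) β) ⟩
    # (supp f) * β + 1                       ∎
    where
    open ≤-Reasoning
    g = λ i → 𝟙 (supp f i) * β
    lem : ∀ x β → 1 + x + β ≡ 1 * β + x + 1
    lem = solve-∀
    f≤g : ∀ i → f i ≤ g i
    f≤g i = pointwise (f i) (f≤β i)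
      where
      pointwise : ∀ x → x ≤ β → x ≤ 𝟙 (0 <ᵇ x) * β
      pointwise zero    _ = z≤n
      pointwise (suc x) h = ≤-trans h (≤-reflexive (sym (*-identityˡ β)))
    rest : ∀ i → omit k f i ≤ omit k g i
    rest = omit-mono k f≤g

  -- For 1 ≤ r ≤ s and 2 ≤ s the hypothesis 9 s² - 5 s - 3 ≤ |B| beats the products of r and s that occur below.
  -- With r = 1, s = 2 + v or r = 2 + u, s = r + e the difference has only positive coefficients, and it is
  -- the excess given to ≤-from.
  split-excess : (P : ℕ → ℕ → Set) → (∀ v → P 1 (2 + v)) → (∀ u e → P (2 + u) (2 + u + e)) →
                 ∀ {r s} → 1 ≤ r → 2 ≤ s → r ≤ s → P r s
  split-excess P one more {1}           {suc (suc v)} _ _ _ = one v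
  split-excess P one more {1}           {1}           _ (s≤s ()) _
  split-excess P one more {suc (suc u)} {s}           _ _ r≤s with m≤n⇒∃[o]m+o≡n r≤s
  ... | e , refl = more u e

  -- Few fibres force a tall one. The negated conclusion is multiplied by the bound r + 2 for `l`
  -- and set against the hypothesis; the excess left over is smallest at s = 2.
  peak-small : ∀ {r s} l β → 1 ≤ r → 2 ≤ s → r ≤ s → l ≤ r + 2 → 9 * (s * s) ≤ l * β + 5 * s + 3 → 5 * s ≤ β + 2 * r
  peak-small l β 1≤r 2≤s r≤s l≤ h = ≮⇒≥ λ h′ → split-excess
      (λ r s → l ≤ r + 2 → 9 * (s * s) ≤ l * β + 5 * s + 3 → β + 2 * r < 5 * s → ⊥)
      (λ v l≤ h h′ → n≮0 {0} (≤-from (h ⊞ *-monoˡ-≤ β l≤ ⊞ *-monoʳ-≤ 3 h′) (1 + 16 * v + 9 * (v * v)) (one v l β)))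
      (λ u e l≤ h h′ → n≮0 {0} (≤-from (h ⊞ *-monoˡ-≤ β l≤ ⊞ *-monoʳ-≤ (4 + u) h′)
        (2 + 14 * u + 6 * (u * u) + 11 * e + 13 * (u * e) + 9 * (e * e)) (more u e l β)))
      1≤r 2≤s r≤s l≤ h h′
    where
    one : ∀ v l β → 1 + ((l * β + 5 * (2 + v) + 3) + ((1 + 2) * β + 3 * (5 * (2 + v)))) + (1 + 16 * v + 9 * (v * v))
                  ≡ 0 + (9 * ((2 + v) * (2 + v)) + (l * β + 3 * (1 + (β + 2 * 1))))
    one = solve-∀
    more : ∀ u e l β →
      1 + ((l * β + 5 * (2 + u + e) + 3) + ((2 + u + 2) * β + (4 + u) * (5 * (2 + u + e))))
        + (2 + 14 * u + 6 * (u * u) + 11 * e + 13 * (u * e) + 9 * (e * e))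
      ≡ 0 + (9 * ((2 + u + e) * (2 + u + e)) + (l * β + (4 + u) * (1 + (β + 2 * (2 + u)))))
    more = solve-∀

  peak-wide : ∀ {r s} l β → 1 ≤ r → 2 ≤ s → r ≤ s → l ≤ 2 * r + 2 → 9 * (s * s) ≤ l * β + 5 * s + 3 → 2 * s < β + r
  peak-wide l β 1≤r 2≤s r≤s l≤ h = ≰⇒> λ h′ → split-excess
      (λ r s → l ≤ 2 * r + 2 → 9 * (s * s) ≤ l * β + 5 * s + 3 → β + r ≤ 2 * s → ⊥)
      (λ v l≤ h h′ → n≮0 {0} (≤-from (h ⊞ *-monoˡ-≤ β l≤ ⊞ *-monoʳ-≤ 4 h′) (10 + 23 * v + 9 * (v * v)) (one v l β)))
      (λ u e l≤ h h′ → n≮0 {0} (≤-from (h ⊞ *-monoˡ-≤ β l≤ ⊞ *-monoʳ-≤ (2 * (2 + u) + 2) h′)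
        (10 + 21 * u + 7 * (u * u) + 19 * e + 14 * (u * e) + 9 * (e * e)) (more u e l β)))
      1≤r 2≤s r≤s l≤ h h′
    where
    one : ∀ v l β → 1 + ((l * β + 5 * (2 + v) + 3) + ((2 * 1 + 2) * β + 4 * (2 * (2 + v)))) + (10 + 23 * v + 9 * (v * v))
                  ≡ 0 + (9 * ((2 + v) * (2 + v)) + (l * β + 4 * (β + 1)))
    one = solve-∀
    more : ∀ u e l β →
      1 + ((l * β + 5 * (2 + u + e) + 3) + ((2 * (2 + u) + 2) * β + (2 * (2 + u) + 2) * (2 * (2 + u + e))))
        + (10 + 21 * u + 7 * (u * u) + 19 * e + 14 * (u * e) + 9 * (e * e))
      ≡ 0 + (9 * ((2 + u + e) * (2 + u + e)) + (l * β + (2 * (2 + u) + 2) * (β + (2 + u))))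
    more = solve-∀

  peak-square : ∀ {r s} l β → 1 ≤ r → 2 ≤ s → r ≤ s → l ≤ 2 * r + 2 → 9 * (s * s) ≤ l * β + 5 * s + 3 → 4 * s ≤ β + 2 * r
  peak-square l β 1≤r 2≤s r≤s l≤ h = ≮⇒≥ λ h′ → split-excess
      (λ r s → l ≤ 2 * r + 2 → 9 * (s * s) ≤ l * β + 5 * s + 3 → β + 2 * r < 4 * s → ⊥)
      (λ v l≤ h h′ → n≮0 {0} (≤-from (h ⊞ *-monoˡ-≤ β l≤ ⊞ *-monoʳ-≤ 4 h′) (2 + 15 * v + 9 * (v * v)) (one v l β)))
      (λ u e l≤ h h′ → n≮0 {0} (≤-from (h ⊞ *-monoˡ-≤ β l≤ ⊞ *-monoʳ-≤ (2 * (2 + u) + 2) h′)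
        (4 + 13 * u + 5 * (u * u) + 7 * e + 10 * (u * e) + 9 * (e * e)) (more u e l β)))
      1≤r 2≤s r≤s l≤ h h′
    where
    one : ∀ v l β → 1 + ((l * β + 5 * (2 + v) + 3) + ((2 * 1 + 2) * β + 4 * (4 * (2 + v)))) + (2 + 15 * v + 9 * (v * v))
                  ≡ 0 + (9 * ((2 + v) * (2 + v)) + (l * β + 4 * (1 + (β + 2 * 1))))
    one = solve-∀
    more : ∀ u e l β →
      1 + ((l * β + 5 * (2 + u + e) + 3) + ((2 * (2 + u) + 2) * β + (2 * (2 + u) + 2) * (4 * (2 + u + e))))
        + (4 + 13 * u + 5 * (u * u) + 7 * e + 10 * (u * e) + 9 * (e * e))
      ≡ 0 + (9 * ((2 + u + e) * (2 + u + e)) + (l * β + (2 * (2 + u) + 2) * (1 + (β + 2 * (2 + u)))))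
    more = solve-∀

  -- A fibre of size 1 leaves at most (l - 1) β + 1 elements in total. With β ≤ 4 s - 2 r this is
  -- too few; the multiplier 2 r + 1 is the bound for l - 1.
  no-light : ∀ {r s} B l β → 1 ≤ r → 2 ≤ s → r ≤ s → l ≤ 2 * r + 2 → 9 * (s * s) ≤ B + 5 * s + 3 →
             β + 2 * r ≤ 4 * s → ¬ B + β ≤ l * β + 1
  no-light B l β 1≤r 2≤s r≤s = split-excess
      (λ r s → l ≤ 2 * r + 2 → 9 * (s * s) ≤ B + 5 * s + 3 → β + 2 * r ≤ 4 * s → ¬ B + β ≤ l * β + 1)
      (λ v l≤ h h′ h″ → n≮0 {0} (≤-from (h ⊞ *-monoˡ-≤ β l≤ ⊞ *-monoʳ-≤ 3 h′ ⊞ h″) (3 + 19 * v + 9 * (v * v)) (one v B l β)))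
      (λ u e l≤ h h′ h″ → n≮0 {0} (≤-from (h ⊞ *-monoˡ-≤ β l≤ ⊞ *-monoʳ-≤ (2 * (2 + u) + 1) h′ ⊞ h″)
        (1 + 13 * u + 5 * (u * u) + 11 * e + 10 * (u * e) + 9 * (e * e)) (more u e B l β)))
      1≤r 2≤s r≤s
    where
    one : ∀ v B l β → 1 + ((B + 5 * (2 + v) + 3) + ((2 * 1 + 2) * β + (3 * (4 * (2 + v)) + (l * β + 1)))) + (3 + 19 * v + 9 * (v * v))
                    ≡ 0 + (9 * ((2 + v) * (2 + v)) + (l * β + (3 * (β + 2 * 1) + (B + β))))
    one = solve-∀
    more : ∀ u e B l β →
      1 + ((B + 5 * (2 + u + e) + 3) + ((2 * (2 + u) + 2) * β + ((2 * (2 + u) + 1) * (4 * (2 + u + e)) + (l * β + 1))))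
        + (1 + 13 * u + 5 * (u * u) + 11 * e + 10 * (u * e) + 9 * (e * e))
      ≡ 0 + (9 * ((2 + u + e) * (2 + u + e)) + (l * β + ((2 * (2 + u) + 1) * (β + 2 * (2 + u)) + (B + β))))
    more = solve-∀

  peak-single : ∀ {s} B → 2 ≤ s → 9 * (s * s) ≤ B + 5 * s + 3 → 4 * s ≤ B
  peak-single {suc (suc t)} B _ h = ≤-from h (15 + 27 * t + 9 * (t * t)) (lem t B)
    where
    lem : ∀ t B → 4 * (2 + t) + (B + 5 * (2 + t) + 3) + (15 + 27 * t + 9 * (t * t)) ≡ B + 9 * ((2 + t) * (2 + t))
    lem = solve-∀
  peak-single {suc zero} B (s≤s ()) h

  -- The number `l` of cosets met by B decides. Up to r + 2 the restricted inequality may yield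
  -- nothing outside the row, so sums through S have to serve; from r + 3 on good classes exist
  -- outside the row, and from 2 r + 3 on level sets suffice.
  strong-half : ∀ {q Add a b c σ} (D : Fibred {q} Add a b c σ) → Rows.l D ≤ Rows.m D → 2 ≤ sum σ →
                9 * (sum σ * sum σ) ≤ sum a + 5 * sum σ + 3 → 9 * (sum σ * sum σ) ≤ sum b + 5 * sum σ + 3 →
                ¬ (Rows.m D ≡ 1 × Rows.l D ≡ 1) → sum a + sum b ≤ sum c + (sum σ + 2)
  strong-half {q} {Add} {a} {b} {c} {σ} D l≤m 2≤s hA hB ¬single = go (m≤n⇒∃[o]m+o≡n l≤m)
    where
    open StrongBound D
    module Swapped = StrongBound (swapFibred D)
    swapped : sum b + sum a ≤ sum c + (s + 2) → Strong
    swapped = subst (_≤ sum c + (s + 2)) (+-comm (sum b) (sum a))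
    1≤s : 1 ≤ s
    1≤s = ≤-trans (s≤s z≤n) 2≤s
    1≤r : 1 ≤ r
    1≤r = #supp-pos σ 1≤s
    hB′ : 9 * (s * s) ≤ l * β + 5 * s + 3
    hB′ = ≤-trans hB ((b≤lβ ⊞ ≤-refl) ⊞ ≤-refl)

    -- For m > l the surplus coset of A brings a second β, and 2 s < β + r is used twice. For m = l
    -- it is missing, and the tallest fibres on both sides are compared with 4 s.
    middle : ∀ d → l + d ≡ m → r + 3 ≤ l → l ≤ 2 * r + 2 → Strong
    middle (suc d) l+d≡m r+3≤l l≤ = strong-middle (suc d) 1 l+d≡m r+3≤l (λ _ p → p)
      (≤-from (peak-wide l β 1≤r 2≤s r≤s l≤ hB′ ⊞ peak-wide l β 1≤r 2≤s r≤s l≤ hB′ ⊞ *-monoʳ-≤ d 1≤β) 0 (lem s r β d))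
      where
      lem : ∀ s r β d → 4 * s + 2 + (1 + d) + ((β + r) + ((β + r) + d * β)) + 0
                      ≡ 1 + 2 * r + β + (1 + d) * β + ((1 + 2 * s) + ((1 + 2 * s) + d * 1))
      lem = solve-∀
    middle zero l+0≡m r+3≤l l≤ = tallest (4 * s <? β + 2 * r) (4 * s <? α + 2 * r)
      where
      l≡m : l ≡ m
      l≡m = trans (sym (+-identityʳ l)) l+0≡m
      lem : ∀ s r β → 4 * s + 2 + 0 + (β + 2 * r) + 0 ≡ 1 + 2 * r + β + 0 * β + (1 + 4 * s)
      lem = solve-∀
      lem₂ : ∀ s r β → 4 * s + 2 + 0 + (β + 2 * r) + 0 ≡ 2 + 2 * r + β + 0 * β + 4 * s
      lem₂ = solve-∀
      tallest : Dec (4 * s < β + 2 * r) → Dec (4 * s < α + 2 * r) → Strong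
      tallest (yes h) _ = strong-middle 0 1 l+0≡m r+3≤l (λ _ p → p) (≤-from h 0 (lem s r β))
      tallest (no _) (yes h) = swapped (Swapped.strong-middle 0 1 (trans (+-identityʳ m) (sym l≡m)) (subst (r + 3 ≤_) l≡m r+3≤l)
        (λ _ p → p) (≤-from h 0 (lem s r α)))
      -- Now α + 2 r ≤ 4 s, so A has no fibre of size 1. The unit gained in `x` makes up for
      -- `peak-square` not being strict.
      tallest (no _) (no h) = strong-middle 0 2 l+0≡m r+3≤l heavy
        (≤-from (peak-square l β 1≤r 2≤s r≤s l≤ hB′) 0 (lem₂ s r β))
        where
        heavy : ∀ i → 1 ≤ a i → 2 ≤ a i
        heavy i 1≤ai = ≰⇒> λ ai≤1 → no-light (sum a) m α 1≤r 2≤s r≤s (subst (_≤ 2 * r + 2) l≡m l≤) hA (≮⇒≥ h)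
          (light-fibre a α a≤α i 1≤ai ai≤1)

    small : ∀ d → l + d ≡ m → 2 ≤ l → l ≤ r + 2 → Strong
    small d l+d≡m 2≤l l≤ = strong-small d l+d≡m 1≤s s<β 2≤l l≤ peak
      where
      peak : 5 * s ≤ β + 2 * r
      peak = peak-small l β 1≤r 2≤s r≤s l≤ hB′
      s<β : s < β
      s<β = ≤-from (peak ⊞ *-monoʳ-≤ 2 r≤s ⊞ *-monoʳ-≤ 2 1≤s) 1 (lem s r β)
        where
        lem : ∀ s r β → 1 + s + ((β + 2 * r) + (2 * s + 2 * s)) + 1 ≡ β + (5 * s + (2 * r + 2 * 1))
        lem = solve-∀

    wide : 2 * r + 2 < l → Strong
    wide h with ≤-total α β
    ... | inj₁ α≤β = strong-levels α≤β (≤-trans h′ l≤m)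
      where h′ = subst (_≤ l) (sym (+-suc (2 * r) 2)) h
    ... | inj₂ β≤α = swapped (Swapped.strong-levels β≤α (subst (_≤ l) (sym (+-suc (2 * r) 2)) h))

    single : ∀ d → l + d ≡ m → l ≡ 1 → Strong
    single zero    l+0≡m l≡1 = ⊥-elim (¬single (trans (sym l+0≡m) (trans (+-identityʳ l) l≡1) , l≡1))
    single (suc d) l+d≡m l≡1 = strong-l≡1 d l+d≡m l≡1 (peak-single (sum b) 2≤s hB)

    go : (∃ λ d → l + d ≡ m) → Strong
    go (d , l+d≡m) = by-size (2 ≤? l) (l ≤? r + 2) (l ≤? 2 * r + 2)
      where
      by-size : Dec (2 ≤ l) → Dec (l ≤ r + 2) → Dec (l ≤ 2 * r + 2) → Strong
      by-size (no  h) _        _        = single d l+d≡m (≤-antisym (s≤s⁻¹ (≰⇒> h)) 1≤l)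
      by-size (yes h) (yes h′) _        = small d l+d≡m h h′
      by-size (yes _) (no  h)  (yes h′) = middle d l+d≡m (subst (_≤ l) (sym (+-suc r 2)) (≰⇒> h)) h′
      by-size (yes _) (no  _)  (no  h)  = wide (≰⇒> h)

  -- The excluded case, A and B each in one coset, is left to the bound for the smaller subgroup.
  strong-bound : ∀ {q Add a b c σ} (D : Fibred {q} Add a b c σ) → 2 ≤ sum σ →
                 9 * (sum σ * sum σ) ≤ sum a + 5 * sum σ + 3 → 9 * (sum σ * sum σ) ≤ sum b + 5 * sum σ + 3 →
                 ¬ (# (supp a) ≡ 1 × # (supp b) ≡ 1) → sum a + sum b ≤ sum c + (sum σ + 2)
  strong-bound {a = a} {b} {c} {σ} D 2≤s hA hB ¬single with ≤-total (Rows.l D) (Rows.m D)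
  ... | inj₁ l≤m = strong-half D l≤m 2≤s hA hB ¬single
  ... | inj₂ m≤l = subst (_≤ sum c + (sum σ + 2)) (+-comm (sum b) (sum a))
                     (strong-half (swapFibred D) m≤l 2≤s hB hA (λ (x , y) → ¬single (y , x)))

-- Addition of residues modulo q

module Cyclic where

  open Counting
  open Modular
  open PrimeField
  open Fibres
  open import Data.Bool using (T)
  open import Data.Nat as ℕ using (ℕ)
  import Data.Nat.Properties as ℕₚ
  open import Data.Nat.Primality using (Prime; prime⇒nonZero)
  open import Data.Fin using (Fin; toℕ; fromℕ<)
  import Data.Fin.Properties as Finₚ
  open import Data.Integer using (ℤ; +_; _+_; _-_; _*_; -_)
  open import Data.Integer.Properties using (+-inverseʳ)
  open import Data.Integer.DivMod using (_%ℕ_; _/ℕ_; n%ℕd<d; a≡a%ℕn+[a/ℕn]*n)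
  open import Data.Integer.Divisibility.Signed
  open import Data.Integer.Tactic.RingSolver using (solve-∀)
  open import Data.Product using (∃; _×_; _,_)
  open import Data.Sum using (inj₂)
  import Data.Sum as Sum
  open import Data.Empty using (⊥-elim)
  open import Relation.Nullary using (yes; no)
  open import Relation.Binary.PropositionalEquality

  module Residues (q : ℕ) (pq : Prime q) (2<q : 2 ℕ.< q) where
    open Modulo q pq public
    open OddPrime q pq 2<q

    private instance _ = prime⇒nonZero pq

    ⟦_⟧ : Fin q → ℤ
    ⟦ i ⟧ = + toℕ i

    infix 4 _~_
    -- A record rather than a synonym of `Zero (t - u)`, so that `t` and `u` can be inferred.
    record _~_ (t u : ℤ) : Set where
      constructor congruent
      field difference-zero : Zero (t - u)
    open _~_ public

    ≡⇒~ : ∀ {t u} → t ≡ u → t ~ u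
    ≡⇒~ {t} refl = congruent (subst Zero (sym (+-inverseʳ t)) Zero-0)

    ~-sym : ∀ {t u} → t ~ u → u ~ t
    ~-sym {t} {u} (congruent h) = congruent (subst Zero (lem t u) (∣m⇒∣-m h))
      where
      lem : ∀ t u → - (t - u) ≡ u - t
      lem = solve-∀

    ~-trans : ∀ {t u v} → t ~ u → u ~ v → t ~ v
    ~-trans {t} {u} {v} (congruent h) (congruent h′) = congruent (subst Zero (lem t u v) (∣m∣n⇒∣m+n h h′))
      where
      lem : ∀ t u v → (t - u) + (u - v) ≡ t - v
      lem = solve-∀

    ~-+ : ∀ {t u t′ u′} → t ~ u → t′ ~ u′ → t + t′ ~ u + u′
    ~-+ {t} {u} {t′} {u′} (congruent h) (congruent h′) = congruent (subst Zero (lem t u t′ u′) (∣m∣n⇒∣m+n h h′))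
      where
      lem : ∀ t u t′ u′ → (t - u) + (t′ - u′) ≡ (t + t′) - (u + u′)
      lem = solve-∀

    ~-minus : ∀ {t u t′ u′} → t ~ u → t′ ~ u′ → t - t′ ~ u - u′
    ~-minus {t} {u} {t′} {u′} (congruent h) (congruent h′) = congruent (subst Zero (lem t u t′ u′) (∣m∣n⇒∣m-n h h′))
      where
      lem : ∀ t u t′ u′ → (t - u) - (t′ - u′) ≡ (t - t′) - (u - u′)
      lem = solve-∀

    ~⇒≡ : ∀ {i j} → ⟦ i ⟧ ~ ⟦ j ⟧ → i ≡ j
    ~⇒≡ {i} {j} (congruent h) with i Finₚ.≟ j
    ... | yes e = e
    ... | no ne = ⊥-elim (toℤ-distinct (λ e → ne (sym e)) h)

    -- What follows knows `reduce` only through its congruence, never through the division behind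
    -- it.
    abstract
      reduce : ℤ → Fin q
      reduce t = fromℕ< (n%ℕd<d t q)

      reduce~ : ∀ t → ⟦ reduce t ⟧ ~ t
      reduce~ t = congruent (divides (- (t /ℕ q)) (trans (cong₂ (λ x y → + x - y) (Finₚ.toℕ-fromℕ< (n%ℕd<d t q)) (a≡a%ℕn+[a/ℕn]*n t q))
                                              (lem (+ (t %ℕ q)) (t /ℕ q) (+ q))))
        where
        lem : ∀ r d q → r - (r + d * q) ≡ - d * q
        lem = solve-∀

    reduce-≡ : ∀ {t i} → t ~ ⟦ i ⟧ → reduce t ≡ i
    reduce-≡ {t} h = ~⇒≡ (~-trans (reduce~ t) h)

    addition : Addition q
    addition = record
      { _⊕_ = λ i j → reduce (⟦ i ⟧ + ⟦ j ⟧) ; _⊖_ = λ i j → reduce (⟦ i ⟧ - ⟦ j ⟧)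
      ; _⊘ʳ_ = λ k j → reduce (⟦ k ⟧ - ⟦ j ⟧) ; _⊘ˡ_ = λ k i → reduce (⟦ k ⟧ - ⟦ i ⟧)
      ; ⊘ʳ-⊕ = λ k j → reduce-≡ (~-trans (~-+ (reduce~ (⟦ k ⟧ - ⟦ j ⟧)) (≡⇒~ {⟦ j ⟧} refl)) (≡⇒~ (lem₁ ⟦ k ⟧ ⟦ j ⟧)))
      ; ⊕-⊘ʳ = λ i j → reduce-≡ (~-trans (~-minus (reduce~ (⟦ i ⟧ + ⟦ j ⟧)) (≡⇒~ {⟦ j ⟧} refl)) (≡⇒~ (lem₂ ⟦ i ⟧ ⟦ j ⟧)))
      ; ⊘ˡ-⊕ = λ k i → reduce-≡ (~-trans (~-+ (≡⇒~ {⟦ i ⟧} refl) (reduce~ (⟦ k ⟧ - ⟦ i ⟧))) (≡⇒~ (lem₃ ⟦ k ⟧ ⟦ i ⟧)))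
      ; ⊕-⊘ˡ = λ i j → reduce-≡ (~-trans (~-minus (reduce~ (⟦ i ⟧ + ⟦ j ⟧)) (≡⇒~ {⟦ i ⟧} refl)) (≡⇒~ (lem₄ ⟦ i ⟧ ⟦ j ⟧)))
      ; ⊖-injˡ = λ i i′ j e → ~⇒≡ (subst₂ _~_ (lem₁ ⟦ i ⟧ ⟦ j ⟧) (lem₁ ⟦ i′ ⟧ ⟦ j ⟧) (~-+ (⊖~ e) (≡⇒~ {⟦ j ⟧} refl)))
      ; ⊖-injʳ = λ i j j′ e → ~⇒≡ (subst₂ _~_ (lem₅ ⟦ i ⟧ ⟦ j ⟧) (lem₅ ⟦ i ⟧ ⟦ j′ ⟧) (~-minus (≡⇒~ {⟦ i ⟧} refl) (⊖~ e)))
      ; restricted = λ X Y D Z h → restricted-bound X Y D Z (λ x y Xx Yy → Sum.map (difference x y) (total x y) (h x y Xx Yy))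
      ; cauchy-davenport = λ X Y Z h 1≤X 1≤Y → unrestricted-bound X Y none Z
          (λ x y Xx Yy → inj₂ (total x y (h x y Xx Yy))) 1≤X 1≤Y #none
      }
      where
      lem₁ : ∀ k j → (k - j) + j ≡ k
      lem₁ = solve-∀
      lem₂ : ∀ i j → (i + j) - j ≡ i
      lem₂ = solve-∀
      lem₃ : ∀ k i → i + (k - i) ≡ k
      lem₃ = solve-∀
      lem₄ : ∀ i j → (i + j) - i ≡ j
      lem₄ = solve-∀
      lem₅ : ∀ i j → i - (i - j) ≡ j
      lem₅ = solve-∀
      ⊖~ : ∀ {t u} → reduce t ≡ reduce u → t ~ u
      ⊖~ {t} {u} e = ~-trans (~-sym (reduce~ t)) (subst (λ i → ⟦ i ⟧ ~ u) (sym e) (reduce~ u))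
      difference : ∀ {D : Fin q → _} x y → T (D (reduce (⟦ x ⟧ - ⟦ y ⟧))) → ∃ λ d → T (D d) × Zero (⟦ x ⟧ - ⟦ y ⟧ - ⟦ d ⟧)
      difference x y p = _ , p , difference-zero (~-sym (reduce~ (⟦ x ⟧ - ⟦ y ⟧)))
      total : ∀ {Z : Fin q → _} x y → T (Z (reduce (⟦ x ⟧ + ⟦ y ⟧))) → ∃ λ z → T (Z z) × Zero (⟦ x ⟧ + ⟦ y ⟧ - ⟦ z ⟧)
      total x y p = _ , p , difference-zero (~-sym (reduce~ (⟦ x ⟧ + ⟦ y ⟧)))
      none : Fin q → _
      none _ = Data.Bool.false
      #none : # none ≡ 0
      #none = trans (sum-const q 0) (ℕₚ.*-zeroʳ q)

-- Subgroups, extensions of prime index and the passage to fibres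

module Tower where

  open import Defs
  open Counting
  open Modular
  open Fibres
  open Weak
  open Strong
  open Cyclic
  open import Level using (0ℓ)
  open import Algebra.Bundles using (AbelianGroup)
  import Algebra.Properties.AbelianGroup as AbelianGroupₚ
  import Algebra.Properties.CommutativeSemigroup as CommutativeSemigroupₚ
  import Algebra.Properties.Monoid.Mult as Mult
  import Algebra.Properties.CommutativeMonoid.Sum as CommutativeMonoidSumₚ
  open import Data.Bool using (Bool; true; false; T; not; _∧_)
  open import Data.Bool.Properties using (T?)
  open import Data.Nat as ℕ using (ℕ; zero; suc; _≤_; _<_; z≤n; s≤s)
  import Data.Nat.Properties as ℕₚ
  import Data.Nat.Tactic.RingSolver as ℕSolver
  open import Data.Nat.Primality using (Prime)
  open import Data.Fin using (Fin; zero; suc)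
  import Data.Fin.Properties as Finₚ
  open import Data.Fin.Permutation using (Permutation; permutation)
  open import Data.List using (List; []; _∷_; allFin)
  open import Data.Nat.ListAction using (product)
  open import Data.List.Membership.Propositional using (_∈_)
  open import Data.List.Membership.Propositional.Properties using (∈-allFin)
  open import Data.List.Relation.Unary.All using (All; []; _∷_)
  open import Data.List.Relation.Unary.Any using (here; there)
  open import Data.Integer as ℤ using (ℤ; +_; -[1+_]; 0ℤ; 1ℤ; _⊖_)
  import Data.Integer.Properties as ℤₚ
  open import Data.Integer.Divisibility.Signed using (divides)
  open import Data.Integer.Tactic.RingSolver using (solve-∀)
  open import Data.Product using (∃; _×_; _,_; proj₁; proj₂)
  open import Data.Sum using (_⊎_; inj₂; [_,_]′)
  import Data.Sum as Sum
  open import Data.Empty using (⊥; ⊥-elim)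
  open import Function using (_∘_)
  open import Relation.Nullary using (Dec; yes; no; does; ¬_)
  open import Relation.Nullary.Decidable using (_×-dec_)
  open import Relation.Binary.PropositionalEquality
  open import Algebra.Properties.CommutativeMonoid.Sum ℕₚ.+-0-commutativeMonoid using (sum)

  closed-multiple : (P : ℤ → Set) → P 0ℤ → (∀ {t u} → P t → P u → P (t ℤ.+ u)) → (∀ {t} → P t → P (ℤ.- t)) →
                    ∀ u {t} → P t → P (u ℤ.* t)
  closed-multiple P P0 P+ P- u {t} Pt = integer u
    where
    natural : ∀ m → P (+ m ℤ.* t)
    natural zero    = P0
    natural (suc m) = subst P (sym (ℤₚ.suc-* (+ m) t)) (P+ Pt (natural m))
    integer : ∀ u → P (u ℤ.* t)
    integer (+ m)    = natural m
    integer -[1+ m ] = subst P (ℤₚ.neg-distribˡ-* (+ suc m) t) (P- (natural (suc m)))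

  module Group {n : ℕ} (G : FinAbGroup n) where
    open FinAbGroup G public

    abelianGroup : AbelianGroup 0ℓ 0ℓ
    abelianGroup = record { isAbelianGroup = isAbelianGroup }

    open AbelianGroup abelianGroup using (monoid; commutativeMonoid; commutativeSemigroup; assoc; comm; identityˡ; identityʳ; inverseˡ; inverseʳ)
    open AbelianGroupₚ abelianGroup using (⁻¹-∙-comm; ⁻¹-anti-homo‿-; ε⁻¹≈ε; ⁻¹-involutive; x∙y⁻¹≈ε⇒x≈y)
    open CommutativeSemigroupₚ commutativeSemigroup using (interchange)
    open Mult monoid using (×-homo-+; ×-assocˡ) renaming (_×_ to infixr 8 _⋆_) public

    +-minus : ∀ x u y v → (x + u) - (y + v) ≡ (x - y) + (u - v)
    +-minus x u y v = trans (cong (_+_ (x + u)) (sym (⁻¹-∙-comm y v))) (interchange x u (- y) (- v))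

    minus-minus : ∀ x u y v → (x - u) - (y - v) ≡ (x - y) - (u - v)
    minus-minus x u y v = trans (+-minus x (- u) y (- v)) (cong (_+_ (x - y)) (⁻¹-∙-comm u (- v)))

    minus-+ : ∀ x y → (x - y) + y ≡ x
    minus-+ x y = trans (assoc x (- y) y) (trans (cong (_+_ x) (inverseˡ y)) (identityʳ x))

    +-minusʳ : ∀ x y → (x + y) - y ≡ x
    +-minusʳ x y = trans (assoc x y (- y)) (trans (cong (_+_ x) (inverseʳ y)) (identityʳ x))

    minus-trans : ∀ x y z → (x - y) + (y - z) ≡ x - z
    minus-trans x y z = trans (sym (assoc (x - y) y (- z))) (cong (_- z) (minus-+ x y))

    minus-0 : ∀ x → x - 0# ≡ x
    minus-0 x = trans (cong (_+_ x) ε⁻¹≈ε) (identityʳ x)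

    +-cancelʳ : ∀ {x y} z → x + z ≡ y + z → x ≡ y
    +-cancelʳ {x} {y} z e = trans (sym (+-minusʳ x z)) (trans (cong (_- z) e) (+-minusʳ y z))

    minus-injʳ : ∀ {y z} x → x - y ≡ x - z → y ≡ z
    minus-injʳ {y} {z} x e = trans (sym (⁻¹-involutive y)) (trans (cong -_ -y≡-z) (⁻¹-involutive z))
      where
      -y≡-z : - y ≡ - z
      -y≡-z = +-cancelʳ x (trans (comm (- y) x) (trans e (comm x (- z))))

    infixr 8 _·_
    _·_ : ℤ → Fin n → Fin n
    (+ m)    · g = m ⋆ g
    -[1+ m ] · g = - (suc m ⋆ g)

    ⊖-· : ∀ m k g → (m ⊖ k) · g ≡ m ⋆ g - k ⋆ g
    ⊖-· zero    zero    g = sym (inverseʳ 0#)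
    ⊖-· (suc m) zero    g = sym (minus-0 _)
    ⊖-· zero    (suc k) g = sym (identityˡ _)
    ⊖-· (suc m) (suc k) g = trans (cong (_· g) (ℤₚ.[1+m]⊖[1+n]≡m⊖n m k)) (trans (⊖-· m k g) (sym
      (trans (+-minus g (m ⋆ g) g (k ⋆ g)) (trans (cong (_+ (m ⋆ g - k ⋆ g)) (inverseʳ g)) (identityˡ _)))))

    ·-+ : ∀ t u g → (t ℤ.+ u) · g ≡ t · g + u · g
    ·-+ (+ m)    (+ k)    g = ×-homo-+ g m k
    ·-+ (+ m)    -[1+ k ] g = ⊖-· m (suc k) g
    ·-+ -[1+ m ] (+ k)    g = trans (⊖-· k (suc m) g) (comm (k ⋆ g) (- (suc m ⋆ g)))
    ·-+ -[1+ m ] -[1+ k ] g = trans (cong (λ x → - (x ⋆ g)) (cong suc (sym (ℕₚ.+-suc m k))))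
      (trans (cong -_ (×-homo-+ g (suc m) (suc k))) (sym (⁻¹-∙-comm (suc m ⋆ g) (suc k ⋆ g))))

    ·-neg : ∀ t g → (ℤ.- t) · g ≡ - (t · g)
    ·-neg (+ zero)  g = sym ε⁻¹≈ε
    ·-neg (+ suc m) g = refl
    ·-neg -[1+ m ]  g = sym (⁻¹-involutive (suc m ⋆ g))

    ·-minus : ∀ t u g → (t ℤ.- u) · g ≡ t · g - u · g
    ·-minus t u g = trans (·-+ t (ℤ.- u) g) (cong (_+_ (t · g)) (·-neg u g))

    record Subgroup : Set where
      field
        member : Fin n → Bool
        0∈ : T (member 0#)
        +∈ : ∀ {x y} → T (member x) → T (member y) → T (member (x + y))
        -∈ : ∀ {x} → T (member x) → T (member (- x))

    open Subgroup using (member)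

    record _⊢_≈_ (K : Subgroup) (x y : Fin n) : Set where
      constructor congruent
      field minus∈ : T (member K (x - y))
    open _⊢_≈_ public

    module _ (K : Subgroup) where
      open Subgroup K hiding (member)

      ≈-refl : ∀ {x} → K ⊢ x ≈ x
      ≈-refl {x} = congruent (subst (T ∘ member K) (sym (inverseʳ x)) 0∈)

      ≈-sym : ∀ {x y} → K ⊢ x ≈ y → K ⊢ y ≈ x
      ≈-sym {x} {y} (congruent h) = congruent (subst (T ∘ member K) (⁻¹-anti-homo‿- x y) (-∈ h))

      ≈-trans : ∀ {x y z} → K ⊢ x ≈ y → K ⊢ y ≈ z → K ⊢ x ≈ z
      ≈-trans {x} {y} {z} (congruent h) (congruent h′) = congruent (subst (T ∘ member K) (minus-trans x y z) (+∈ h h′))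

      ≈-+ : ∀ {x y u v} → K ⊢ x ≈ y → K ⊢ u ≈ v → K ⊢ (x + u) ≈ (y + v)
      ≈-+ {x} {y} {u} {v} (congruent h) (congruent h′) = congruent (subst (T ∘ member K) (sym (+-minus x u y v)) (+∈ h h′))

      ≈-minus : ∀ {x y u v} → K ⊢ x ≈ y → K ⊢ u ≈ v → K ⊢ (x - u) ≈ (y - v)
      ≈-minus {x} {y} {u} {v} (congruent h) (congruent h′) =
        congruent (subst (T ∘ member K) (sym (minus-minus x u y v)) (+∈ h (-∈ h′)))

      ≈0 : ∀ {x} → T (member K x) → K ⊢ x ≈ 0#
      ≈0 {x} h = congruent (subst (T ∘ member K) (sym (minus-0 x)) h)

    Coset : Subgroup → (Fin n → Bool) → Set
    Coset K A = ∀ x y → T (A x) → T (A y) → K ⊢ x ≈ y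

    Cover : (A B C S : Fin n → Bool) → Set
    Cover A B C S = ∀ x y → T (A x) → T (B y) → T (S (x - y)) ⊎ T (C (x + y))

    -- For one fixed `x` in A the maps y ↦ x + y and y ↦ x - y are injective, and each `y` is sent
    -- into C by the first or into S by the second.
    cover-trivial-b : ∀ A B C S → Cover A B C S → 1 ≤ # A → # B ≤ # C ℕ.+ # S
    cover-trivial-b A B C S cover 1≤A = bound (#-witness A 1≤A)
      where
      bound : (∃ λ x → T (A x)) → # B ≤ # C ℕ.+ # S
      bound (x , Ax) = begin
        # B                                        ≡⟨ #-⊎ B (λ y → C (x + y)) ⟩
        # (λ y → B y ∧ C (x + y)) ℕ.+ # (λ y → B y ∧ not (C (x + y)))
          ≤⟨ #-inj {P = λ y → B y ∧ C (x + y)} {C} (_+_ x) (λ y p → proj₂ (∧-elim {B y} p))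
               (λ y y′ _ _ e → +-cancelʳ x (trans (comm y x) (trans e (comm x y′))))
           ⊞ #-inj {P = λ y → B y ∧ not (C (x + y))} {S} (_-_ x) inS (λ y y′ _ _ e → minus-injʳ x e) ⟩
        # C ℕ.+ # S ∎
        where
        open ℕₚ.≤-Reasoning
        inS : ∀ y → T (B y ∧ not (C (x + y))) → T (S (x - y))
        inS y p with C (x + y) | cover x y Ax | ∧-elim {B y} p
        ... | false | h | By , _ = [ (λ z → z) , (λ ()) ]′ (h By)

    cover-trivial-a : ∀ A B C S → Cover A B C S → 1 ≤ # B → # A ≤ # C ℕ.+ # S
    cover-trivial-a A B C S cover 1≤B = bound (#-witness B 1≤B)
      where
      bound : (∃ λ y → T (B y)) → # A ≤ # C ℕ.+ # S
      bound (y , By) = begin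
        # A                                        ≡⟨ #-⊎ A (λ x → C (x + y)) ⟩
        # (λ x → A x ∧ C (x + y)) ℕ.+ # (λ x → A x ∧ not (C (x + y)))
          ≤⟨ #-inj {P = λ x → A x ∧ C (x + y)} {C} (_+ y) (λ x p → proj₂ (∧-elim {A x} p)) (λ x x′ _ _ e → +-cancelʳ y e)
           ⊞ #-inj {P = λ x → A x ∧ not (C (x + y))} {S} (_- y) inS (λ x x′ _ _ e → +-cancelʳ (- y) e) ⟩
        # C ℕ.+ # S ∎
        where
        open ℕₚ.≤-Reasoning
        inS : ∀ x → T (A x ∧ not (C (x + y))) → T (S (x - y))
        inS x p with C (x + y) | (λ Ax → cover x y Ax By) | ∧-elim {A x} p
        ... | false | h | Ax , _ = [ (λ z → z) , (λ ()) ]′ (h Ax)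

    record Bounds (A B C S : Fin n → Bool) : Set where
      field
        weak   : # A ℕ.+ # B ≤ # C ℕ.+ (1 ℕ.+ ψ (# S))
        strong : 2 ≤ # S → 9 ℕ.* (# S ℕ.* # S) ≤ # A ℕ.+ 5 ℕ.* # S ℕ.+ 3 →
                 9 ℕ.* (# S ℕ.* # S) ≤ # B ℕ.+ 5 ℕ.* # S ℕ.+ 3 → # A ℕ.+ # B ≤ # C ℕ.+ (# S ℕ.+ 2)

    -- Only A and B are confined to cosets; stray elements of C and S merely weaken the inequality.
    Bounded : ℕ → Subgroup → Set
    Bounded p K = ∀ A B C S → Coset K A → Coset K B → 1 ≤ # A → 1 ≤ # B → Cover A B C S → # C < p → Bounds A B C S

    trivial : Subgroup
    trivial = record
      { member = λ x → does (x Finₚ.≟ 0#)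
      ; 0∈ = holds (0# Finₚ.≟ 0#) refl
      ; +∈ = λ {x} {y} h h′ → holds (x + y Finₚ.≟ 0#)
          (trans (cong₂ _+_ (witness (x Finₚ.≟ 0#) h) (witness (y Finₚ.≟ 0#) h′)) (identityˡ 0#))
      ; -∈ = λ {x} h → holds (- x Finₚ.≟ 0#) (trans (cong -_ (witness (x Finₚ.≟ 0#) h)) ε⁻¹≈ε)
      }

    -- Cosets are points. One pair already makes S or C nonempty, which gives the weak bound; the
    -- size hypothesis reads 9 s² ≤ 5 s + 4 at best, which fails for s ≥ 2.
    trivial-bounded : ∀ p → Bounded p trivial
    trivial-bounded p A B C S cosetA cosetB 1≤A 1≤B cover _ = record
      { weak = bound (#-witness A 1≤A) (#-witness B 1≤B)
      ; strong = λ 2≤s h _ → ⊥-elim (large (# S) 2≤s (ℕₚ.≤-trans h ((#≤1 A cosetA ⊞ ℕₚ.≤-refl) ⊞ ℕₚ.≤-refl)))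
      }
      where
      #≤1 : ∀ A → Coset trivial A → # A ≤ 1
      #≤1 A coset = #-inj {P = A} {λ (_ : Fin 1) → true} (λ _ → zero) _
        λ x y Ax Ay _ → x∙y⁻¹≈ε⇒x≈y x y (witness (x - y Finₚ.≟ 0#) (minus∈ (coset x y Ax Ay)))
      large : ∀ s → 2 ≤ s → ¬ 9 ℕ.* (s ℕ.* s) ≤ 1 ℕ.+ 5 ℕ.* s ℕ.+ 3
      large (suc (suc t)) _ h = ℕₚ.n≮0 {0} (≤-from h (21 ℕ.+ 31 ℕ.* t ℕ.+ 9 ℕ.* (t ℕ.* t)) (lem t))
        where
        lem : ∀ t → 1 ℕ.+ (1 ℕ.+ 5 ℕ.* (2 ℕ.+ t) ℕ.+ 3) ℕ.+ (21 ℕ.+ 31 ℕ.* t ℕ.+ 9 ℕ.* (t ℕ.* t))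
                  ≡ 0 ℕ.+ 9 ℕ.* ((2 ℕ.+ t) ℕ.* (2 ℕ.+ t))
        lem = ℕSolver.solve-∀
      large 1 (s≤s ())
      nonempty : ∀ s c → 1 ≤ s ⊎ 1 ≤ c → 2 ≤ c ℕ.+ (1 ℕ.+ ψ s)
      nonempty zero    c (inj₂ 1≤c) = 1≤c ⊞ ℕₚ.≤-refl
      nonempty (suc s) c _ = ℕₚ.≤-trans (s≤s (ℕₚ.≤-trans (s≤s z≤n) (ℕₚ.m≤n+m 2 (5 ℕ.* s)))) (ℕₚ.m≤n+m _ c)
      bound : (∃ λ x → T (A x)) → (∃ λ y → T (B y)) → # A ℕ.+ # B ≤ # C ℕ.+ (1 ℕ.+ ψ (# S))
      bound (x , Ax) (y , By) = ℕₚ.≤-trans (#≤1 A cosetA ⊞ #≤1 B cosetB)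
        (nonempty (# S) (# C) (Sum.map (#-pos {P = S} (x - y)) (#-pos {P = C} (x + y)) (cover x y Ax By)))

    -- The multiples of `g` identify K′/K with ℤ/q, where K′ is generated by K and `g`.
    module Extension (K : Subgroup) (g : Fin n) (q : ℕ) (pq : Prime q) (2<q : 2 < q)
                     (g∉K : ¬ T (member K g)) (qg∈K : T (member K (q ⋆ g))) where
      open Residues q pq 2<q renaming (congruent to congruent~)
      open Addition addition using (_⊕_) renaming (_⊖_ to _⊝_)
      open Subgroup K hiding (member)

      kernel-multiple : ∀ u {t} → T (member K (t · g)) → T (member K ((u ℤ.* t) · g))
      kernel-multiple = closed-multiple (λ t → T (member K (t · g))) 0∈
        (λ {t} {u} h h′ → subst (T ∘ member K) (sym (·-+ t u g)) (+∈ h h′))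
        (λ {t} h → subst (T ∘ member K) (sym (·-neg t g)) (-∈ h))

      zero-kernel : ∀ t → Zero t → T (member K (t · g))
      zero-kernel t (divides u e) = subst (λ t → T (member K (t · g))) (sym e) (kernel-multiple u {+ q} qg∈K)

      -- If `t` had an inverse `u` modulo q, then g = (u t) g - (u t - 1) g would lie in K.
      kernel-zero : ∀ t → T (member K (t · g)) → Zero t
      kernel-zero t h with zero? t
      ... | yes z = z
      ... | no ¬z = ⊥-elim (from-inverse (inverse t ¬z))
        where
        from-inverse : (∃ λ u → Zero (u ℤ.* t ℤ.- 1ℤ)) → ⊥
        from-inverse (u , z) = g∉K (subst (T ∘ member K) one
          (+∈ (kernel-multiple u {t} h) (-∈ (zero-kernel (u ℤ.* t ℤ.- 1ℤ) z))))
          where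
          lem : ∀ w → w ℤ.- (w ℤ.- 1ℤ) ≡ 1ℤ
          lem = solve-∀
          one : (u ℤ.* t) · g - (u ℤ.* t ℤ.- 1ℤ) · g ≡ g
          one = trans (sym (·-minus (u ℤ.* t) (u ℤ.* t ℤ.- 1ℤ) g)) (trans (cong (_· g) (lem (u ℤ.* t))) (identityʳ g))

      ~⇒≈ : ∀ {t u} → t ~ u → K ⊢ t · g ≈ (u · g)
      ~⇒≈ {t} {u} h = congruent (subst (T ∘ member K) (·-minus t u g) (zero-kernel (t ℤ.- u) (difference-zero h)))

      ≈⇒~ : ∀ {t u} → K ⊢ t · g ≈ (u · g) → t ~ u
      ≈⇒~ {t} {u} h = congruent~ (kernel-zero (t ℤ.- u) (subst (T ∘ member K) (sym (·-minus t u g)) (minus∈ h)))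

      residue? : ∀ x → Dec (∃ λ i → T (member K (x - ⟦ i ⟧ · g)))
      residue? x = Finₚ.any? λ i → T? (member K (x - ⟦ i ⟧ · g))

      extend-intro : ∀ {x} t → K ⊢ x ≈ (t · g) → T (does (residue? x))
      extend-intro {x} t h = holds (residue? x) (reduce t , minus∈ (≈-trans K h (~⇒≈ (~-sym (reduce~ t)))))

      extend-elim : ∀ {x} → T (does (residue? x)) → ∃ λ i → K ⊢ x ≈ (⟦ i ⟧ · g)
      extend-elim {x} h with witness (residue? x) h
      ... | i , p = i , congruent p

      extension : Subgroup
      extension = record
        { member = λ x → does (residue? x)
        ; 0∈ = extend-intro 0ℤ (≈-refl K)
        ; +∈ = λ h h′ → sum-in (extend-elim h) (extend-elim h′)
        ; -∈ = λ h → neg-in (extend-elim h)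
        }
        where
        sum-in : ∀ {x y} → (∃ λ i → K ⊢ x ≈ (⟦ i ⟧ · g)) → (∃ λ i → K ⊢ y ≈ (⟦ i ⟧ · g)) → T (does (residue? (x + y)))
        sum-in {x} {y} (i , p) (j , p′) = extend-intro (⟦ i ⟧ ℤ.+ ⟦ j ⟧)
          (subst (K ⊢ x + y ≈_) (sym (·-+ ⟦ i ⟧ ⟦ j ⟧ g)) (≈-+ K p p′))
        neg-in : ∀ {x} → (∃ λ i → K ⊢ x ≈ (⟦ i ⟧ · g)) → T (does (residue? (- x)))
        neg-in {x} (i , p) = extend-intro (ℤ.- ⟦ i ⟧)
          (subst₂ (K ⊢_≈_) (identityˡ (- x)) (trans (identityˡ _) (sym (·-neg ⟦ i ⟧ g))) (≈-minus K (≈-refl K {0#}) p))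

      extension-⊇ : ∀ {x} → T (member K x) → T (member extension x)
      extension-⊇ h = extend-intro 0ℤ (≈0 K h)

      generator∈extension : T (member extension g)
      generator∈extension = extend-intro 1ℤ (subst (K ⊢ g ≈_) (sym (identityʳ g)) (≈-refl K))

      -- The coordinate in K′/K. Elements outside K′ receive class 0 by default, so the fibres of C
      -- and S still partition these sets and every element is counted once.
      χ : Fin n → Fin q
      χ x with residue? x
      ... | yes (i , _) = i
      ... | no  _       = reduce 0ℤ

      χ-spec : ∀ {x} → T (member extension x) → K ⊢ x ≈ (⟦ χ x ⟧ · g)
      χ-spec {x} h with residue? x
      ... | yes (i , p) = congruent p

      χ-unique : ∀ {x} t → K ⊢ x ≈ (t · g) → χ x ≡ reduce t
      χ-unique {x} t h = sym (reduce-≡ (≈⇒~ (≈-trans K (≈-sym K h) (χ-spec (extend-intro t h)))))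

      χ-+ : ∀ {x y} → T (member extension x) → T (member extension y) → χ (x + y) ≡ χ x ⊕ χ y
      χ-+ {x} {y} h h′ = χ-unique (⟦ χ x ⟧ ℤ.+ ⟦ χ y ⟧)
        (subst (K ⊢ x + y ≈_) (sym (·-+ ⟦ χ x ⟧ ⟦ χ y ⟧ g)) (≈-+ K (χ-spec h) (χ-spec h′)))

      χ-minus : ∀ {x y} → T (member extension x) → T (member extension y) → χ (x - y) ≡ χ x ⊝ χ y
      χ-minus {x} {y} h h′ = χ-unique (⟦ χ x ⟧ ℤ.- ⟦ χ y ⟧)
        (subst (K ⊢ x - y ≈_) (sym (·-minus ⟦ χ x ⟧ ⟦ χ y ⟧ g)) (≈-minus K (χ-spec h) (χ-spec h′)))

      χ-coset : ∀ {x y} z → T (member extension (x - z)) → T (member extension (y - z)) → χ (x - z) ≡ χ (y - z) → K ⊢ x ≈ y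
      χ-coset {x} {y} z h h′ e = subst₂ (K ⊢_≈_) (minus-+ x z) (minus-+ y z)
        (≈-+ K (≈-trans K (χ-spec h) (subst (λ i → K ⊢ ⟦ i ⟧ · g ≈ (y - z)) (sym e) (≈-sym K (χ-spec h′)))) (≈-refl K))

      extension-bounded : ∀ p → p ≤ q → Bounded p K → Bounded p extension
      extension-bounded p p≤q boundedK A B C S cosetA cosetB 1≤A 1≤B cover C<p =
        from-points (#-witness A 1≤A) (#-witness B 1≤B)
        where
        from-points : (∃ λ x → T (A x)) → (∃ λ y → T (B y)) → Bounds A B C S
        from-points (a₀ , Aa₀) (b₀ , Bb₀) = record { weak = weak ; strong = strong }
          where
          -- Classes are measured from base points: a₀ for A, b₀ for B, a₀ + b₀ for C and a₀ - b₀
          -- for S. This moves the cosets of A and B into the subgroup and keeps sums and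
          -- differences compatible.
          fibre : (Fin n → Bool) → Fin n → Fin q → Fin n → Bool
          fibre P z k x = P x ∧ does (χ (x - z) Finₚ.≟ k)
          ∈P : ∀ P z k {x} → T (fibre P z k x) → T (P x)
          ∈P P z k {x} h = proj₁ (∧-elim {P x} h)
          χ≡ : ∀ P z k {x} → T (fibre P z k x) → χ (x - z) ≡ k
          χ≡ P z k {x} h = witness (χ (x - z) Finₚ.≟ k) (proj₂ (∧-elim {P x} h))
          own-fibre : ∀ P z {x} → T (P x) → T (fibre P z (χ (x - z)) x)
          own-fibre P z {x} h = ∧-intro h (holds (χ (x - z) Finₚ.≟ χ (x - z)) refl)
          Aᵢ = fibre A a₀
          Bⱼ = fibre B b₀
          Cₖ = fibre C (a₀ + b₀)
          Sₖ = fibre S (a₀ - b₀)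
          a = λ i → # (Aᵢ i)
          b = λ j → # (Bⱼ j)
          c = λ k → # (Cₖ k)
          σ = λ k → # (Sₖ k)
          sum-a : sum a ≡ # A
          sum-a = #-fibres A (λ x → χ (x - a₀))
          sum-b : sum b ≡ # B
          sum-b = #-fibres B (λ x → χ (x - b₀))
          sum-c : sum c ≡ # C
          sum-c = #-fibres C (λ x → χ (x - (a₀ + b₀)))
          sum-σ : sum σ ≡ # S
          sum-σ = #-fibres S (λ x → χ (x - (a₀ - b₀)))
          inA : ∀ {x} → T (A x) → T (member extension (x - a₀))
          inA {x} Ax = minus∈ (cosetA x a₀ Ax Aa₀)
          inB : ∀ {y} → T (B y) → T (member extension (y - b₀))
          inB {y} By = minus∈ (cosetB y b₀ By Bb₀)

          fibre-cover : ∀ i j → Cover (Aᵢ i) (Bⱼ j) (Cₖ (i ⊕ j)) (Sₖ (i ⊝ j))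
          fibre-cover i j x y h h′ = Sum.map
            (λ s → ∧-intro s (holds (χ ((x - y) - (a₀ - b₀)) Finₚ.≟ i ⊝ j)
              (trans (cong χ (minus-minus x y a₀ b₀)) (trans (χ-minus (inA Ax) (inB By)) (cong₂ _⊝_ (χ≡ A a₀ i h) (χ≡ B b₀ j h′))))))
            (λ c → ∧-intro c (holds (χ ((x + y) - (a₀ + b₀)) Finₚ.≟ i ⊕ j)
              (trans (cong χ (+-minus x y a₀ b₀)) (trans (χ-+ (inA Ax) (inB By)) (cong₂ _⊕_ (χ≡ A a₀ i h) (χ≡ B b₀ j h′))))))
            (cover x y Ax By)
            where
            Ax = ∈P A a₀ i h
            By = ∈P B b₀ j h′

          coset-a : ∀ i → Coset K (Aᵢ i)
          coset-a i x y h h′ = χ-coset a₀ (inA (∈P A a₀ i h)) (inA (∈P A a₀ i h′)) (trans (χ≡ A a₀ i h) (sym (χ≡ A a₀ i h′)))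
          coset-b : ∀ j → Coset K (Bⱼ j)
          coset-b j x y h h′ = χ-coset b₀ (inB (∈P B b₀ j h)) (inB (∈P B b₀ j h′)) (trans (χ≡ B b₀ j h) (sym (χ≡ B b₀ j h′)))

          fibred : Fibred addition a b c σ
          fibred = record
            { fibre-bound = λ i j 1≤ai 1≤bj → Bounds.weak (boundedK (Aᵢ i) (Bⱼ j) (Cₖ (i ⊕ j)) (Sₖ (i ⊝ j))
                (coset-a i) (coset-b j) 1≤ai 1≤bj (fibre-cover i j)
                (ℕₚ.≤-<-trans (#-mono {P = Cₖ (i ⊕ j)} {C} (λ x → ∈P C (a₀ + b₀) (i ⊕ j))) C<p))
            ; trivial-b = λ i j → cover-trivial-b (Aᵢ i) (Bⱼ j) (Cₖ (i ⊕ j)) (Sₖ (i ⊝ j)) (fibre-cover i j)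
            ; trivial-a = λ i j → cover-trivial-a (Aᵢ i) (Bⱼ j) (Cₖ (i ⊕ j)) (Sₖ (i ⊝ j)) (fibre-cover i j)
            -- Here |C| < p becomes the condition that sets of classes counted by `c` do not fill
            -- ℤ/q.
            ; c<q = subst (_< q) (sym sum-c) (ℕₚ.<-≤-trans C<p p≤q)
            ; 1≤a = subst (1 ≤_) (sym sum-a) 1≤A
            ; 1≤b = subst (1 ≤_) (sym sum-b) 1≤B
            }

          weak : # A ℕ.+ # B ≤ # C ℕ.+ (1 ℕ.+ ψ (# S))
          weak = subst₂ _≤_ (cong₂ ℕ._+_ sum-a sum-b) (cong₂ (λ c s → c ℕ.+ (1 ℕ.+ ψ s)) sum-c sum-σ)
            (weak-bound (ℕₚ.<-trans (s≤s (s≤s z≤n)) 2<q) fibred)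

          coset-whole : ∀ P z → Coset extension P → (∀ k → Coset K (fibre P z k)) →
                        # (supp (λ k → # (fibre P z k))) ≡ 1 → Coset K P
          coset-whole P z coset coset-k one x y Px Py = coset-k (χ (x - z)) x y (own-fibre P z Px)
            (subst (λ k → T (fibre P z k y)) (#-unique (supp f) (χ (y - z)) (χ (x - z)) (ℕₚ.≤-reflexive one) (in-supp y Py) (in-supp x Px))
                   (own-fibre P z Py))
            where
            f = λ k → # (fibre P z k)
            in-supp : ∀ x → T (P x) → T (supp f (χ (x - z)))
            in-supp x Px = pos-supp f (#-pos {P = fibre P z (χ (x - z))} x (own-fibre P z Px))

          strong : 2 ≤ # S → 9 ℕ.* (# S ℕ.* # S) ≤ # A ℕ.+ 5 ℕ.* # S ℕ.+ 3 →
                   9 ℕ.* (# S ℕ.* # S) ≤ # B ℕ.+ 5 ℕ.* # S ℕ.+ 3 → # A ℕ.+ # B ≤ # C ℕ.+ (# S ℕ.+ 2)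
          strong 2≤s hA hB = by-cosets ((# (supp a) ℕₚ.≟ 1) ×-dec (# (supp b) ℕₚ.≟ 1))
            where
            -- If A and B each meet one coset of K, the sharp bound for K applies to them as they
            -- are; otherwise the fibres enter, through their weak bound.
            by-cosets : Dec (# (supp a) ≡ 1 × # (supp b) ≡ 1) → # A ℕ.+ # B ≤ # C ℕ.+ (# S ℕ.+ 2)
            by-cosets (yes (one-a , one-b)) = Bounds.strong (boundedK A B C S (coset-whole A a₀ cosetA coset-a one-a)
              (coset-whole B b₀ cosetB coset-b one-b) 1≤A 1≤B cover C<p) 2≤s hA hB
            by-cosets (no ¬single) = subst₂ _≤_ (cong₂ ℕ._+_ sum-a sum-b) (cong₂ (λ c s → c ℕ.+ (s ℕ.+ 2)) sum-c sum-σ)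
              (strong-bound fibred (subst (2 ≤_) (sym sum-σ) 2≤s)
                (subst₂ (λ x s → 9 ℕ.* (s ℕ.* s) ≤ x ℕ.+ 5 ℕ.* s ℕ.+ 3) (sym sum-a) (sym sum-σ) hA)
                (subst₂ (λ x s → 9 ℕ.* (s ℕ.* s) ≤ x ℕ.+ 5 ℕ.* s ℕ.+ 3) (sym sum-b) (sym sum-σ) hB)
                ¬single)

    record Enlargement (p : ℕ) (K : Subgroup) (P : Fin n → Set) : Set where
      field
        larger  : Subgroup
        bounded : Bounded p larger
        ⊇       : ∀ x → T (member K x) → T (member larger x)
        spans   : ∀ x → P x → T (member larger x)

    -- Let y = product fs ⋆ x, where `fs` is the rest of the list. Either y already lies in K and
    -- `q` is skipped, or q ⋆ y ∈ K makes y the generator of an extension of index `q`. So only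
    -- listed primes occur as indices.
    adjoin : ∀ p fs → All (λ q → Prime q × 2 < q × p ≤ q) fs → ∀ K → Bounded p K → ∀ x →
             T (member K (product fs ⋆ x)) → Enlargement p K (_≡ x)
    adjoin p [] [] K bounded x h = record
      { larger = K ; bounded = bounded ; ⊇ = λ _ z → z ; spans = λ { _ refl → subst (T ∘ member K) (identityʳ x) h } }
    adjoin p (q ∷ fs) ((pq , 2<q , p≤q) ∷ good) K bounded x h = by-membership (T? (member K (product fs ⋆ x)))
      where
      by-membership : Dec (T (member K (product fs ⋆ x))) → Enlargement p K (_≡ x)
      by-membership (yes y∈K) = adjoin p fs good K bounded x y∈K
      by-membership (no  y∉K) = record
        { larger = larger ; bounded = bounded′ ; ⊇ = λ z z∈K → ⊇ z (extension-⊇ z∈K) ; spans = spans }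
        where
        open Extension K (product fs ⋆ x) q pq 2<q y∉K (subst (T ∘ member K) (sym (×-assocˡ x q (product fs))) h)
        open Enlargement (adjoin p fs good extension (extension-bounded p p≤q bounded) x generator∈extension)
          renaming (bounded to bounded′)

    -- Lagrange's theorem for abelian groups: translation by `x` permutes the elements, which adds n
    -- ⋆ x to the sum of all of them without changing it.
    order-⋆ : ∀ x → n ⋆ x ≡ 0#
    order-⋆ x = +-cancelʳ (sumG (λ i → i)) (begin
      n ⋆ x + sumG (λ i → i)              ≡⟨ cong (_+ sumG (λ i → i)) (sumGₚ.sum-replicate n {x}) ⟨
      sumG {n} (λ _ → x) + sumG (λ i → i) ≡⟨ sumGₚ.∑-distrib-+ (λ _ → x) (λ i → i) ⟨
      sumG (λ i → x + i)                  ≡⟨ sumGₚ.sum-permute (λ i → i) translation ⟨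
      sumG (λ i → i)                      ≡⟨ identityˡ _ ⟨
      0# + sumG (λ i → i)                 ∎)
      where
      open ≡-Reasoning
      module sumGₚ = CommutativeMonoidSumₚ commutativeMonoid
      sumG : ∀ {m} → (Fin m → Fin n) → Fin n
      sumG = sumGₚ.sum
      translation : Permutation n n
      translation = permutation (λ i → x + i) (λ i → - x + i)
        (λ i → trans (sym (assoc x (- x) i)) (trans (cong (_+ i) (inverseʳ x)) (identityˡ i)))
        (λ i → trans (sym (assoc (- x) x i)) (trans (cong (_+ i) (inverseˡ x)) (identityˡ i)))

    -- All elements are adjoined one after another; in the resulting subgroup any two elements are
    -- congruent, so the coset conditions hold for all A and B.
    bounded-group : ∀ p fs → All (λ q → Prime q × 2 < q × p ≤ q) fs → product fs ≡ n → ∀ A B C S →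
                    1 ≤ # A → 1 ≤ # B → Cover A B C S → # C < p → Bounds A B C S
    bounded-group p fs good fs≡n A B C S = bounded A B C S (λ x y _ _ → everything x y) (λ x y _ _ → everything x y)
      where
      generate : ∀ (xs : List (Fin n)) → Enlargement p trivial (_∈ xs)
      generate [] = record { larger = trivial ; bounded = trivial-bounded p ; ⊇ = λ _ h → h ; spans = λ _ () }
      generate (x ∷ xs) = record
        { larger = larger E′ ; bounded = bounded E′ ; ⊇ = λ y h → ⊇ E′ y (⊇ E y h)
        ; spans = λ { y (here y≡x) → spans E′ y y≡x ; y (there y∈xs) → ⊇ E′ y (spans E y y∈xs) } }
        where
        open Enlargement
        E = generate xs
        E′ = adjoin p fs good (larger E) (bounded E) x
          (subst (T ∘ member (larger E)) (sym (trans (cong (_⋆ x) fs≡n) (order-⋆ x))) (Subgroup.0∈ (larger E)))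
      open Enlargement (generate (allFin n))
      everything : ∀ x y → larger ⊢ x ≈ y
      everything x y = congruent (spans (x - y) (∈-allFin (x - y)))

open import Defs
open import Data.Nat using (ℕ; zero; suc; _+_; _*_; _∸_; _≤_; _⊓_)
open import Data.Fin.Subset using (Subset; Nonempty; ∣_∣)
open import Data.Product using (_,_)

-- From bit vectors to counts, and the theorem

module Subsets where

  open Counting
  open Fibres
  open Tower
  open import Data.Bool using (true; false; T)
  open import Data.Nat using (_<_; _<?_; z≤n; s≤s; s≤s⁻¹)
  open import Data.Nat.Properties hiding (_≟_)
  open import Data.Nat.Tactic.RingSolver using (solve-∀)
  open import Data.Nat.Divisibility using (_∣_; ∣-refl; ∣-trans; m∣m*n; n∣m*n)
  open import Data.Nat.Primality using (Prime)
  open import Data.Nat.Primality.Factorisation using (factorise; module PrimeFactorisation)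
  open import Data.Nat.ListAction using (product)
  open import Data.Fin using (zero; suc)
  open import Data.Fin.Properties using (any?; _≟_)
  open import Data.Fin.Subset using (_∈_)
  open import Data.Fin.Subset.Properties using (_∈?_)
  open import Data.List using ([]; _∷_)
  open import Data.List.Relation.Unary.All using (All; []; _∷_)
  open import Data.Vec using ([]; _∷_; lookup)
  open import Data.Vec.Properties using (lookup⇒[]=; []=⇒lookup; lookup∘tabulate)
  open import Data.Product using (_×_; _,_; proj₂)
  open import Data.Sum using (_⊎_; inj₁; inj₂)
  open import Data.Empty using (⊥-elim)
  open import Data.Unit using (tt)
  open import Function using (_∘_)
  open import Relation.Nullary using (Dec; yes; no; does; ¬?)
  open import Relation.Nullary.Decidable using (_×-dec_)
  open import Relation.Binary.PropositionalEquality

  #-lookup : ∀ {n} (P : Subset n) → # (lookup P) ≡ ∣ P ∣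
  #-lookup []            = refl
  #-lookup (true  ∷ P) = cong suc (#-lookup P)
  #-lookup (false ∷ P) = #-lookup P

  T⇒∈ : ∀ {n} (P : Subset n) {x} → T (lookup P x) → x ∈ P
  T⇒∈ P {x} h = lookup⇒[]= x P (is-true h)
    where
    is-true : ∀ {b} → T b → b ≡ true
    is-true {true} _ = refl

  ∈⇒T : ∀ {n} (P : Subset n) {x} → x ∈ P → T (lookup P x)
  ∈⇒T P h = subst T (sym ([]=⇒lookup h)) tt

  all-factors : ∀ {n} (P : ℕ → Set) fs → All Prime fs → product fs ∣ n → (∀ q → Prime q → q ∣ n → P q) → All P fs
  all-factors P []       []          _ h = []
  all-factors P (q ∷ fs) (pq ∷ primes) d h =
    h q pq (∣-trans (m∣m*n (product fs)) d) ∷ all-factors P fs primes (∣-trans (n∣m*n q) d) h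

  restrictedSumset-cover : ∀ {n} (G : FinAbGroup n) (A B S : Subset n) →
    Group.Cover G (lookup A) (lookup B) (lookup (restrictedSumset G A B S)) (lookup S)
  restrictedSumset-cover {n} G A B S x y Ax By = decide (x G.- y ∈? S)
    where
    module G = FinAbGroup G
    -- The decision in the definition of the restricted sumset, repeated verbatim so that
    -- `lookup∘tabulate` applies.
    summand? : ∀ z → Dec _
    summand? z = any? λ a → any? λ b → (a ∈? A) ×-dec ((b ∈? B) ×-dec (¬? ((a G.- b) ∈? S) ×-dec (a G.+ b ≟ z)))
    decide : Dec (x G.- y ∈ S) → T (lookup S (x G.- y)) ⊎ T (lookup (restrictedSumset G A B S) (x G.+ y))
    decide (yes h) = inj₁ (∈⇒T S h)
    decide (no ¬h) = inj₂ (subst T (sym (lookup∘tabulate (does ∘ summand?) (x G.+ y)))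
      (holds (summand? (x G.+ y)) (x , y , T⇒∈ A Ax , T⇒∈ B By , ¬h , refl)))

  -- For p = 2 and |A ∔ B| ≤ 1 the trivial bounds |A|, |B| ≤ |A ∔ B| + |S| only allow |S| = 1.
  even-bound : ∀ a b c s → 1 ≤ s → 9 * (s * s) ≤ a + 5 * s + 3 → a ≤ c + s → b ≤ c + s → c ≤ 1 → a + b ≤ c + (s + 2)
  even-bound a b c 1 _ _ ha hb hc = ≤-from (ha ⊞ hb ⊞ hc) 0 (lem a b c)
    where
    lem : ∀ a b c → a + b + ((c + 1) + ((c + 1) + 1)) + 0 ≡ c + (1 + 2) + (a + (b + c))
    lem = solve-∀
  even-bound a b c (suc (suc t)) _ h ha _ hc = ⊥-elim (n≮0 {0} (≤-from (h ⊞ ha ⊞ hc) (19 + 30 * t + 9 * (t * t)) (lem t a c)))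
    where
    lem : ∀ t a c → 1 + ((a + 5 * (2 + t) + 3) + ((c + (2 + t)) + 1)) + (19 + 30 * t + 9 * (t * t))
                  ≡ 0 + (9 * ((2 + t) * (2 + t)) + (a + c))
    lem = solve-∀

  module Theorem {n} (G : FinAbGroup (suc n)) (A B S : Subset (suc n)) (nonemptyA : Nonempty A) (nonemptyB : Nonempty B)
                 (nonemptyS : Nonempty S) (large : 9 * (∣ S ∣ * ∣ S ∣) ∸ 5 * ∣ S ∣ ∸ 3 ≤ ∣ A ∣ ⊓ ∣ B ∣)
                 (p : ℕ) (least : IsLeastPrimeFactor (suc n) p) where

    C : Subset (suc n)
    C = restrictedSumset G A B S

    cover : Group.Cover G (lookup A) (lookup B) (lookup C) (lookup S)
    cover = restrictedSumset-cover G A B S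

    positive : ∀ (P : Subset (suc n)) → Nonempty P → 1 ≤ # (lookup P)
    positive P (x , x∈P) = #-pos {P = lookup P} x (∈⇒T P x∈P)

    1≤A : 1 ≤ # (lookup A)
    1≤A = positive A nonemptyA
    1≤B : 1 ≤ # (lookup B)
    1≤B = positive B nonemptyB
    1≤S : 1 ≤ # (lookup S)
    1≤S = positive S nonemptyS

    -- Truncated subtraction does no harm in this direction: x ∸ y ≤ z always yields x ≤ y + z.
    largeness : ∀ m → ∣ A ∣ ⊓ ∣ B ∣ ≤ m → 9 * (# (lookup S) * # (lookup S)) ≤ m + 5 * # (lookup S) + 3
    largeness m h = subst (λ s → 9 * (s * s) ≤ m + 5 * s + 3) (sym (#-lookup S))
      (≤-trans (m∸n≤o⇒m≤n+o _ (5 * ∣ S ∣) (m∸n≤o⇒m≤n+o _ 3 (≤-trans large h)))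
        (≤-reflexive (lem (5 * ∣ S ∣) m)))
      where
      m∸n≤o⇒m≤n+o : ∀ m n {o} → m ∸ n ≤ o → m ≤ n + o
      m∸n≤o⇒m≤n+o m n h = ≤-trans (m≤n+m∸n m n) (+-monoʳ-≤ n h)
      lem : ∀ s m → s + (3 + m) ≡ m + s + 3
      lem = solve-∀

    largeA : 9 * (# (lookup S) * # (lookup S)) ≤ # (lookup A) + 5 * # (lookup S) + 3
    largeA = largeness (# (lookup A)) (≤-trans (m⊓n≤m ∣ A ∣ ∣ B ∣) (≤-reflexive (sym (#-lookup A))))

    largeB : 9 * (# (lookup S) * # (lookup S)) ≤ # (lookup B) + 5 * # (lookup S) + 3
    largeB = largeness (# (lookup B)) (≤-trans (m⊓n≤n ∣ A ∣ ∣ B ∣) (≤-reflexive (sym (#-lookup B))))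

    Goal : Set
    Goal = # (lookup A) + # (lookup B) ≤ # (lookup C) + (# (lookup S) + 2)

    even : # (lookup C) < p → p ≤ 2 → Goal
    even C<p p≤2 = even-bound (# (lookup A)) (# (lookup B)) (# (lookup C)) (# (lookup S)) 1≤S largeA
      (Group.cover-trivial-a G (lookup A) (lookup B) (lookup C) (lookup S) cover 1≤B)
      (Group.cover-trivial-b G (lookup A) (lookup B) (lookup C) (lookup S) cover 1≤A)
      (s≤s⁻¹ (≤-trans C<p p≤2))

    odd : # (lookup C) < p → 2 < p → Goal
    odd C<p 2<p = by-size (# (lookup S)) refl
      where
      open PrimeFactorisation (factorise (suc n))
      factors-good : All (λ q → Prime q × 2 < q × p ≤ q) factors
      factors-good = all-factors _ factors factorsPrime (subst (_∣ suc n) isFactorisation ∣-refl)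
        λ q pq q∣n → pq , <-≤-trans 2<p (proj₂ (proj₂ least) q pq q∣n) , proj₂ (proj₂ least) q pq q∣n
      open Group.Bounds (Group.bounded-group G p factors factors-good (sym isFactorisation)
        (lookup A) (lookup B) (lookup C) (lookup S) 1≤A 1≤B cover C<p)
      by-size : ∀ s → # (lookup S) ≡ s → Goal
      by-size zero          e = ⊥-elim (<⇒≢ 1≤S (sym e))
      -- For |S| = 1 the weak bound is already sharp: 1 + ψ 1 = 3 = |S| + 2.
      by-size (suc zero)    e = subst (λ s → # (lookup A) + # (lookup B) ≤ # (lookup C) + (s + 2)) (sym e)
        (subst (λ s → # (lookup A) + # (lookup B) ≤ # (lookup C) + (1 + ψ s)) e weak)
      by-size (suc (suc s)) e = strong (subst (2 ≤_) (sym e) (s≤s (s≤s z≤n))) largeA largeB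

    conclusion : (∣ A ∣ + ∣ B ∣ ∸ ∣ S ∣ ∸ 2) ⊓ p ≤ ∣ C ∣
    conclusion = by-size (# (lookup C) <? p) (2 <? p)
      where
      from-goal : Goal → (∣ A ∣ + ∣ B ∣ ∸ ∣ S ∣ ∸ 2) ⊓ p ≤ ∣ C ∣
      from-goal h = ≤-trans (m⊓n≤m _ p) (subst (_≤ ∣ C ∣) (sym (∸-+-assoc (∣ A ∣ + ∣ B ∣) ∣ S ∣ 2))
        (m≤n+o⇒m∸n≤o _ (∣ S ∣ + 2) (≤-trans (subst₂ _≤_ (cong₂ _+_ (#-lookup A) (#-lookup B))
          (cong₂ (λ c s → c + (s + 2)) (#-lookup C) (#-lookup S)) h) (≤-reflexive (+-comm ∣ C ∣ _)))))
      by-size : Dec (# (lookup C) < p) → Dec (2 < p) → (∣ A ∣ + ∣ B ∣ ∸ ∣ S ∣ ∸ 2) ⊓ p ≤ ∣ C ∣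
      by-size (no  h) _        = ≤-trans (m⊓n≤n (∣ A ∣ + ∣ B ∣ ∸ ∣ S ∣ ∸ 2) p) (subst (p ≤_) (#-lookup C) (≮⇒≥ h))
      by-size (yes h) (yes h′) = from-goal (odd h h′)
      by-size (yes h) (no  h′) = from-goal (even h (≮⇒≥ h′))

theorem1p2 : (n : ℕ) (G : FinAbGroup n) (A B S : Subset n) →
    Nonempty A → Nonempty B → Nonempty S →
    9 * (∣ S ∣ * ∣ S ∣) ∸ 5 * ∣ S ∣ ∸ 3 ≤ ∣ A ∣ ⊓ ∣ B ∣ →
    (p : ℕ) → IsLeastPrimeFactor n p →
    (∣ A ∣ + ∣ B ∣ ∸ ∣ S ∣ ∸ 2) ⊓ p ≤ ∣ restrictedSumset G A B S ∣
theorem1p2 (suc n) = Subsets.Theorem.conclusion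
theorem1p2 zero G A B S (() , _)
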